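{- Let $r\ge 2$ be a prime power, let $n$ be a positive integer such that $r-1$ divides $n-1$, let $k\ge 4$, and let $t=\frac{r(k-3)}{2(k-1)}+1$. Then $\chi(\mathrm{KG}^r(k,n;t))=\left\lceil \frac{n-r(k-1)}{r-1}\right\rceil$.
   Context: For a $k$-element set $\sigma\subseteq\{1,\dots,n\}$, the complement $\{1,\dots,n\}\setminus\sigma$ splits, in the cyclic order of $\{1,\dots,n\}$, into $k$ (possibly empty) gaps between cyclically consecutive elements of $\sigma$; let their cardinalities be $g_1,\dots,g_k$, indexed so that $g_k=\max_i g_i$. For a real number $t$, $\sigma$ is called $t$-stable on average if $t\le \frac{1}{k-1}\sum_{i=1}^{k-1}g_i+1$. The Kneser hypergraph $\mathrm{KG}^r(k,n)$ is the $r$-uniform hypergraph whose vertices are the $k$-element subsets of $\{1,\dots,n\}$, with $r$ vertices forming a hyperedge when the corresponding sets are pairwise disjoint. $\mathrm{KG}^r(k,n;t)$ is its subhypergraph induced by the vertices corresponding to sets that are $t$-stable on average. A $c$-coloring of a hypergraph is a map from its vertices to $\{1,\dots,c\}$ with no monochromatic hyperedge; $\chi$ is the least such $c$.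
   Formalization: The theorem additionally assumes n ≥ rk, so that KG^r(k,n) can have hyperedges; for smaller n the hypergraph has none and the stated formula can fail, e.g. r=2, k=4, n=6, where a stable set exists but the formula gives 0. -}

module Defs where

open import Data.Nat as ℕ using (ℕ; zero; suc; _∸_; _⊔_)
open import Data.Integer as ℤ using (ℤ; +_)
open import Data.Rational as ℚ using (ℚ; _/_; 0ℚ)
open import Data.Bool using (Bool; true; false)
open import Data.List using (List; []; _∷_; [_]; foldr)
open import Data.Nat.ListAction using (sum)
open import Data.Vec using (Vec; toList)
open import Data.Fin using (Fin)
open import Data.Fin.Subset using (Subset; ∣_∣; _∩_; Empty)
open import Data.Nat.Primality using (Prime)
open import Data.Product using (Σ; _×_; ∃)
open import Relation.Binary.PropositionalEquality using (_≡_)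
open import Relation.Nullary using (¬_)

-- Rational fraction a / d; the value for d = 0 is an arbitrary
-- junk value (0) and is never used in the theorem (denominators are ≥ 1 there).
frac : ℤ → ℕ → ℚ
frac a zero    = 0ℚ
frac a (suc d) = a / suc d

IsPrimePower : ℕ → Set
IsPrimePower r = Σ ℕ λ p → Σ ℕ λ m → Prime p × (1 ℕ.≤ m) × (r ≡ p ℕ.^ m)

-- The ground set {1,…,n} is represented by Fin n (element i ↦ i+1),
-- with its cyclic order 0 < 1 < … < n-1 < 0.
-- Positions (as naturals, ascending) of the elements of a subset.
positionsFrom : ℕ → List Bool → List ℕ
positionsFrom i []            = []
positionsFrom i (true  ∷ bs) = i ∷ positionsFrom (suc i) bs
positionsFrom i (false ∷ bs) = positionsFrom (suc i) bs

positions : ∀ {n} → Subset n → List ℕ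
positions σ = positionsFrom 0 (toList σ)

-- gapsAux n first prev rest: sizes of the gaps between cyclically
-- consecutive elements, the last one wrapping around from the last
-- element back to the first.
gapsAux : ℕ → ℕ → ℕ → List ℕ → List ℕ
gapsAux n first prev []       = [ (n ∸ suc prev) ℕ.+ first ]
gapsAux n first prev (q ∷ qs) = (q ∸ suc prev) ∷ gapsAux n first q qs

gaps : ∀ {n} → Subset n → List ℕ
gaps {n} σ with positions σ
... | []     = []
... | p ∷ ps = gapsAux n p p ps

maximum : List ℕ → ℕ
maximum = foldr _⊔_ 0

-- Σ_{i=1}^{k-1} g_i where the gaps are indexed so that g_k is a maximal one:
-- the sum of all gaps minus one maximal gap.
sumNonMaxGaps : ∀ {n} → Subset n → ℕ
sumNonMaxGaps σ = sum (gaps σ) ∸ maximum (gaps σ)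

StableOnAverage : ℚ → ∀ {n} → Subset n → Set
StableOnAverage t σ = t ℚ.≤ (frac (+ sumNonMaxGaps σ) (∣ σ ∣ ∸ 1) ℚ.+ ℚ.1ℚ)

Vertex : (k n : ℕ) (t : ℚ) → Set
Vertex k n t = Σ (Subset n) λ σ → (∣ σ ∣ ≡ k) × StableOnAverage t σ

Disjoint : ∀ {n} → Subset n → Subset n → Set
Disjoint σ τ = Empty (σ ∩ τ)

-- r vertices form a hyperedge of KG^r(k,n;t) when they are pairwise disjoint
-- (pairwise disjoint nonempty sets are automatically distinct).
IsHyperedge : ∀ {r k n t} → (Fin r → Vertex k n t) → Set
IsHyperedge {r} e = ∀ (i j : Fin r) → ¬ (i ≡ j) →
  Disjoint (Σ.proj₁ (e i)) (Σ.proj₁ (e j))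
  where open import Data.Product as Σ using ()

IsColoring : (r k n : ℕ) (t : ℚ) (c : ℕ) → (Vertex k n t → Fin c) → Set
IsColoring r k n t c f =
  ∀ (e : Fin r → Vertex k n t) → IsHyperedge e → ¬ (∀ (i j : Fin r) → f (e i) ≡ f (e j))

Colorable : (r k n : ℕ) (t : ℚ) (c : ℕ) → Set
Colorable r k n t c = Σ (Vertex k n t → Fin c) (IsColoring r k n t c)

ChromaticNumberIs : (r k n : ℕ) (t : ℚ) (χ : ℕ) → Set
ChromaticNumberIs r k n t χ =
  Colorable r k n t χ × (∀ c → Colorable r k n t c → χ ℕ.≤ c)

{-# OPTIONS --safe #-}
module Submission where

-- Upper bound: colour a set by the block of r - 1 consecutive elements that
-- contains its minimum, giving one colour to all sets in a final stretch of fewer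
-- than r k elements; disjoint sets have distinct minima.
--
-- Lower bound: put D = ⌈r (k-1) / (r-1)⌉ and suppose that c ≤ χ - 1 colours
-- suffice, so that (D + c) (r - 1) < n. Read a partial r-partition of {1,…,n} as
-- a sign vector x, and cut it greedily into blocks, each missing at least one of
-- the r signs. If x has at most D blocks, label it by the number of completed
-- blocks and the set of signs in the current one. Otherwise (r-1) D + 1 > r (k-1)
-- entries bring a new sign to their block or start a new block, so k of them share
-- a sign; as every sign recurs within 2 (r-1) such entries, k of them can be chosen
-- to be stable on average. Label x by the largest colour of a stable set in one of
-- its classes and the set of the signs whose class contains a stable set of this
-- colour, which is proper as no hyperedge is monochromatic. This is a monotone
-- S_r-equivariant map from the nonzero sign vectors of length n to levels × proper
-- nonempty sets of signs, of rank less than n.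
--
-- Such a map does not exist when r = p^m. Let G = (ℤ/p)^m act on the signs by
-- translations; no proper nonempty set of signs is fixed by G. As in Smith theory,
-- going through the generators one at a time, the unit cochain of the target is a
-- boundary in the total complex of (periodic resolution of G) ⊗ (cochains mod p):
-- on chains moved by a generator, the kernels of σ - 1 and of the norm are each
-- other's images. Its pullback to the n-fold join of copies of the sign set is
-- paired with the chains given by iterated coning. The pairing is 1 on the
-- resolution's generator of degree 0, and equals a pairing in degree n - 1, where
-- normalized cochains vanish because the rank takes fewer than n values.

-- As `r` is only a prime power, a proper set of signs may well be fixed by some generators, so the
-- action on the target is not free. Points fixed by `g` are therefore handed on to the remaining
-- generators; only a set fixed by all of them would stop the induction, and transitivity of the
-- translations excludes it.
--
-- No chain is ever formed: a chain is represented by the functional that evaluates functions on it,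
-- so that cones, boundaries and subdivision act on functions.
--
-- The threshold comes from the shape of the blocks. A completed block has exactly `r - 1` counted
-- entries, of distinct signs, and the one sign that it misses starts the next block. Successive
-- counted entries of one sign are thus between `2` and `2 (r - 1)` counted entries apart. In the
-- choice of `k` of them no cyclic gap may be too large; with `K = r (k - 3) + 2 (k - 1)`, twice the
-- length required of the complement of a gap, the worst case needs
-- `K + 2 (r - 1) - 2 (k - 2) = r (k - 1)` to be at most `D (r - 1)`.
--
-- As `n - 1 = q (r - 1)`, rounding `D` up loses nothing: `q - D + 1` is the ceiling in the theorem.

module Obstruction where
  open import Data.Nat as ℕ using (ℕ; zero; suc; s≤s; z≤n; _^_)
  open import Data.Integer using (ℤ; +_; 0ℤ; 1ℤ; _+_; _*_; -_; _-_; -[1+_])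
  import Data.Integer.Properties as ℤ
  open import Algebra.Properties.AbelianGroup ℤ.+-0-abelianGroup using (∙-cancelˡ)
  open import Data.Integer.Tactic.RingSolver using (solve-∀)
  open import Data.List as List using (List; []; _∷_)
  open import Data.List.Relation.Unary.All as All using (All; []; _∷_)
  open import Data.Vec as Vec using (Vec; []; _∷_; lookup; tabulate)
  open import Data.Product using (_×_; _,_; proj₁; proj₂; ∃)
  open import Data.Empty using (⊥; ⊥-elim)
  open import Relation.Binary.PropositionalEquality using (_≡_; _≢_; refl; sym; trans; cong; cong₂; subst; module ≡-Reasoning)
  open import Relation.Binary.Bundles using (Setoid)
  open import Relation.Nullary
  import Data.List.Relation.Unary.All.Properties as All
  import Data.Vec.Relation.Unary.All as VecAll
  open import Data.Unit using (⊤; tt)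
  open import Relation.Binary.Definitions using (DecidableEquality)
  import Data.Nat.Properties as ℕ
  open import Data.Maybe as Maybe using (Maybe; just; nothing)
  open import Data.Sum using (_⊎_; inj₁; inj₂)
  open import Data.Nat.DivMod using (_%_; m%n<n; %-distribˡ-+; m%n%n≡m%n; m<n⇒m%n≡m; [m+n]%n≡m%n)
  open import Data.Nat.Primality using (Prime; ¬prime[0]; ¬prime[1])
  open import Data.Nat.Coprimality using (coprime-Bézout; prime⇒coprime)
  open import Data.Nat.GCD using (module Bézout)
  import Data.Integer as ℤ
  open import Data.Bool using (Bool; true; false; if_then_else_; _∨_)
  import Data.Bool.Properties as Bool
  open import Data.Fin as Fin using (Fin; zero; suc; toℕ; fromℕ<; combine; remQuot)
  import Data.Fin.Properties as Fin
  open import Data.Fin.Subset using (Subset)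
  import Data.Vec.Properties as Vec
  open import Data.List.Membership.Propositional.Properties using (∈-allFin)
  open import Data.Product.Properties using (≡-dec)
  import Data.Vec.Relation.Unary.All.Properties as VecAll
  open import Function using (case_of_)
  open import Relation.Nullary.Decidable using (dec-true)

  -- Congruence modulo p

  module Modular (p : ℕ) where

    infix 4 _≈_
    -- Coefficients remain integers and only their equality is taken modulo `p`, so that identities
    -- can be left to the ring solver over ℤ.
    record _≈_ (a b : ℤ) : Set where
      constructor congruent
      field
        quot : ℤ
        eq   : a ≡ b + quot * + p

    reflexive : ∀ {a b} → a ≡ b → a ≈ b
    reflexive {a} refl = congruent 0ℤ (lem a (+ p))
      where
      lem : ∀ a p → a ≡ a + 0ℤ * p
      lem = solve-∀

    ≈-sym : ∀ {a b} → a ≈ b → b ≈ a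
    ≈-sym {_} {b} (congruent q refl) = congruent (- q) (lem b q (+ p))
      where
      lem : ∀ b q p → b ≡ b + q * p + - q * p
      lem = solve-∀

    ≈-trans : ∀ {a b c} → a ≈ b → b ≈ c → a ≈ c
    ≈-trans {c = c} (congruent q refl) (congruent q′ refl) = congruent (q + q′) (lem c q q′ (+ p))
      where
      lem : ∀ c q q′ p → c + q′ * p + q * p ≡ c + (q + q′) * p
      lem = solve-∀

    setoid : Setoid _ _
    setoid = record
      { Carrier = ℤ ; _≈_ = _≈_
      ; isEquivalence = record { refl = reflexive refl ; sym = ≈-sym ; trans = ≈-trans } }

    +-cong : ∀ {a b c d} → a ≈ b → c ≈ d → a + c ≈ b + d
    +-cong {_} {b} {_} {d} (congruent q refl) (congruent q′ refl) =
      congruent (q + q′) (lem b d q q′ (+ p))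
      where
      lem : ∀ b d q q′ p → b + q * p + (d + q′ * p) ≡ b + d + (q + q′) * p
      lem = solve-∀

    neg-cong : ∀ {a b} → a ≈ b → - a ≈ - b
    neg-cong {_} {b} (congruent q refl) = congruent (- q) (lem b q (+ p))
      where
      lem : ∀ b q p → - (b + q * p) ≡ - b + - q * p
      lem = solve-∀

    *-cong : ∀ {a b c d} → a ≈ b → c ≈ d → a * c ≈ b * d
    *-cong {_} {b} {_} {d} (congruent q refl) (congruent q′ refl) =
      congruent (q * d + b * q′ + q * q′ * + p) (lem b d q q′ (+ p))
      where
      lem : ∀ b d q q′ p →
        (b + q * p) * (d + q′ * p) ≡ b * d + (q * d + b * q′ + q * q′ * p) * p
      lem = solve-∀

    p≈0 : + p ≈ 0ℤ
    p≈0 = congruent 1ℤ (lem (+ p))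
      where
      lem : ∀ p → p ≡ 0ℤ + 1ℤ * p
      lem = solve-∀

  -- Periodic resolutions of elementary abelian p-groups

  iterate : {A : Set} → (A → A) → ℕ → A → A
  iterate f zero    x = x
  iterate f (suc q) x = iterate f q (f x)

  -- Gen indexes commuting generators of an elementary abelian p-group.
  module Equivariant (p : ℕ) (Gen : Set) where
    open Modular p public
    open import Relation.Binary.Reasoning.Setoid setoid

    record Space : Set₁ where
      field
        Point    : Set
        act      : Gen → Point → Point
        commute  : ∀ g h z → act g (act h z) ≡ act h (act g z)
        order    : ∀ g z → iterate (act g) p z ≡ z

    module _ (X : Space) where
      open Space X

      Fun : Set
      Fun = Point → ℤ

      partialNorm : Gen → ℕ → Fun → Fun
      partialNorm g zero    u z = 0ℤ
      partialNorm g (suc q) u z = u z + partialNorm g q u (act g z)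

      -- The alternating maps g - 1 and 1 + g + ⋯ + g^(p-1) of the periodic
      -- resolution of the cyclic group of order p.
      periodic : ℕ → Gen → Fun → Fun
      periodic 0             g u z = u (act g z) - u z
      periodic 1             g u z = partialNorm g p u z
      periodic (suc (suc i)) g u z = periodic i g u z

    signed : ℕ → ℤ → ℤ
    signed zero    a = a
    signed (suc i) a = - signed i a

    Family : ℕ → Set → Set
    Family m Z = Vec ℕ m → Z → ℤ

    -- The group part of the total differential on (tensor product of periodic
    -- resolutions) ⊗ (functions on X), with one resolution for each generator.
    ∂ : (X : Space) → ∀ {m} → Vec Gen m → Family m (Space.Point X) → Family m (Space.Point X)
    ∂ X []       U a z = 0ℤ
    ∂ X (g ∷ gs) U (i ∷ a) z =
      signed i (∂ X gs (λ b → U (i ∷ b)) a z) + periodic X i g (U (suc i ∷ a)) z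

    signed-cong : ∀ i {a b} → a ≈ b → signed i a ≈ signed i b
    signed-cong zero    e = e
    signed-cong (suc i) e = neg-cong (signed-cong i e)

    signed-+ : ∀ i a b → signed i (a + b) ≡ signed i a + signed i b
    signed-+ zero    a b = refl
    signed-+ (suc i) a b = trans (cong -_ (signed-+ i a b)) (ℤ.neg-distrib-+ (signed i a) (signed i b))

    signed-neg : ∀ i a → signed i (- a) ≡ - signed i a
    signed-neg zero    a = refl
    signed-neg (suc i) a = cong -_ (signed-neg i a)

    signed-0 : ∀ i → signed i 0ℤ ≡ 0ℤ
    signed-0 zero    = refl
    signed-0 (suc i) = cong -_ (signed-0 i)

    record Linear (X Y : Space) (T : Fun X → Fun Y) : Set where
      field
        T-+    : ∀ u v z → T (λ x → u x + v x) z ≈ T u z + T v z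
        T-neg  : ∀ u z → T (λ x → - u x) z ≈ - T u z

      T-0 : ∀ z → T (λ _ → 0ℤ) z ≈ 0ℤ
      T-0 z = begin
        t              ≡⟨ lem t ⟩
        t + t + - t    ≈⟨ +-cong (T-+ (λ _ → 0ℤ) (λ _ → 0ℤ) z) (reflexive refl) ⟨
        t + - t        ≡⟨ ℤ.+-inverseʳ t ⟩
        0ℤ             ∎
        where
        t = T (λ _ → 0ℤ) z
        lem : ∀ t → t ≡ t + t + - t
        lem = solve-∀

      T-signed : ∀ i u z → T (λ x → signed i (u x)) z ≈ signed i (T u z)
      T-signed zero    u z = reflexive refl
      T-signed (suc i) u z =
        ≈-trans (T-neg (λ x → signed i (u x)) z) (neg-cong (T-signed i u z))

    record Equivariantly (X Y : Space) (T : Fun X → Fun Y) : Set where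
      field
        linear : Linear X Y T
        T-act  : ∀ g u z → T (λ x → u (Space.act X g x)) z ≈ T u (Space.act Y g z)
      open Linear linear public

    module _ {X Y : Space} {T : Fun X → Fun Y} (E : Equivariantly X Y T) where
      open Equivariantly E

      T-partialNorm : ∀ g q u z → T (partialNorm X g q u) z ≈ partialNorm Y g q (T u) z
      T-partialNorm g zero    u z = T-0 z
      T-partialNorm g (suc q) u z = begin
        T (λ x → u x + partialNorm X g q u (Space.act X g x)) z
          ≈⟨ T-+ u (λ x → partialNorm X g q u (Space.act X g x)) z ⟩
        T u z + T (λ x → partialNorm X g q u (Space.act X g x)) z
          ≈⟨ +-cong (reflexive {T u z} refl) (≈-trans (T-act g (partialNorm X g q u) z)
               (T-partialNorm g q u (Space.act Y g z))) ⟩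
        T u z + partialNorm Y g q (T u) (Space.act Y g z) ∎

      T-periodic : ∀ i g u z → T (periodic X i g u) z ≈ periodic Y i g (T u) z
      T-periodic 0 g u z = begin
        T (λ x → u (Space.act X g x) - u x) z
          ≈⟨ T-+ (λ x → u (Space.act X g x)) (λ x → - u x) z ⟩
        T (λ x → u (Space.act X g x)) z + T (λ x → - u x) z
          ≈⟨ +-cong (T-act g u z) (T-neg u z) ⟩
        T u (Space.act Y g z) - T u z ∎
      T-periodic 1             g u z = T-partialNorm g p u z
      T-periodic (suc (suc i)) g u z = T-periodic i g u z

      T-∂ : ∀ {m} (gs : Vec Gen m) (U : Family m (Space.Point X)) a z →
        T (∂ X gs U a) z ≈ ∂ Y gs (λ b → T (U b)) a z
      T-∂ []       U []      z = T-0 z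
      T-∂ (g ∷ gs) U (i ∷ a) z = begin
        T (λ x → signed i (∂ X gs Uᵢ a x) + periodic X i g (U (suc i ∷ a)) x) z
          ≈⟨ T-+ (λ x → signed i (∂ X gs Uᵢ a x)) (periodic X i g (U (suc i ∷ a))) z ⟩
        T (λ x → signed i (∂ X gs Uᵢ a x)) z + T (periodic X i g (U (suc i ∷ a))) z
          ≈⟨ +-cong (≈-trans (T-signed i (∂ X gs Uᵢ a) z) (signed-cong i (T-∂ gs Uᵢ a z)))
               (T-periodic i g (U (suc i ∷ a)) z) ⟩
        signed i (∂ Y gs (λ b → T (Uᵢ b)) a z) + periodic Y i g (T (U (suc i ∷ a))) z ∎
        where Uᵢ = λ b → U (i ∷ b)

    module Operators (X : Space) where
      open Space X

      -- Congruences are relative to an invariant set `G` because the later ones hold only on chains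
      -- with all entries in `P`, on fixed chains, or on degenerate chains.
      module _ (G : Point → Set) (closed : ∀ g {z} → G z → G (act g z)) where

        partialNorm-cong : ∀ g q {u v : Fun X} → (∀ {z} → G z → u z ≈ v z) →
          ∀ {z} → G z → partialNorm X g q u z ≈ partialNorm X g q v z
        partialNorm-cong g zero    e G = reflexive refl
        partialNorm-cong g (suc q) e G = +-cong (e G) (partialNorm-cong g q e (closed g G))

        periodic-cong : ∀ i g {u v : Fun X} → (∀ {z} → G z → u z ≈ v z) →
          ∀ {z} → G z → periodic X i g u z ≈ periodic X i g v z
        periodic-cong 0             g e G = +-cong (e (closed g G)) (neg-cong (e G))
        periodic-cong 1             g e G = partialNorm-cong g p e G
        periodic-cong (suc (suc i)) g e G = periodic-cong i g e G

        ∂-cong : ∀ {m} (gs : Vec Gen m) {U V : Family m Point} →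
          (∀ a {z} → G z → U a z ≈ V a z) → ∀ a {z} → G z → ∂ X gs U a z ≈ ∂ X gs V a z
        ∂-cong []       e []      G = reflexive refl
        ∂-cong (g ∷ gs) e (i ∷ a) G =
          +-cong (signed-cong i (∂-cong gs (λ b → e (i ∷ b)) a G)) (periodic-cong i g (e (suc i ∷ a)) G)

        partialNorm-vanish : ∀ g q {u : Fun X} → (∀ {z} → G z → u z ≈ 0ℤ) →
          ∀ {z} → G z → partialNorm X g q u z ≈ 0ℤ
        partialNorm-vanish g zero    e Gz = reflexive refl
        partialNorm-vanish g (suc q) e Gz = +-cong (e Gz) (partialNorm-vanish g q e (closed g Gz))

        periodic-vanish : ∀ i g {u : Fun X} → (∀ {z} → G z → u z ≈ 0ℤ) →
          ∀ {z} → G z → periodic X i g u z ≈ 0ℤ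
        periodic-vanish 0             g e Gz = +-cong (e (closed g Gz)) (neg-cong (e Gz))
        periodic-vanish 1             g e Gz = partialNorm-vanish g p e Gz
        periodic-vanish (suc (suc i)) g e Gz = periodic-vanish i g e Gz

        ∂-vanish : ∀ {m} (gs : Vec Gen m) {U : Family m Point} →
          (∀ a {z} → G z → U a z ≈ 0ℤ) → ∀ a {z} → G z → ∂ X gs U a z ≈ 0ℤ
        ∂-vanish []       e []      Gz = reflexive refl
        ∂-vanish (g ∷ gs) e (i ∷ a) Gz = +-cong
          (≈-trans (signed-cong i (∂-vanish gs (λ b → e (i ∷ b)) a Gz)) (reflexive (signed-0 i)))
          (periodic-vanish i g (e (suc i ∷ a)) Gz)

      partialNorm-+ : ∀ g q u v z →
        partialNorm X g q (λ x → u x + v x) z ≡ partialNorm X g q u z + partialNorm X g q v z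
      partialNorm-+ g zero    u v z = refl
      partialNorm-+ g (suc q) u v z =
        trans (cong (λ w → u z + v z + w) (partialNorm-+ g q u v (act g z))) (lem (u z) (v z) _ _)
        where
        lem : ∀ a b c d → a + b + (c + d) ≡ a + c + (b + d)
        lem = solve-∀

      partialNorm-neg : ∀ g q u z → partialNorm X g q (λ x → - u x) z ≡ - partialNorm X g q u z
      partialNorm-neg g zero    u z = refl
      partialNorm-neg g (suc q) u z =
        trans (cong (λ w → - u z + w) (partialNorm-neg g q u (act g z)))
          (sym (ℤ.neg-distrib-+ (u z) _))

      periodic-+ : ∀ i g u v z →
        periodic X i g (λ x → u x + v x) z ≡ periodic X i g u z + periodic X i g v z
      periodic-+ 0 g u v z = lem (u (act g z)) (v (act g z)) (u z) (v z)
        where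
        lem : ∀ a b c d → a + b - (c + d) ≡ a - c + (b - d)
        lem = solve-∀
      periodic-+ 1             g u v z = partialNorm-+ g p u v z
      periodic-+ (suc (suc i)) g u v z = periodic-+ i g u v z

      periodic-neg : ∀ i g u z → periodic X i g (λ x → - u x) z ≡ - periodic X i g u z
      periodic-neg 0 g u z = lem (u (act g z)) (u z)
        where
        lem : ∀ a b → - a - - b ≡ - (a - b)
        lem = solve-∀
      periodic-neg 1             g u z = partialNorm-neg g p u z
      periodic-neg (suc (suc i)) g u z = periodic-neg i g u z

      partialNorm-act : ∀ g h q u z →
        partialNorm X g q (λ x → u (act h x)) z ≡ partialNorm X g q u (act h z)
      partialNorm-act g h zero    u z = refl
      partialNorm-act g h (suc q) u z = cong (λ w → u (act h z) + w)
        (trans (partialNorm-act g h q u (act g z)) (cong (partialNorm X g q u) (commute h g z)))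

      periodic-act : ∀ i g h u z →
        periodic X i g (λ x → u (act h x)) z ≡ periodic X i g u (act h z)
      periodic-act 0 g h u z = cong (λ y → u y - u (act h z)) (commute h g z)
      periodic-act 1             g h u z = partialNorm-act g h p u z
      periodic-act (suc (suc i)) g h u z = periodic-act i g h u z

      periodic-equivariant : ∀ i g → Equivariantly X X (periodic X i g)
      periodic-equivariant i g = record
        { linear = record
          { T-+    = λ u v z → reflexive (periodic-+ i g u v z)
          ; T-neg  = λ u z → reflexive (periodic-neg i g u z) }
        ; T-act  = λ h u z → reflexive (periodic-act i g h u z) }

      act-equivariant : ∀ g → Equivariantly X X (λ u z → u (act g z))
      act-equivariant g = record
        { linear = record
          { T-+    = λ u v z → reflexive refl
          ; T-neg  = λ u z → reflexive refl }
        ; T-act  = λ h u z → reflexive (cong u (commute h g z)) }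

      ∂-+ : ∀ {m} (gs : Vec Gen m) (U V : Family m Point) a z →
        ∂ X gs (λ b x → U b x + V b x) a z ≡ ∂ X gs U a z + ∂ X gs V a z
      ∂-+ []       U V []      z = refl
      ∂-+ (g ∷ gs) U V (i ∷ a) z = trans
        (cong₂ _+_ (trans (cong (signed i) (∂-+ gs Uᵢ Vᵢ a z)) (signed-+ i (∂ X gs Uᵢ a z) (∂ X gs Vᵢ a z)))
          (periodic-+ i g (U (suc i ∷ a)) (V (suc i ∷ a)) z))
        (lem (signed i (∂ X gs Uᵢ a z)) _ _ _)
        where
        Uᵢ = λ b → U (i ∷ b)
        Vᵢ = λ b → V (i ∷ b)
        lem : ∀ a b c d → a + b + (c + d) ≡ a + c + (b + d)
        lem = solve-∀

      ∂-neg : ∀ {m} (gs : Vec Gen m) (U : Family m Point) a z →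
        ∂ X gs (λ b x → - U b x) a z ≡ - ∂ X gs U a z
      ∂-neg []       U []      z = refl
      ∂-neg (g ∷ gs) U (i ∷ a) z = trans
        (cong₂ _+_ (trans (cong (signed i) (∂-neg gs (λ b → U (i ∷ b)) a z)) (signed-neg i _))
          (periodic-neg i g (U (suc i ∷ a)) z))
        (sym (ℤ.neg-distrib-+ (signed i (∂ X gs (λ b → U (i ∷ b)) a z)) _))

      ∂-signed : ∀ {m} (gs : Vec Gen m) j (U : Family m Point) a z →
        ∂ X gs (λ b x → signed j (U b x)) a z ≡ signed j (∂ X gs U a z)
      ∂-signed gs zero    U a z = refl
      ∂-signed gs (suc j) U a z =
        trans (∂-neg gs (λ b x → signed j (U b x)) a z) (cong -_ (∂-signed gs j U a z))

      partialNorm-last : ∀ g q u z →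
        partialNorm X g (suc q) u z ≡ partialNorm X g q u z + u (iterate (act g) q z)
      partialNorm-last g zero    u z = ℤ.+-comm (u z) 0ℤ
      partialNorm-last g (suc q) u z = trans
        (cong (λ w → u z + w) (partialNorm-last g q u (act g z)))
        (sym (ℤ.+-assoc (u z) _ _))

      -- After `u z` is added, both sides are the sum over `p + 1` successive points, the last of
      -- which is `z` again.
      norm-invariant : ∀ g u z → partialNorm X g p u (act g z) ≡ partialNorm X g p u z
      norm-invariant g u z = ∙-cancelˡ (u z) _ _
        (trans (partialNorm-last g p u z)
          (trans (cong (λ y → partialNorm X g p u z + u y) (order g z)) (ℤ.+-comm _ (u z))))

      partialNorm-difference : ∀ g q (u : Fun X) z →
        partialNorm X g q (λ x → u (act g x) - u x) z ≡ u (iterate (act g) q z) - u z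
      partialNorm-difference g zero    u z = sym (ℤ.+-inverseʳ (u z))
      partialNorm-difference g (suc q) u z = trans
        (cong (λ w → u (act g z) - u z + w) (partialNorm-difference g q u (act g z)))
        (lem (u (act g z)) (u z) (u (iterate (act g) q (act g z))))
        where
        lem : ∀ a b c → a - b + (c - a) ≡ c - b
        lem = solve-∀

      periodic-periodic : ∀ i g u z → periodic X i g (periodic X (suc i) g u) z ≡ 0ℤ
      periodic-periodic 0 g u z = ℤ.i≡j⇒i-j≡0 (norm-invariant g u z)
      periodic-periodic 1 g u z =
        trans (partialNorm-difference g p u z) (ℤ.i≡j⇒i-j≡0 (cong u (order g z)))
      periodic-periodic (suc (suc i)) g u z = periodic-periodic i g u z

      -- The mixed terms cancel: `periodic X i g` commutes with `∂ X gs`, and their composite enters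
      -- once with `signed i` and once with `signed (suc i)`.
      ∂-∂ : ∀ {m} (gs : Vec Gen m) (U : Family m Point) a z → ∂ X gs (∂ X gs U) a z ≈ 0ℤ
      ∂-∂ []       U []      z = reflexive refl
      ∂-∂ (g ∷ gs) U (i ∷ a) z = begin
        signed i (∂ X gs (λ b x → signed i (∂ X gs U₀ b x) + periodic X i g (U₁ b) x) a z)
          + periodic X i g (λ x → - signed i (∂ X gs U₁ a x) + periodic X (suc i) g U₂ x) z
          ≡⟨ cong₂ _+_
               (cong (signed i) (trans (∂-+ gs (λ b x → signed i (∂ X gs U₀ b x)) (λ b → periodic X i g (U₁ b)) a z)
                 (cong (λ w → w + ∂ X gs (λ b → periodic X i g (U₁ b)) a z) (∂-signed gs i (∂ X gs U₀) a z))))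
               (periodic-+ i g (λ x → - signed i (∂ X gs U₁ a x)) (periodic X (suc i) g U₂) z) ⟩
        signed i (signed i (∂ X gs (∂ X gs U₀) a z) + ∂ X gs (λ b → periodic X i g (U₁ b)) a z)
          + (periodic X i g (λ x → - signed i (∂ X gs U₁ a x)) z + periodic X i g (periodic X (suc i) g U₂) z)
          ≈⟨ +-cong
               (signed-cong i (+-cong (≈-trans (signed-cong i (∂-∂ gs U₀ a z)) (reflexive (signed-0 i)))
                 (≈-sym (T-∂ (periodic-equivariant i g) gs U₁ a z))))
               (+-cong (Equivariantly.T-signed (periodic-equivariant i g) (suc i) (∂ X gs U₁ a) z)
                 (reflexive (periodic-periodic i g U₂ z))) ⟩
        signed i (0ℤ + w) + (- signed i w + 0ℤ)
          ≡⟨ cong (λ v → signed i v + (- signed i w + 0ℤ)) (ℤ.+-identityˡ w) ⟩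
        signed i w + (- signed i w + 0ℤ)
          ≡⟨ lem (signed i w) ⟩
        0ℤ ∎
        where
        U₀ = λ b → U (i ∷ b)
        U₁ = λ b → U (suc i ∷ b)
        U₂ = U (suc (suc i) ∷ a)
        w  = periodic X i g (∂ X gs U₁ a) z
        lem : ∀ w → w + (- w + 0ℤ) ≡ 0ℤ
        lem = solve-∀

      partialNorm-constant : ∀ g q {u : Fun X} → (∀ z → u (act g z) ≈ u z) →
        ∀ z → partialNorm X g q u z ≈ + q * u z
      partialNorm-constant g zero    {u} e z = reflexive (sym (ℤ.*-zeroˡ (u z)))
      partialNorm-constant g (suc q) {u} e z = begin
        u z + partialNorm X g q u (act g z)
          ≈⟨ +-cong (reflexive {u z} refl) (partialNorm-constant g q e (act g z)) ⟩
        u z + + q * u (act g z)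
          ≈⟨ +-cong (reflexive {u z} refl) (*-cong (reflexive {+ q} refl) (e z)) ⟩
        u z + + q * u z
          ≡⟨ ℤ.suc-* (+ q) (u z) ⟨
        + suc q * u z ∎

      norm-constant : ∀ g {u : Fun X} → (∀ z → u (act g z) ≈ u z) → ∀ z → partialNorm X g p u z ≈ 0ℤ
      norm-constant g {u} e z = ≈-trans (partialNorm-constant g p e z)
        (≈-trans (*-cong p≈0 (reflexive {u z} refl)) (reflexive (ℤ.*-zeroˡ (u z))))

      module Contraction (g : Gen) (b : Fun X) where

        weighted : ℕ → Fun X → Fun X
        weighted zero    u z = 0ℤ
        weighted (suc q) u z =
          weighted q u z + b (iterate (act g) q z) * partialNorm X g q u z

        -- Where b has norm 1, multiplication by b inverts the norm on invariants,
        -- and minus the weighted sum inverts g - 1 on the kernel of the norm.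
        contract : ℕ → Fun X → Fun X
        contract 0             u z = - weighted p u z
        contract 1             u z = b z * u z
        contract (suc (suc i)) u z = contract i u z

        -- Summation by parts. `weighted q u z` is the sum over `j < q` of `b` at the `j`-th
        -- translate of `z` times the partial norm of length `j`; the partial norm of length `j` at
        -- `act g z` is that of length `j + 1` at `z` minus `u z`.
        weighted-act : ∀ q u z → weighted q u (act g z) ≡
          weighted q u z + b (iterate (act g) q z) * partialNorm X g q u z
            - partialNorm X g q b (act g z) * u z
        weighted-act zero    u z = lem (b z) (u z)
          where
          lem : ∀ b u → 0ℤ ≡ 0ℤ + b * 0ℤ - 0ℤ * u
          lem = solve-∀
        weighted-act (suc q) u z = trans
          (cong (λ w → w + b′ * partialNorm X g q u (act g z)) (weighted-act q u z))
          (trans (lem (weighted q u z) (b (iterate (act g) q z)) (partialNorm X g q u z)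
                   (partialNorm X g q b (act g z)) b′ (partialNorm X g q u (act g z)) (u z))
            (cong (λ w → weighted (suc q) u z + b′ * partialNorm X g (suc q) u z - w * u z)
              (sym (partialNorm-last g q b (act g z)))))
          where
          b′ = b (iterate (act g) (suc q) z)
          lem : ∀ w b n s b′ n′ u →
            w + b * n - s * u + b′ * n′ ≡ w + b * n + b′ * (u + n′) - (s + b′) * u
          lem = solve-∀

        module _ (G : Point → Set) (closed : ∀ g {z} → G z → G (act g z)) where

          partialNorm-product : ∀ q {u : Fun X} → (∀ {z} → G z → u (act g z) ≈ u z) →
            ∀ {z} → G z → partialNorm X g q (λ x → b x * u x) z ≈ partialNorm X g q b z * u z
          partialNorm-product zero    {u} e {z} Gz = reflexive (sym (ℤ.*-zeroˡ (u z)))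
          partialNorm-product (suc q) {u} e {z} Gz = begin
            b z * u z + partialNorm X g q (λ x → b x * u x) (act g z)
              ≈⟨ +-cong (reflexive {b z * u z} refl) (≈-trans (partialNorm-product q e (closed g Gz))
                   (*-cong (reflexive {partialNorm X g q b (act g z)} refl) (e Gz))) ⟩
            b z * u z + partialNorm X g q b (act g z) * u z
              ≡⟨ ℤ.*-distribʳ-+ (u z) (b z) (partialNorm X g q b (act g z)) ⟨
            (b z + partialNorm X g q b (act g z)) * u z ∎

          periodic-contract : ∀ i {u : Fun X} → (∀ {z} → G z → periodic X (suc i) g u z ≈ 0ℤ) →
            ∀ {z} → G z → partialNorm X g p b z ≈ 1ℤ → periodic X i g (contract i u) z ≈ u z
          periodic-contract 0 {u} e {z} Gz n = begin
            - weighted p u (act g z) - - weighted p u z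
              ≡⟨ cong (λ w → - w - - weighted p u z) (weighted-act p u z) ⟩
            - (weighted p u z + b′ * partialNorm X g p u z - partialNorm X g p b (act g z) * u z)
              - - weighted p u z
              ≡⟨ lem (weighted p u z) _ _ ⟩
            partialNorm X g p b (act g z) * u z - b′ * partialNorm X g p u z
              ≈⟨ +-cong (*-cong (≈-trans (reflexive (norm-invariant g b z)) n) (reflexive {u z} refl))
                   (neg-cong (*-cong (reflexive {b′} refl) (e Gz))) ⟩
            1ℤ * u z - b′ * 0ℤ
              ≡⟨ lem′ (u z) b′ ⟩
            u z ∎
            where
            b′ = b (iterate (act g) p z)
            lem : ∀ w c d → - (w + c - d) - - w ≡ d - c
            lem = solve-∀
            lem′ : ∀ u b → 1ℤ * u - b * 0ℤ ≡ u
            lem′ = solve-∀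
          periodic-contract 1 {u} e {z} Gz n = begin
            partialNorm X g p (λ x → b x * u x) z
              ≈⟨ partialNorm-product p (λ {x} Gx → invariant x (e Gx)) Gz ⟩
            partialNorm X g p b z * u z
              ≈⟨ *-cong n (reflexive {u z} refl) ⟩
            1ℤ * u z
              ≡⟨ ℤ.*-identityˡ (u z) ⟩
            u z ∎
            where
            lem : ∀ a b → a ≡ a - b + b
            lem = solve-∀
            invariant : ∀ x → u (act g x) - u x ≈ 0ℤ → u (act g x) ≈ u x
            invariant x d = ≈-trans (reflexive (lem (u (act g x)) (u x)))
              (≈-trans (+-cong d (reflexive {u x} refl)) (reflexive (ℤ.+-identityˡ (u x))))
          periodic-contract (suc (suc i)) e Gz n = periodic-contract i e Gz n

          weighted-vanish : ∀ q {u : Fun X} → (∀ {z} → G z → b z ≈ 0ℤ) → ∀ {z} → G z → weighted q u z ≈ 0ℤ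
          weighted-vanish zero    e Gz = reflexive refl
          weighted-vanish (suc q) {u} e {z} Gz = +-cong (weighted-vanish q e Gz)
            (≈-trans (*-cong (e (closed-iterate q Gz)) (reflexive {partialNorm X g q u z} refl))
              (reflexive (ℤ.*-zeroˡ (partialNorm X g q u z))))
            where
            closed-iterate : ∀ q {z} → G z → G (iterate (act g) q z)
            closed-iterate zero    Gz = Gz
            closed-iterate (suc q) Gz = closed-iterate q (closed g Gz)

          contract-vanish : ∀ i {u : Fun X} → (∀ {z} → G z → b z ≈ 0ℤ) → ∀ {z} → G z → contract i u z ≈ 0ℤ
          contract-vanish 0 e Gz = neg-cong (weighted-vanish p e Gz)
          contract-vanish 1 {u} e {z} Gz = ≈-trans (*-cong (e Gz) (reflexive {u z} refl))
            (reflexive (ℤ.*-zeroˡ (u z)))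
          contract-vanish (suc (suc i)) e Gz = contract-vanish i e Gz

          contract-vanishʳ : ∀ i {u : Fun X} → (∀ {z} → G z → u z ≈ 0ℤ) → ∀ {z} → G z → contract i u z ≈ 0ℤ
          contract-vanishʳ 0 {u} e Gz = neg-cong (weighted-vanishʳ p Gz)
            where
            weighted-vanishʳ : ∀ q {z} → G z → weighted q u z ≈ 0ℤ
            weighted-vanishʳ zero    Gz = reflexive refl
            weighted-vanishʳ (suc q) {z} Gz = +-cong (weighted-vanishʳ q Gz)
              (≈-trans (*-cong (reflexive {b (iterate (act g) q z)} refl) (partialNorm-vanish G closed g q e Gz))
                (reflexive (ℤ.*-zeroʳ (b (iterate (act g) q z)))))
          contract-vanishʳ 1 e {z} Gz = ≈-trans (*-cong (reflexive {b z} refl) (e Gz))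
            (reflexive (ℤ.*-zeroʳ (b z)))
          contract-vanishʳ (suc (suc i)) e Gz = contract-vanishʳ i e Gz

  -- Equivariant cochains on sequences and Smith theory

  data Degenerate {A : Set} : List A → Set where
    here  : ∀ {x l} → Degenerate (x ∷ x ∷ l)
    there : ∀ {x l} → Degenerate l → Degenerate (x ∷ l)

  module Cochains (p : ℕ) {Gen Q : Set} (_·_ : Gen → Q → Q)
    (·-commute : ∀ g h q → g · (h · q) ≡ h · (g · q))
    (·-order : ∀ g q → iterate (g ·_) p q ≡ q)
    (·-injective : ∀ g {q r} → g · q ≡ g · r → q ≡ r)
    where
    open Equivariant p Gen
    open import Relation.Binary.Reasoning.Setoid setoid

    points : Space
    points = record { Point = Q ; act = _·_ ; commute = ·-commute ; order = ·-order }

    chains : Space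
    chains = record
      { Point   = List Q
      ; act     = λ g → List.map (g ·_)
      ; commute = map-commute
      ; order   = λ g → map-order g p ·-order }
      where
      map-commute : ∀ g h l → List.map (g ·_) (List.map (h ·_) l) ≡ List.map (h ·_) (List.map (g ·_) l)
      map-commute g h []      = refl
      map-commute g h (q ∷ l) = cong₂ _∷_ (·-commute g h q) (map-commute g h l)
      iterate-[] : ∀ g j → iterate (List.map (g ·_)) j [] ≡ []
      iterate-[] g zero    = refl
      iterate-[] g (suc j) = iterate-[] g j
      iterate-∷ : ∀ g j q l →
        iterate (List.map (g ·_)) j (q ∷ l) ≡ iterate (g ·_) j q ∷ iterate (List.map (g ·_)) j l
      iterate-∷ g zero    q l = refl
      iterate-∷ g (suc j) q l = iterate-∷ g j (g · q) (List.map (g ·_) l)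
      map-order : ∀ g j → (∀ g q → iterate (g ·_) j q ≡ q) → ∀ l → iterate (List.map (g ·_)) j l ≡ l
      map-order g j e []      = iterate-[] g j
      map-order g j e (q ∷ l) = trans (iterate-∷ g j q l) (cong₂ _∷_ (e g q) (map-order g j e l))

    open Operators chains

    Cochain : Set
    Cochain = List Q → ℤ

    -- The simplicial coboundary on sequences with repetitions, in all degrees at once. It is
    -- augmented: `[]` is a simplex of degree -1.
    δ : Cochain → Cochain
    δ u []      = 0ℤ
    δ u (q ∷ l) = u l - δ (λ k → u (q ∷ k)) l

    δ-+ : ∀ u v l → δ (λ k → u k + v k) l ≡ δ u l + δ v l
    δ-+ u v []      = refl
    δ-+ u v (q ∷ l) = trans (cong (λ w → u l + v l - w) (δ-+ (λ k → u (q ∷ k)) (λ k → v (q ∷ k)) l))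
      (lem (u l) (v l) _ _)
      where
      lem : ∀ a b c d → a + b - (c + d) ≡ a - c + (b - d)
      lem = solve-∀

    δ-neg : ∀ u l → δ (λ k → - u k) l ≡ - δ u l
    δ-neg u []      = refl
    δ-neg u (q ∷ l) = trans (cong (λ w → - u l - w) (δ-neg (λ k → u (q ∷ k)) l)) (lem (u l) _)
      where
      lem : ∀ a c → - a - - c ≡ - (a - c)
      lem = solve-∀

    δ-act : ∀ g u l → δ (λ k → u (List.map (g ·_) k)) l ≡ δ u (List.map (g ·_) l)
    δ-act g u []      = refl
    δ-act g u (q ∷ l) = cong (λ w → u (List.map (g ·_) l) - w) (δ-act g (λ k → u (g · q ∷ k)) l)

    δ-cong : ∀ {P : Q → Set} {u v} → (∀ {l} → All P l → u l ≈ v l) → ∀ {l} → All P l → δ u l ≈ δ v l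
    δ-cong e []        = reflexive refl
    δ-cong e (px ∷ pl) = +-cong (e pl) (neg-cong (δ-cong (λ pk → e (px ∷ pk)) pl))

    δ-0 : ∀ l → δ (λ _ → 0ℤ) l ≡ 0ℤ
    δ-0 []      = refl
    δ-0 (q ∷ l) = cong (λ w → 0ℤ - w) (δ-0 l)

    δ-vanish : ∀ {P : Q → Set} {u} → (∀ {l} → All P l → u l ≈ 0ℤ) → ∀ {l} → All P l → δ u l ≈ 0ℤ
    δ-vanish e {l} pl = ≈-trans (δ-cong e pl) (reflexive (δ-0 l))

    δ-δ : ∀ u l → δ (δ u) l ≡ 0ℤ
    δ-δ u []      = refl
    δ-δ u (q ∷ l) = trans
      (cong (λ w → δ u l - w) (trans (δ-+ u (λ k → - δ (λ k → u (q ∷ k)) k) l)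
        (cong (λ w → δ u l + w) (trans (δ-neg (δ (λ k → u (q ∷ k))) l) (cong -_ (δ-δ (λ k → u (q ∷ k)) l))))))
      (lem (δ u l))
      where
      lem : ∀ d → d - (d + - 0ℤ) ≡ 0ℤ
      lem = solve-∀

    δ-equivariant : Equivariantly chains chains δ
    δ-equivariant = record
      { linear = record
        { T-+   = λ u v l → reflexive (δ-+ u v l)
        ; T-neg = λ u l → reflexive (δ-neg u l) }
      ; T-act = λ g u l → reflexive (δ-act g u l) }

    Normalized : Cochain → Set
    Normalized u = ∀ {l} → Degenerate l → u l ≈ 0ℤ

    δ-normalized : ∀ {u} → Normalized u → Normalized (δ u)
    δ-normalized {u} n (here {x} {l}) = begin
      u (x ∷ l) - (u (x ∷ l) - δ (λ k → u (x ∷ x ∷ k)) l)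
        ≡⟨ lem (u (x ∷ l)) _ ⟩
      δ (λ k → u (x ∷ x ∷ k)) l
        ≈⟨ δ-vanish (λ _ → n here) (All.universal {P = λ _ → ⊤} (λ _ → tt) l) ⟩
      0ℤ ∎
      where
      lem : ∀ a d → a - (a - d) ≡ d
      lem = solve-∀
    δ-normalized n (there d) = +-cong (n d) (neg-cong (δ-normalized (λ d′ → n (there d′)) d))

    Degenerate-act : ∀ g {l} → Degenerate l → Degenerate (List.map (g ·_) l)
    Degenerate-act g here      = here
    Degenerate-act g (there d) = there (Degenerate-act g d)

    isZero : ∀ {m} → Vec ℕ m → ℤ
    isZero []          = 1ℤ
    isZero (zero  ∷ a) = isZero a
    isZero (suc _ ∷ a) = 0ℤ

    unit : ∀ {m} → Family m (List Q)
    unit a []          = 0ℤ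
    unit a (_ ∷ [])    = isZero a
    unit a (_ ∷ _ ∷ _) = 0ℤ

    unit-normalized : ∀ {m} (a : Vec ℕ m) → Normalized (unit a)
    unit-normalized a here               = reflexive refl
    unit-normalized a (there here)       = reflexive refl
    unit-normalized a (there (there d))  = reflexive refl

    unit-act : ∀ {m} (a : Vec ℕ m) g l → unit a (List.map (g ·_) l) ≡ unit a l
    unit-act a g []          = refl
    unit-act a g (_ ∷ [])    = refl
    unit-act a g (_ ∷ _ ∷ _) = refl

    unit-zero : ∀ {m} (a : Vec ℕ m) l → unit (zero ∷ a) l ≡ unit a l
    unit-zero a []          = refl
    unit-zero a (_ ∷ [])    = refl
    unit-zero a (_ ∷ _ ∷ _) = refl

    unit-suc : ∀ {m} i (a : Vec ℕ m) l → unit (suc i ∷ a) l ≡ 0ℤ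
    unit-suc i a []          = refl
    unit-suc i a (_ ∷ [])    = refl
    unit-suc i a (_ ∷ _ ∷ _) = refl

    ∂-unit : ∀ {m} (gs : Vec Gen m) a l → ∂ chains gs unit a l ≈ 0ℤ
    ∂-unit []       []      l = reflexive refl
    ∂-unit (g ∷ gs) (zero ∷ a) l = +-cong
      (≈-trans (∂-cong (λ _ → ⊤) _ gs (λ b {k} _ → reflexive (unit-zero b k)) a {l} tt) (∂-unit gs a l))
      (periodic-vanish (λ _ → ⊤) _ 0 g (λ {k} _ → reflexive (unit-suc 0 a k)) {l} tt)
    ∂-unit (g ∷ gs) (suc i ∷ a) l = +-cong
      (≈-trans (signed-cong (suc i) (∂-vanish (λ _ → ⊤) _ gs (λ b {k} _ → reflexive (unit-suc i b k)) a {l} tt))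
        (reflexive (signed-0 (suc i))))
      (periodic-vanish (λ _ → ⊤) _ (suc i) g (λ {k} _ → reflexive (unit-suc (suc i) a k)) {l} tt)

    δ-unit : ∀ {m} (a : Vec ℕ m) l → δ (unit a) l ≡ 0ℤ
    δ-unit a []              = refl
    δ-unit a (_ ∷ [])        = refl
    δ-unit a (_ ∷ _ ∷ [])    = lem (isZero a)
      where
      lem : ∀ z → z - (z - 0ℤ) ≡ 0ℤ
      lem = solve-∀
    δ-unit a (x ∷ y ∷ z ∷ l) = cong (λ w → 0ℤ - (0ℤ - (0ℤ - w))) (δ-0 l)

    -- `empty` excludes the solution that always exists, namely -1 on `[]` in resolution degree 0
    -- and 0 elsewhere; with it, the degree 0 evaluation of the boundary leaves exactly the unit.
    -- `normalized` is what makes the pullback vanish in high dimension.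
    record Trivialization {m} (gs : Vec Gen m) (P : Q → Set) : Set where
      field
        family     : Family m (List Q)
        boundary   : ∀ a {l} → All P l → ∂ chains gs family a l ≈ δ (family a) l + unit a l
        empty      : ∀ a → family a [] ≈ 0ℤ
        normalized : ∀ a → Normalized (family a)

    module Smith (_≟_ : DecidableEquality Q) (β : Gen → Q → ℤ)
      (β-norm : ∀ g q → g · q ≢ q → partialNorm points g p (β g) q ≈ 1ℤ) where

      -- The first entry moved by `g` decides. Its place is the same in all translates of the
      -- sequence by `g`, so the norm of `weight g` is a norm over a single orbit in `Q`.
      weight : Gen → Cochain
      weight g []      = 0ℤ
      weight g (q ∷ l) with (g · q) ≟ q
      ... | yes _ = weight g l
      ... | no  _ = β g q

      Fixed : Gen → List Q → Set
      Fixed g = All (λ q → g · q ≡ q)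

      Fixed? : ∀ g l → Dec (Fixed g l)
      Fixed? g = All.all? (λ q → (g · q) ≟ q)

      Fixed-act : ∀ g h {l} → Fixed g l → Fixed g (List.map (h ·_) l)
      Fixed-act g h []      = []
      Fixed-act g h (e ∷ f) = trans (·-commute g h _) (cong (h ·_) e) ∷ Fixed-act g h f

      weight-fixed : ∀ g {l} → Fixed g l → weight g l ≡ 0ℤ
      weight-fixed g [] = refl
      weight-fixed g (_∷_ {q} e f) with (g · q) ≟ q
      ... | yes _ = weight-fixed g f
      ... | no ¬e = ⊥-elim (¬e e)

      weight-norm : ∀ g l → ¬ Fixed g l → partialNorm chains g p (weight g) l ≈ 1ℤ
      weight-norm g []      ¬f = ⊥-elim (¬f [])
      weight-norm g (q ∷ l) ¬f with (g · q) ≟ q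
      ... | yes e = ≈-trans (reflexive (skip p q l e)) (weight-norm g l (λ f → ¬f (e ∷ f)))
        where
        skip : ∀ j q l → g · q ≡ q →
          partialNorm chains g j (weight g) (q ∷ l) ≡ partialNorm chains g j (weight g) l
        skip zero    q l e = refl
        skip (suc j) q l e with (g · q) ≟ q
        ... | yes _ = cong (λ w → weight g l + w) (skip j (g · q) (List.map (g ·_) l) (cong (g ·_) e))
        ... | no ¬e = ⊥-elim (¬e e)
      ... | no ¬e = ≈-trans (reflexive (halt p q l ¬e)) (β-norm g q ¬e)
        where
        halt : ∀ j q l → g · q ≢ q →
          partialNorm chains g j (weight g) (q ∷ l) ≡ partialNorm points g j (β g) q
        halt zero    q l ¬e = refl
        halt (suc j) q l ¬e with (g · q) ≟ q
        ... | yes e = ⊥-elim (¬e e)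
        ... | no _  = cong (λ w → β g q + w)
          (halt j (g · q) (List.map (g ·_) l) (λ e → ¬e (·-injective g e)))

      module Step {m} (g : Gen) (gs : Vec Gen m) (P : Q → Set) (closed : ∀ h {q} → P q → P (h · q))
        (ih : Trivialization gs (λ q → P q × g · q ≡ q)) where
        open Trivialization ih renaming
          (family to V; boundary to V-boundary; empty to V-empty; normalized to V-normalized)
        open Contraction g (weight g)

        All-closed : ∀ h {l} → All P l → All P (List.map (h ·_) l)
        All-closed h []        = []
        All-closed h (px ∷ pl) = closed h px ∷ All-closed h pl

        -- Extension by zero of the solution on fixed chains. It is invariant under `g`, because
        -- being fixed is, and this starts the recursion on the degree in the new resolution.
        masked : Family m (List Q)
        masked a l with Fixed? g l
        ... | yes _ = V a l
        ... | no  _ = 0ℤ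

        -- The boundary equation in degree `i` solved for its last term: the value that
        -- `periodic i g` has to take on layer `i + 1`.
        defect : ℕ → Family m (List Q) → Family m (List Q)
        defect i U a l = δ (U a) l - signed i (∂ chains gs U a l) + unit (i ∷ a) l

        layer : ℕ → Family m (List Q)
        layer zero    = masked
        layer (suc i) = λ a → contract i (defect i (layer i) a)

        masked-fixed : ∀ a {l} → Fixed g l → masked a l ≡ V a l
        masked-fixed a {l} f with Fixed? g l
        ... | yes _ = refl
        ... | no ¬f = ⊥-elim (¬f f)

        masked-act : ∀ a l → masked a (List.map (g ·_) l) ≡ masked a l
        masked-act a l with Fixed? g l | Fixed? g (List.map (g ·_) l)
        ... | yes f | yes _  = cong (V a) (fixed-map f)
          where
          fixed-map : ∀ {l} → Fixed g l → List.map (g ·_) l ≡ l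
          fixed-map []      = refl
          fixed-map (e ∷ f) = cong₂ _∷_ e (fixed-map f)
        ... | yes f | no ¬f  = ⊥-elim (¬f (Fixed-act g g f))
        ... | no ¬f | yes f  = ⊥-elim (¬f (unmap f))
          where
          unmap : ∀ {l} → Fixed g (List.map (g ·_) l) → Fixed g l
          unmap {[]}    []      = []
          unmap {_ ∷ _} (e ∷ f) = ·-injective g e ∷ unmap f
        ... | no _  | no _   = refl

        layer-fixed : ∀ i a {l} → Fixed g l → layer (suc i) a l ≈ 0ℤ
        layer-fixed i a = contract-vanish (Fixed g) (Fixed-act g) i
          {defect i (layer i) a} (λ f → reflexive (weight-fixed g f))

        -- No contraction exists on fixed chains, so the equation must hold there already. In degree
        -- 0 this is the induction hypothesis; in higher degrees every layer vanishes on fixed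
        -- chains since `weight g` does.
        defect-fixed : ∀ i a {l} → All P l → Fixed g l → defect i (layer i) a l ≈ 0ℤ
        defect-fixed zero a {l} pl f = begin
          δ (masked a) l - ∂ chains gs masked a l + unit (0 ∷ a) l
            ≈⟨ +-cong (+-cong (δ-cong (λ f → reflexive (masked-fixed a (All.map proj₂ f))) pf)
                 (neg-cong (≈-trans (∂-cong (Fixed g) (Fixed-act g) gs
                   (λ b f → reflexive (masked-fixed b f)) a f) (V-boundary a pf))))
                 (reflexive (unit-zero a l)) ⟩
          δ (V a) l - (δ (V a) l + unit a l) + unit a l
            ≡⟨ lem (δ (V a) l) (unit a l) ⟩
          0ℤ ∎
          where
          pf : All (λ q → P q × g · q ≡ q) l
          pf = All.zip (pl , f)
          lem : ∀ d u → d - (d + u) + u ≡ 0ℤ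
          lem = solve-∀
        defect-fixed (suc i) a {l} pl f = +-cong
          (+-cong (δ-vanish (layer-fixed i a) f)
            (neg-cong (≈-trans (signed-cong (suc i)
              (∂-vanish (Fixed g) (Fixed-act g) gs (λ b → layer-fixed i b) a f))
              (reflexive (signed-0 (suc i))))))
          (reflexive (unit-suc i a l))

        mutual
          -- The solvability condition. For `i = 0` the defect is invariant under `g`, so its norm
          -- is `p` times a value. For later layers, the periodic map commutes with `δ` and
          -- `∂ chains gs` and turns the layer into the preceding defect `E`; the remaining
          -- `δ E + signed i (∂ E)` vanishes since `δ` and `∂` square to zero and the unit is closed
          -- for both.
          annihilated : ∀ i a {l} → All P l → periodic chains (suc i) g (defect i (layer i) a) l ≈ 0ℤ
          annihilated zero a {l} pl = norm-constant g {defect 0 masked a} invariant l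
            where
            invariant : ∀ l → defect 0 masked a (List.map (g ·_) l) ≈ defect 0 masked a l
            invariant l = +-cong
              (+-cong
                (≈-trans (reflexive (sym (δ-act g (masked a) l)))
                  (δ-cong (λ {k} _ → reflexive (masked-act a k)) (All.universal {P = λ _ → ⊤} (λ _ → tt) l)))
                (neg-cong (≈-trans (T-∂ (act-equivariant g) gs masked a l)
                  (∂-cong (λ _ → ⊤) _ gs (λ b {k} _ → reflexive (masked-act b k)) a {l} tt))))
              (reflexive (unit-act (0 ∷ a) g l))
          annihilated (suc i) a {l} pl = begin
            T (λ k → δ (W a) k - signed (suc i) (∂ chains gs W a k) + unit (suc i ∷ a) k) l
              ≡⟨ trans (periodic-+ i g (λ k → δ (W a) k - signed (suc i) (∂ chains gs W a k)) (unit (suc i ∷ a)) l)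
                   (cong (λ w → w + T (unit (suc i ∷ a)) l)
                     (trans (periodic-+ i g (δ (W a)) (λ k → - signed (suc i) (∂ chains gs W a k)) l)
                       (cong (λ w → T (δ (W a)) l + w)
                         (periodic-neg i g (λ k → signed (suc i) (∂ chains gs W a k)) l)))) ⟩
            T (δ (W a)) l - T (λ k → signed (suc i) (∂ chains gs W a k)) l + T (unit (suc i ∷ a)) l
              ≈⟨ +-cong (+-cong
                   (≈-trans (≈-sym (T-periodic δ-equivariant i g (W a) l)) (δ-cong (λ pk → solved i a pk) pl))
                   (neg-cong (≈-trans
                     (Equivariantly.T-signed (periodic-equivariant i g) (suc i) (∂ chains gs W a) l)
                     (signed-cong (suc i) (≈-trans (T-∂ (periodic-equivariant i g) gs W a l)
                       (∂-cong (All P) All-closed gs (λ b pk → solved i b pk) a pl))))))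
                   (periodic-vanish (λ _ → ⊤) _ i g (λ {k} _ → reflexive (unit-suc i a k)) {l} tt) ⟩
            δ (E a) l - - signed i (∂ chains gs E a l) + 0ℤ
              ≈⟨ +-cong (+-cong δE (neg-cong (neg-cong (signed-cong i ∂E)))) (reflexive {0ℤ} refl) ⟩
            - signed i e - - signed i e + 0ℤ
              ≡⟨ lem (signed i e) ⟩
            0ℤ ∎
            where
            W = layer (suc i)
            U = layer i
            E = defect i U
            e = ∂ chains gs (λ b → δ (U b)) a l
            T = periodic chains i g
            lem : ∀ e → - e - - e + 0ℤ ≡ 0ℤ
            lem = solve-∀
            lem₁ : ∀ s → 0ℤ - s + 0ℤ ≡ - s
            lem₁ = solve-∀
            lem₂ : ∀ s → s - 0ℤ + 0ℤ ≡ s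
            lem₂ = solve-∀
            δE : δ (E a) l ≈ - signed i e
            δE = begin
              δ (E a) l
                ≡⟨ trans (δ-+ (λ k → δ (U a) k - signed i (∂ chains gs U a k)) (unit (i ∷ a)) l)
                     (cong (λ w → w + δ (unit (i ∷ a)) l)
                       (trans (δ-+ (δ (U a)) (λ k → - signed i (∂ chains gs U a k)) l)
                         (cong₂ _+_ (δ-δ (U a) l) (δ-neg (λ k → signed i (∂ chains gs U a k)) l)))) ⟩
              0ℤ - δ (λ k → signed i (∂ chains gs U a k)) l + δ (unit (i ∷ a)) l
                ≈⟨ +-cong (+-cong (reflexive {0ℤ} refl) (neg-cong (≈-trans
                     (Equivariantly.T-signed δ-equivariant i (∂ chains gs U a) l)
                     (signed-cong i (T-∂ δ-equivariant gs U a l)))))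
                     (reflexive (δ-unit (i ∷ a) l)) ⟩
              0ℤ - signed i e + 0ℤ
                ≡⟨ lem₁ (signed i e) ⟩
              - signed i e ∎
            ∂E : ∂ chains gs E a l ≈ e
            ∂E = begin
              ∂ chains gs E a l
                ≡⟨ trans (∂-+ gs (λ b k → δ (U b) k - signed i (∂ chains gs U b k)) (λ b → unit (i ∷ b)) a l)
                     (cong (λ w → w + ∂ chains gs (λ b → unit (i ∷ b)) a l)
                       (trans (∂-+ gs (λ b → δ (U b)) (λ b k → - signed i (∂ chains gs U b k)) a l)
                         (cong (λ w → e + w)
                           (trans (∂-neg gs (λ b k → signed i (∂ chains gs U b k)) a l)
                             (cong -_ (∂-signed gs i (∂ chains gs U) a l)))))) ⟩
              e - signed i (∂ chains gs (∂ chains gs U) a l) + ∂ chains gs (λ b → unit (i ∷ b)) a l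
                ≈⟨ +-cong (+-cong (reflexive {e} refl) (neg-cong (≈-trans (signed-cong i (∂-∂ gs U a l))
                     (reflexive (signed-0 i))))) (∂-unit′ i) ⟩
              e - 0ℤ + 0ℤ
                ≡⟨ lem₂ e ⟩
              e ∎
              where
              ∂-unit′ : ∀ i → ∂ chains gs (λ b → unit (i ∷ b)) a l ≈ 0ℤ
              ∂-unit′ zero    = ≈-trans
                (∂-cong (λ _ → ⊤) _ gs (λ b {k} _ → reflexive (unit-zero b k)) a {l} tt) (∂-unit gs a l)
              ∂-unit′ (suc i) =
                ∂-vanish (λ _ → ⊤) _ gs (λ b {k} _ → reflexive (unit-suc i b k)) a {l} tt

          solved : ∀ i a {l} → All P l → periodic chains i g (layer (suc i) a) l ≈ defect i (layer i) a l
          solved i a {l} pl with Fixed? g l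
          -- On fixed chains both sides are 0; elsewhere `weight g` has norm 1 and the contraction
          -- applies.
          ... | yes f = ≈-trans (periodic-vanish (Fixed g) (Fixed-act g) i g (layer-fixed i a) f)
                          (≈-sym (defect-fixed i a pl f))
          ... | no ¬f = periodic-contract (All P) All-closed i {defect i (layer i) a}
                          (annihilated i a) pl (weight-norm g l ¬f)

        step : Trivialization (g ∷ gs) P
        step = record
          { family     = family
          ; boundary   = boundary
          ; empty      = λ { (i ∷ a) → empty i a }
          ; normalized = λ { (i ∷ a) → normalized i a } }
          where
          family : Family (suc m) (List Q)
          family (i ∷ a) = layer i a
          lem : ∀ s d u → s + (d - s + u) ≡ d + u
          lem = solve-∀
          boundary : ∀ a {l} → All P l → ∂ chains (g ∷ gs) family a l ≈ δ (family a) l + unit a l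
          boundary (i ∷ a) {l} pl = ≈-trans (+-cong (reflexive {signed i (∂ chains gs (layer i) a l)} refl) (solved i a pl))
            (reflexive (lem (signed i (∂ chains gs (layer i) a l)) (δ (layer i a) l) (unit (i ∷ a) l)))
          empty : ∀ i a → layer i a [] ≈ 0ℤ
          empty zero    a = V-empty a
          empty (suc i) a = layer-fixed i a []
          normalized : ∀ i a → Normalized (layer i a)
          normalized zero a {l} d with Fixed? g l
          ... | yes _ = V-normalized a d
          ... | no  _ = reflexive refl
          normalized (suc i) a = contract-vanishʳ Degenerate Degenerate-act i λ {l} d →
            +-cong (+-cong (δ-normalized (normalized i a) d)
              (neg-cong (≈-trans (signed-cong i (∂-vanish Degenerate Degenerate-act gs (λ b → normalized i b) a d))
                (reflexive (signed-0 i)))))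
              (unit-normalized (i ∷ a) d)

      -- The induction narrows `P` to the points fixed by the generators already treated. When no
      -- generator is left, `P` is empty, so `[]` is the only chain in question and the zero family
      -- will do.
      trivialization : ∀ {m} (gs : Vec Gen m) (P : Q → Set) → (∀ h {q} → P q → P (h · q)) →
        (∀ {q} → P q → ¬ VecAll.All (λ g → g · q ≡ q) gs) → Trivialization gs P
      trivialization [] P closed free = record
        { family     = λ _ _ → 0ℤ
        ; boundary   = λ { [] [] → reflexive refl ; [] (px ∷ _) → ⊥-elim (free px VecAll.[]) }
        ; empty      = λ _ → reflexive refl
        ; normalized = λ _ _ → reflexive refl }
      trivialization (g ∷ gs) P closed free = Step.step g gs P closed
        (trivialization gs (λ q → P q × g · q ≡ q)
          (λ h (px , e) → closed h px , trans (·-commute g h _) (cong (h ·_) e))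
          (λ (px , e) f → free px (e VecAll.∷ f)))

  -- Sign vectors as simplices of an iterated join

  SignVector : Set → ℕ → Set
  SignVector A n = Vec (Maybe A) n

  data Face {A : Set} : ∀ {n} → SignVector A n → SignVector A n → Set where
    here  : ∀ {n a} {x : SignVector A n} → Face (nothing ∷ x) (just a ∷ x)
    there : ∀ {n m} {z x : SignVector A n} → Face z x → Face (m ∷ z) (m ∷ x)

  NonZero : ∀ {A n} → SignVector A n → Set
  NonZero x = ∃ λ z → Face z x

  nonZero? : ∀ {A n} (x : SignVector A n) → Dec (NonZero x)
  nonZero? []            = no λ ()
  nonZero? (just a ∷ x)  = yes (_ , here)
  nonZero? (nothing ∷ x) with nonZero? x
  ... | yes (z , f) = yes (_ , there f)
  ... | no ¬f       = no λ { (_ , there f) → ¬f (_ , f) }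

  module SignVectors (p : ℕ) {Gen A : Set} (_∙_ : Gen → A → A)
    (∙-commute : ∀ g h a → g ∙ (h ∙ a) ≡ h ∙ (g ∙ a))
    (∙-order : ∀ g a → iterate (g ∙_) p a ≡ a)
    where
    open Equivariant p Gen
    open import Relation.Binary.Reasoning.Setoid setoid

    actVector : ∀ {n} → Gen → SignVector A n → SignVector A n
    actVector g = Vec.map (Maybe.map (g ∙_))

    simplices : ℕ → Space
    simplices n = record
      { Point   = SignVector A n
      ; act     = actVector
      ; commute = commute
      ; order   = order }
      where
      commute : ∀ {n} g h (x : SignVector A n) → actVector g (actVector h x) ≡ actVector h (actVector g x)
      commute g h []            = refl
      commute g h (nothing ∷ x) = cong (nothing ∷_) (commute g h x)
      commute g h (just a ∷ x)  = cong₂ (λ b → just b ∷_) (∙-commute g h a) (commute g h x)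
      iterate-[] : ∀ g j → iterate (actVector g) j [] ≡ []
      iterate-[] g zero    = refl
      iterate-[] g (suc j) = iterate-[] g j
      iterate-nothing : ∀ {n} g j (x : SignVector A n) →
        iterate (actVector g) j (nothing ∷ x) ≡ nothing ∷ iterate (actVector g) j x
      iterate-nothing g zero    x = refl
      iterate-nothing g (suc j) x = iterate-nothing g j (actVector g x)
      iterate-just : ∀ {n} g j a (x : SignVector A n) →
        iterate (actVector g) j (just a ∷ x) ≡ just (iterate (g ∙_) j a) ∷ iterate (actVector g) j x
      iterate-just g zero    a x = refl
      iterate-just g (suc j) a x = iterate-just g j (g ∙ a) (actVector g x)
      order : ∀ {n} g (x : SignVector A n) → iterate (actVector g) p x ≡ x
      order g []            = iterate-[] g p
      order g (nothing ∷ x) = trans (iterate-nothing g p x) (cong (nothing ∷_) (order g x))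
      order g (just a ∷ x)  =
        trans (iterate-just g p a x) (cong₂ (λ b → just b ∷_) (∙-order g a) (order g x))

    -- The value of `y` on the simplicial boundary of `x`, with signs alternating over the entries
    -- other than `nothing`. The zero vector counts as the empty simplex.
    faceSum : ∀ {n} → (SignVector A n → ℤ) → SignVector A n → ℤ
    faceSum y []            = 0ℤ
    faceSum y (nothing ∷ x) = faceSum (λ z → y (nothing ∷ z)) x
    faceSum y (just a ∷ x)  = y (nothing ∷ x) - faceSum (λ z → y (just a ∷ z)) x

    faceSum-cong : ∀ {n} {y y′ : SignVector A n → ℤ} x → (∀ {z} → Face z x → y z ≈ y′ z) →
      faceSum y x ≈ faceSum y′ x
    faceSum-cong []            e = reflexive refl
    faceSum-cong (nothing ∷ x) e = faceSum-cong x (λ f → e (there f))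
    faceSum-cong (just a ∷ x)  e = +-cong (e here) (neg-cong (faceSum-cong x (λ f → e (there f))))

    faceSum-+ : ∀ {n} (y y′ : SignVector A n → ℤ) x →
      faceSum (λ z → y z + y′ z) x ≡ faceSum y x + faceSum y′ x
    faceSum-+ y y′ []            = refl
    faceSum-+ y y′ (nothing ∷ x) = faceSum-+ (λ z → y (nothing ∷ z)) (λ z → y′ (nothing ∷ z)) x
    faceSum-+ y y′ (just a ∷ x)  = trans
      (cong (λ w → y (nothing ∷ x) + y′ (nothing ∷ x) - w)
        (faceSum-+ (λ z → y (just a ∷ z)) (λ z → y′ (just a ∷ z)) x))
      (lem (y (nothing ∷ x)) (y′ (nothing ∷ x)) _ _)
      where
      lem : ∀ a b c d → a + b - (c + d) ≡ a - c + (b - d)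
      lem = solve-∀

    faceSum-neg : ∀ {n} (y : SignVector A n → ℤ) x → faceSum (λ z → - y z) x ≡ - faceSum y x
    faceSum-neg y []            = refl
    faceSum-neg y (nothing ∷ x) = faceSum-neg (λ z → y (nothing ∷ z)) x
    faceSum-neg y (just a ∷ x)  = trans
      (cong (λ w → - y (nothing ∷ x) - w) (faceSum-neg (λ z → y (just a ∷ z)) x))
      (lem (y (nothing ∷ x)) _)
      where
      lem : ∀ a c → - a - - c ≡ - (a - c)
      lem = solve-∀

    faceSum-act : ∀ {n} g (y : SignVector A n → ℤ) x →
      faceSum (λ z → y (actVector g z)) x ≡ faceSum y (actVector g x)
    faceSum-act g y []            = refl
    faceSum-act g y (nothing ∷ x) = faceSum-act g (λ z → y (nothing ∷ z)) x
    faceSum-act g y (just a ∷ x)  =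
      cong (λ w → y (nothing ∷ actVector g x) - w) (faceSum-act g (λ z → y (just (g ∙ a) ∷ z)) x)

    faceSum-0 : ∀ {n} (x : SignVector A n) → faceSum (λ _ → 0ℤ) x ≡ 0ℤ
    faceSum-0 []            = refl
    faceSum-0 (nothing ∷ x) = faceSum-0 x
    faceSum-0 (just a ∷ x)  = cong (λ w → 0ℤ - w) (faceSum-0 x)

    faceSum-vanish : ∀ {n} {y : SignVector A n → ℤ} x → (∀ {z} → Face z x → y z ≈ 0ℤ) → faceSum y x ≈ 0ℤ
    faceSum-vanish x e = ≈-trans (faceSum-cong x e) (reflexive (faceSum-0 x))

    faceSum-faceSum : ∀ {n} (y : SignVector A n → ℤ) x → faceSum (faceSum y) x ≡ 0ℤ
    faceSum-faceSum y []            = refl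
    faceSum-faceSum y (nothing ∷ x) = faceSum-faceSum (λ z → y (nothing ∷ z)) x
    faceSum-faceSum y (just a ∷ x)  = trans
      (cong (λ w → faceSum y₀ x - w) (trans (faceSum-+ y₀ (λ z → - faceSum y₁ z) x)
        (cong (λ w → faceSum y₀ x + w) (trans (faceSum-neg (faceSum y₁) x) (cong -_ (faceSum-faceSum y₁ x))))))
      (lem (faceSum y₀ x))
      where
      y₀ = λ z → y (nothing ∷ z)
      y₁ = λ z → y (just a ∷ z)
      lem : ∀ d → d - (d + - 0ℤ) ≡ 0ℤ
      lem = solve-∀

    faceSum-equivariant : ∀ n → Equivariantly (simplices n) (simplices n) faceSum
    faceSum-equivariant n = record
      { linear = record
        { T-+   = λ u v x → reflexive (faceSum-+ u v x)
        ; T-neg = λ u x → reflexive (faceSum-neg u x) }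
      ; T-act = λ g u x → reflexive (faceSum-act g u x) }

    extend-equivariant : ∀ n → Equivariantly (simplices (suc n)) (simplices n) (λ y x → y (nothing ∷ x))
    extend-equivariant n = record
      { linear = record { T-+ = λ _ _ _ → reflexive refl ; T-neg = λ _ _ → reflexive refl }
      ; T-act  = λ _ _ _ → reflexive refl }

    module Fundamental (a₀ : A) {m} (gs : Vec Gen m) where

      ∂ₛ : ∀ {n} → Family m (SignVector A n) → Family m (SignVector A n)
      ∂ₛ {n} = ∂ (simplices n) gs

      cone : ∀ {n} → (SignVector A (suc n) → ℤ) → SignVector A n → ℤ
      cone y x = y (just a₀ ∷ x)

      -- Pairing with the chains c_a of total degree t given by c_0 = [a₀] and
      -- c_a = a₀ * ∂c_a, i.e. with the images of the generators of the resolution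
      -- under a chain map into the iterated join of copies of A.
      evaluate : ∀ t → Family m (SignVector A (suc t)) → ℤ
      evaluate zero    Y = Y (Vec.replicate m 0) (just a₀ ∷ [])
      evaluate (suc t) Y = evaluate t (∂ₛ (λ a → cone (Y a)))

      ∂ₛ-cong : ∀ {n} {Y Z : Family m (SignVector A n)} → (∀ a x → Y a x ≈ Z a x) →
        ∀ a x → ∂ₛ Y a x ≈ ∂ₛ Z a x
      ∂ₛ-cong {n} e a x = Operators.∂-cong (simplices n) (λ _ → ⊤) _ gs (λ b {z} _ → e b z) a {x} tt

      evaluate-cong : ∀ t {Y Z : Family m (SignVector A (suc t))} → (∀ a x → Y a x ≈ Z a x) →
        evaluate t Y ≈ evaluate t Z
      evaluate-cong zero    e = e (Vec.replicate m 0) (just a₀ ∷ [])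
      evaluate-cong (suc t) e = evaluate-cong t (∂ₛ-cong (λ a x → e a (just a₀ ∷ x)))

      evaluate-difference : ∀ t (Y Z : Family m (SignVector A (suc t))) →
        evaluate t (λ a x → Y a x - Z a x) ≈ evaluate t Y - evaluate t Z
      evaluate-difference zero    Y Z = reflexive refl
      evaluate-difference (suc t) Y Z = ≈-trans
        (evaluate-cong t (λ a x → reflexive (trans
          (Operators.∂-+ (simplices (suc t)) gs (λ b → cone (Y b)) (λ b z → - cone (Z b) z) a x)
          (cong (λ w → ∂ₛ (λ b → cone (Y b)) a x + w)
            (Operators.∂-neg (simplices (suc t)) gs (λ b → cone (Z b)) a x)))))
        (evaluate-difference t (∂ₛ (λ a → cone (Y a))) (∂ₛ (λ a → cone (Z a))))

      evaluate-0 : ∀ t {Y : Family m (SignVector A (suc t))} → (∀ a x → Y a x ≈ 0ℤ) → evaluate t Y ≈ 0ℤ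
      evaluate-0 zero    e = e (Vec.replicate m 0) (just a₀ ∷ [])
      evaluate-0 (suc t) e = evaluate-0 t λ a x →
        Operators.∂-vanish (simplices (suc t)) (λ _ → ⊤) _ gs (λ b {z} _ → e b (just a₀ ∷ z)) a {x} tt

      -- Dual to the formula that the boundary of `a₀ * c` is `c` minus `a₀ *` the boundary of `c`.
      evaluate-cone : ∀ t (Y : Family m (SignVector A (suc (suc t)))) →
        evaluate (suc t) (λ a → faceSum (Y a)) ≈
        evaluate t (λ a x → ∂ₛ Y a (nothing ∷ x)) - evaluate t (λ a → faceSum (∂ₛ (λ b → cone (Y b)) a))
      evaluate-cone t Y = ≈-trans
        (evaluate-cong t (λ a x → begin
          ∂ₛ (λ b z → Y b (nothing ∷ z) - faceSum (cone (Y b)) z) a x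
            ≡⟨ trans (Operators.∂-+ (simplices (suc t)) gs (λ b z → Y b (nothing ∷ z)) (λ b z → - faceSum (cone (Y b)) z) a x)
                 (cong (λ w → ∂ₛ (λ b z → Y b (nothing ∷ z)) a x + w)
                   (Operators.∂-neg (simplices (suc t)) gs (λ b → faceSum (cone (Y b))) a x)) ⟩
          ∂ₛ (λ b z → Y b (nothing ∷ z)) a x - ∂ₛ (λ b → faceSum (cone (Y b))) a x
            ≈⟨ +-cong (T-∂ (extend-equivariant (suc t)) gs Y a x)
                 (neg-cong (T-∂ (faceSum-equivariant (suc t)) gs (λ b → cone (Y b)) a x)) ⟨
          ∂ₛ Y a (nothing ∷ x) - faceSum (∂ₛ (λ b → cone (Y b)) a) x ∎))
        (evaluate-difference t (λ a x → ∂ₛ Y a (nothing ∷ x)) (λ a → faceSum (∂ₛ (λ b → cone (Y b)) a)))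

      ∂ₛ-fixed : ∀ {n k} (hs : Vec Gen k) (Y : Family k (SignVector A n)) a {x} →
        (∀ g → actVector g x ≡ x) → ∂ (simplices n) hs Y a x ≈ 0ℤ
      ∂ₛ-fixed {n} []       Y []      fix = reflexive refl
      ∂ₛ-fixed {n} (g ∷ hs) Y (i ∷ a) {x} fix = +-cong
        (≈-trans (signed-cong i (∂ₛ-fixed hs (λ b → Y (i ∷ b)) a fix)) (reflexive (signed-0 i)))
        (periodic-fixed i (Y (suc i ∷ a)))
        where
        partialNorm-fixed : ∀ q (u : SignVector A n → ℤ) → partialNorm (simplices n) g q u x ≡ + q * u x
        partialNorm-fixed zero    u = sym (ℤ.*-zeroˡ (u x))
        partialNorm-fixed (suc q) u = trans
          (cong (λ w → u x + w) (trans (cong (partialNorm (simplices n) g q u) (fix g)) (partialNorm-fixed q u)))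
          (sym (ℤ.suc-* (+ q) (u x)))
        periodic-fixed : ∀ i (u : SignVector A n → ℤ) → periodic (simplices n) i g u x ≈ 0ℤ
        periodic-fixed 0 u = reflexive (ℤ.i≡j⇒i-j≡0 (cong u (fix g)))
        periodic-fixed 1 u = ≈-trans (reflexive (partialNorm-fixed p u))
          (≈-trans (*-cong p≈0 (reflexive {u x} refl)) (reflexive (ℤ.*-zeroˡ (u x))))
        periodic-fixed (suc (suc i)) u = periodic-fixed i u

      -- This says that the chains defined by coning form a chain map. In the induction the first
      -- term of `evaluate-cone` dies because `∂ₛ` squares to zero. The bottom case concerns the
      -- zero vector, which every generator fixes: there differences vanish and norms are multiples
      -- of `p`.
      evaluate-faceSum : ∀ t (W : Family m (SignVector A (suc t))) →
        evaluate t (λ a → faceSum (∂ₛ W a)) ≈ 0ℤ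
      evaluate-faceSum zero    W = +-cong (∂ₛ-fixed gs W (Vec.replicate m 0) (λ _ → refl)) (reflexive {0ℤ} refl)
      evaluate-faceSum (suc t) W = ≈-trans (evaluate-cone t (∂ₛ W))
        (+-cong (evaluate-0 t (λ a x → Operators.∂-∂ (simplices (suc (suc t))) gs W a (nothing ∷ x)))
          (neg-cong (evaluate-faceSum t (λ b → cone (∂ₛ W b)))))

  -- Pulling back cochains along an equivariant labelling

  data _⊒_ (n : ℕ) : ℕ → Set where
    top  : n ⊒ n
    down : ∀ {t} → n ⊒ suc t → n ⊒ t

  ⊒-one : ∀ n → suc n ⊒ 1
  ⊒-one n = go n top
    where
    go : ∀ {n} t → n ⊒ suc t → n ⊒ 1
    go zero    h = h
    go (suc t) h = go t (down h)

  -- New entries go to the front because that is where `cone` puts `a₀`: the padded `x` is the facet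
  -- of the cone opposite to its apex.
  pad : ∀ {A n t} → n ⊒ t → SignVector A t → SignVector A n
  pad top      x = x
  pad (down h) x = pad h (nothing ∷ x)

  module Labelling (p : ℕ) {Gen A Q : Set}
    (_∙_ : Gen → A → A)
    (∙-commute : ∀ g h a → g ∙ (h ∙ a) ≡ h ∙ (g ∙ a))
    (∙-order : ∀ g a → iterate (g ∙_) p a ≡ a)
    (_·_ : Gen → Q → Q)
    (·-commute : ∀ g h q → g · (h · q) ≡ h · (g · q))
    (·-order : ∀ g q → iterate (g ·_) p q ≡ q)
    (·-injective : ∀ g {q r} → g · q ≡ g · r → q ≡ r)
    where
    open Equivariant p Gen
    open Cochains p _·_ ·-commute ·-order ·-injective
    open SignVectors p _∙_ ∙-commute ∙-order
    open import Relation.Binary.Reasoning.Setoid setoid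

    module Subdivision {n : ℕ} (label : SignVector A n → Q)
      (label-act : ∀ g x → label (actVector g x) ≡ g · label x)
      (P : Q → Set) (label-P : ∀ x → NonZero x → P (label x))
      (rank : Q → ℕ) (rank-positive : ∀ x → NonZero x → 1 ℕ.≤ rank (label x))
      (monotone : ∀ {z x} → Face z x → NonZero z → label z ≡ label x ⊎ rank (label z) ℕ.< rank (label x))
      where

      -- The signed sum of u over the images of all flags x = x₀ > x₁ > ⋯ of
      -- length j obtained by deleting one entry at a time.
      flagSum : ℕ → Cochain → SignVector A n → ℤ
      flagSum zero    u x = u []
      flagSum (suc j) u x = faceSum (flagSum j (λ l → u (label x ∷ l))) x

      flagSum-cong : ∀ j {u v} → (∀ {l} → All P l → u l ≈ v l) → ∀ x → flagSum j u x ≈ flagSum j v x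
      flagSum-cong zero    e x = e []
      flagSum-cong (suc j) e x = faceSum-cong x λ {z} f →
        flagSum-cong j (λ pl → e (label-P x (_ , f) ∷ pl)) z

      flagSum-+ : ∀ j u v x → flagSum j (λ l → u l + v l) x ≈ flagSum j u x + flagSum j v x
      flagSum-+ zero    u v x = reflexive refl
      flagSum-+ (suc j) u v x = ≈-trans
        (faceSum-cong x (λ {z} _ → flagSum-+ j (λ l → u (label x ∷ l)) (λ l → v (label x ∷ l)) z))
        (reflexive (faceSum-+ (flagSum j (λ l → u (label x ∷ l))) (flagSum j (λ l → v (label x ∷ l))) x))

      flagSum-neg : ∀ j u x → flagSum j (λ l → - u l) x ≈ - flagSum j u x
      flagSum-neg zero    u x = reflexive refl
      flagSum-neg (suc j) u x = ≈-trans
        (faceSum-cong x (λ {z} _ → flagSum-neg j (λ l → u (label x ∷ l)) z))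
        (reflexive (faceSum-neg (flagSum j (λ l → u (label x ∷ l))) x))

      flagSum-act : ∀ j g u x → flagSum j (λ l → u (List.map (g ·_) l)) x ≈ flagSum j u (actVector g x)
      flagSum-act zero    g u x = reflexive refl
      flagSum-act (suc j) g u x = ≈-trans
        (faceSum-cong x (λ {z} _ → flagSum-act j g (λ l → u (g · label x ∷ l)) z))
        (reflexive (trans (faceSum-act g (flagSum j (λ l → u (g · label x ∷ l))) x)
          (cong (λ q → faceSum (flagSum j (λ l → u (q ∷ l))) (actVector g x)) (sym (label-act g x)))))

      flagSum-vanish : ∀ j {u} → (∀ l → u l ≈ 0ℤ) → ∀ x → flagSum j u x ≈ 0ℤ
      flagSum-vanish zero    e x = e []
      flagSum-vanish (suc j) e x = faceSum-vanish x λ {z} _ → flagSum-vanish j (λ l → e (label x ∷ l)) z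

      -- Deleting a label other than the first leaves two successive sums over facets with no label
      -- between them, which is zero by `faceSum-faceSum`. Deleting the first label leaves the flags
      -- that start at the facets of `x`.
      flagSum-δ : ∀ j u x → flagSum (suc j) (δ u) x ≈ faceSum (flagSum j u) x
      flagSum-δ j u x = begin
        faceSum (flagSum j (λ l → u l - δ v l)) x
          ≈⟨ faceSum-cong x (λ {z} _ → ≈-trans (flagSum-+ j u (λ l → - δ v l) z)
               (+-cong (reflexive {flagSum j u z} refl) (flagSum-neg j (δ v) z))) ⟩
        faceSum (λ z → flagSum j u z - flagSum j (δ v) z) x
          ≡⟨ trans (faceSum-+ (flagSum j u) (λ z → - flagSum j (δ v) z) x)
               (cong (λ w → faceSum (flagSum j u) x + w) (faceSum-neg (flagSum j (δ v)) x)) ⟩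
        faceSum (flagSum j u) x - faceSum (flagSum j (δ v)) x
          ≈⟨ +-cong (reflexive {faceSum (flagSum j u) x} refl) (neg-cong (zero-part j)) ⟩
        faceSum (flagSum j u) x - 0ℤ
          ≡⟨ ℤ.+-identityʳ _ ⟩
        faceSum (flagSum j u) x ∎
        where
        v = λ l → u (label x ∷ l)
        zero-part : ∀ j → faceSum (flagSum j (δ v)) x ≈ 0ℤ
        zero-part zero    = reflexive (faceSum-0 x)
        zero-part (suc j) = ≈-trans (faceSum-cong x (λ {z} _ → flagSum-δ j v z))
          (reflexive (faceSum-faceSum (flagSum j v) x))

      -- Each step of a flag either repeats the label, so that the sequence is degenerate, or lowers
      -- the rank, which is at least 1 off the zero vector. With at least as many steps left as the
      -- rank allows, the flag must reach the zero vector, which has no facets to sum over.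
      flagSum-normalized : ∀ j {u} → Normalized u → ∀ x → NonZero x → rank (label x) ℕ.< j → flagSum j u x ≈ 0ℤ
      flagSum-normalized (suc j) {u} norm x nz (ℕ.s≤s r≤j) = faceSum-vanish x λ f → next j f r≤j
        where
        v = λ l → u (label x ∷ l)
        positive : ∀ i → rank (label x) ℕ.≤ i → i ≢ 0
        positive i r≤ refl = ℕ.<-irrefl refl (ℕ.≤-trans (rank-positive x nz) r≤)
        isolated : ∀ i {z} → i ≢ 0 → ¬ NonZero z → flagSum i v z ≈ 0ℤ
        isolated zero    i≢0 ¬nz = ⊥-elim (i≢0 refl)
        isolated (suc i) {z} _ ¬nz = faceSum-vanish z (λ f → ⊥-elim (¬nz (_ , f)))
        repeated : ∀ i {z} → i ≢ 0 → label z ≡ label x → flagSum i v z ≈ 0ℤ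
        repeated zero    i≢0 e = ⊥-elim (i≢0 refl)
        repeated (suc i) {z} _ e rewrite e = faceSum-vanish z λ {w} _ →
          flagSum-vanish i {λ l → u (label x ∷ label x ∷ l)} (λ l → norm here) w
        next : ∀ i {z} → Face z x → rank (label x) ℕ.≤ i → flagSum i v z ≈ 0ℤ
        next i {z} f r≤ with nonZero? z
        ... | no ¬nz = isolated i (positive i r≤) ¬nz
        ... | yes nz′ with monotone f nz′
        ...   | inj₂ r< = flagSum-normalized i {v} (λ d → norm (there d)) z nz′ (ℕ.<-≤-trans r< r≤)
        ...   | inj₁ e  = repeated i (positive i r≤) e

      module Padded (a₀ : A) {m} (gs : Vec Gen m) (triv : Trivialization gs P)
        (rank-bound : ∀ x → NonZero x → rank (label x) ℕ.< n) where
        open Trivialization triv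
        open Fundamental a₀ gs

        pad-act : ∀ {t} (h : n ⊒ t) g x → pad h (actVector g x) ≡ actVector g (pad h x)
        pad-act top      g x = refl
        pad-act (down h) g x = pad-act h g (nothing ∷ x)

        pad-faceSum : ∀ {t} (h : n ⊒ t) y x → faceSum y (pad h x) ≡ faceSum (λ z → y (pad h z)) x
        pad-faceSum top      y x = refl
        pad-faceSum (down h) y x = pad-faceSum h y (nothing ∷ x)

        pullback : ∀ {t} → n ⊒ t → ℕ → Cochain → SignVector A t → ℤ
        pullback h j u x = flagSum j u (pad h x)

        pullback-equivariant : ∀ {t} (h : n ⊒ t) j → Equivariantly chains (simplices t) (pullback h j)
        pullback-equivariant h j = record
          { linear = record
            { T-+   = λ u v x → flagSum-+ j u v (pad h x)
            ; T-neg = λ u x → flagSum-neg j u (pad h x) }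
          ; T-act = λ g u x → ≈-trans (flagSum-act j g u (pad h x))
              (reflexive (cong (flagSum j u) (sym (pad-act h g x)))) }

        ∂-normalized : ∀ a → Normalized (∂ chains gs family a)
        ∂-normalized a = Operators.∂-vanish chains Degenerate Degenerate-act gs normalized a

        -- The value at t = n - 1 vanishes for dimension reasons, and the value
        -- does not depend on t.
        evaluation-vanishes : ∀ {t} (h : n ⊒ suc t) →
          evaluate t (λ a → pullback h (suc t) (∂ chains gs family a)) ≈ 0ℤ
        evaluation-vanishes {t} top = evaluate-0 t at
          where
          at : ∀ a x → flagSum (suc t) (∂ chains gs family a) x ≈ 0ℤ
          at a x with nonZero? x
          ... | yes nz = flagSum-normalized (suc t) (∂-normalized a) x nz (rank-bound x nz)
          ... | no ¬nz = faceSum-vanish x (λ f → ⊥-elim (¬nz (_ , f)))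
        evaluation-vanishes {t} (down h) = begin
          evaluate t (λ a → pullback (down h) (suc t) (∂ chains gs family a))
            ≈⟨ evaluate-cong t (λ a x → ≈-trans (T-∂ (pullback-equivariant h (suc t)) gs family a (nothing ∷ x))
                 (reflexive refl)) ⟩
          evaluate t (λ a x → ∂ₛ Y a (nothing ∷ x))
            ≡⟨ ℤ.+-identityʳ _ ⟨
          evaluate t (λ a x → ∂ₛ Y a (nothing ∷ x)) - 0ℤ
            ≈⟨ +-cong (reflexive {evaluate t (λ a x → ∂ₛ Y a (nothing ∷ x))} refl)
                 (neg-cong (evaluate-faceSum t (λ b → cone (Y b)))) ⟨
          evaluate t (λ a x → ∂ₛ Y a (nothing ∷ x)) - evaluate t (λ a → faceSum (∂ₛ (λ b → cone (Y b)) a))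
            ≈⟨ evaluate-cone t Y ⟨
          evaluate (suc t) (λ a → faceSum (Y a))
            ≈⟨ evaluate-cong (suc t) (λ a x → descend a x) ⟨
          evaluate (suc t) (λ a → pullback h (suc (suc t)) (∂ chains gs family a))
            ≈⟨ evaluation-vanishes h ⟩
          0ℤ ∎
          where
          Y : Family m (SignVector A (suc (suc t)))
          Y a = pullback h (suc t) (family a)
          descend : ∀ a x → pullback h (suc (suc t)) (∂ chains gs family a) x ≈ faceSum (Y a) x
          descend a x = begin
            flagSum (suc (suc t)) (∂ chains gs family a) (pad h x)
              ≈⟨ flagSum-cong (suc (suc t)) (boundary a) (pad h x) ⟩
            flagSum (suc (suc t)) (λ l → δ (family a) l + unit a l) (pad h x)
              ≈⟨ flagSum-+ (suc (suc t)) (δ (family a)) (unit a) (pad h x) ⟩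
            flagSum (suc (suc t)) (δ (family a)) (pad h x) + flagSum (suc (suc t)) (unit a) (pad h x)
              ≈⟨ +-cong (flagSum-δ (suc t) (family a) (pad h x))
                   -- The sequences have length at least 2 here, and `unit` is 0 on them.
                   (faceSum-vanish (pad h x) λ {z} _ → faceSum-vanish z λ {w} _ →
                     flagSum-vanish t (λ _ → reflexive refl) w) ⟩
            faceSum (flagSum (suc t) (family a)) (pad h x) + 0ℤ
              ≡⟨ trans (ℤ.+-identityʳ _) (pad-faceSum h (flagSum (suc t) (family a)) x) ⟩
            faceSum (Y a) x ∎

        isZero-0 : ∀ m → isZero (Vec.replicate m 0) ≡ 1ℤ
        isZero-0 zero    = refl
        isZero-0 (suc m) = isZero-0 m

        contradiction-mod-p : n ⊒ 1 → 1ℤ ≈ 0ℤ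
        contradiction-mod-p h = begin
          1ℤ
            ≡⟨ isZero-0 m ⟨
          isZero 𝟎
            ≡⟨ ℤ.+-identityˡ _ ⟨
          0ℤ + isZero 𝟎
            ≈⟨ +-cong (empty 𝟎) (reflexive {isZero 𝟎} refl) ⟨
          family 𝟎 [] + isZero 𝟎
            ≡⟨ lem (family 𝟎 []) (isZero 𝟎) ⟩
          family 𝟎 [] - 0ℤ + (isZero 𝟎 - 0ℤ)
            ≡⟨ cong₂ _+_ (trans (pad-faceSum h _ _) refl) (trans (pad-faceSum h _ _) refl) ⟨
          faceSum (flagSum 0 (family 𝟎)) v + flagSum 1 (unit 𝟎) v
            ≈⟨ +-cong (flagSum-δ 0 (family 𝟎) v) (reflexive {flagSum 1 (unit 𝟎) v} refl) ⟨
          flagSum 1 (δ (family 𝟎)) v + flagSum 1 (unit 𝟎) v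
            ≈⟨ flagSum-+ 1 (δ (family 𝟎)) (unit 𝟎) v ⟨
          flagSum 1 (λ l → δ (family 𝟎) l + unit 𝟎 l) v
            ≈⟨ flagSum-cong 1 (boundary 𝟎) v ⟨
          flagSum 1 (∂ chains gs family 𝟎) v
            ≈⟨ evaluation-vanishes h ⟩
          0ℤ ∎
          where
          𝟎 = Vec.replicate m 0
          v = pad h (just a₀ ∷ [])
          lem : ∀ a b → a + b ≡ a - 0ℤ + (b - 0ℤ)
          lem = solve-∀

  -- Weights of norm 1 on the points moved by a generator

  module Inverses (p : ℕ) (prime : Prime p) where
    open Modular p

    inverse : ∀ c → 0 ℕ.< c → c ℕ.< p → ∃ λ x → + c * x ≈ 1ℤ
    inverse c@(suc _) 0<c c<p with coprime-Bézout (prime⇒coprime prime c<p)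
    ... | Bézout.-+ x y eq = + y , congruent (+ x) (trans (ℤ.*-comm (+ c) (+ y))
            (trans (sym (ℤ.pos-* y c)) (trans (cong +_ (sym eq))
              (trans (ℤ.pos-+ 1 (x ℕ.* p)) (cong (λ w → 1ℤ + w) (ℤ.pos-* x p))))))
    ... | Bézout.+- x y eq = - + y , congruent (- + x) (lem (+ c) (+ y) (+ x) (+ p)
            (trans (cong (λ w → 1ℤ + w) (sym (ℤ.pos-* y c)))
              (trans (sym (ℤ.pos-+ 1 (y ℕ.* c))) (trans (cong +_ eq) (ℤ.pos-* x p)))))
      where
      lem₁ : ∀ c y → c * - y ≡ 1ℤ + - (1ℤ + y * c)
      lem₁ = solve-∀
      lem₂ : ∀ x p → 1ℤ + - (x * p) ≡ 1ℤ + - x * p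
      lem₂ = solve-∀
      lem : ∀ c y x p → 1ℤ + y * c ≡ x * p → c * - y ≡ 1ℤ + - x * p
      lem c y x p e = trans (lem₁ c y) (trans (cong (λ w → 1ℤ + - w) e) (lem₂ x p))

    -- Junk value 0 unless 0 < a < p.
    inv : ℤ → ℤ
    inv -[1+ _ ] = 0ℤ
    inv (+ c) with 0 ℕ.<? c | c ℕ.<? p
    ... | yes 0<c | yes c<p = proj₁ (inverse c 0<c c<p)
    ... | _       | _       = 0ℤ

    inv-inverse : ∀ c → 0 ℕ.< c → c ℕ.< p → + c * inv (+ c) ≈ 1ℤ
    inv-inverse c 0<c c<p with 0 ℕ.<? c | c ℕ.<? p
    ... | yes 0<c′ | yes c<p′ = proj₂ (inverse c 0<c′ c<p′)
    ... | no ¬0<c  | _        = ⊥-elim (¬0<c 0<c)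
    ... | yes _    | no ¬c<p  = ⊥-elim (¬c<p c<p)

    module Weights (1<p : 1 ℕ.< p) {Gen Q : Set} (_·_ : Gen → Q → Q)
      (·-commute : ∀ g h q → g · (h · q) ≡ h · (g · q))
      (·-order : ∀ g q → iterate (g ·_) p q ≡ q)
      (·-injective : ∀ g {q r} → g · q ≡ g · r → q ≡ r)
      where
      open Equivariant p Gen using (partialNorm; module Operators)
      open Cochains p _·_ ·-commute ·-order ·-injective using (points)
      open Operators points using (norm-invariant)

      indicator : (Q → Bool) → Q → ℤ
      indicator χ q = if χ q then 1ℤ else 0ℤ

      record Count (g : Gen) (χ : Q → Bool) (j : ℕ) (q : Q) : Set where
        field
          count : ℕ
          sum   : partialNorm points g j (indicator χ) q ≡ + count
          bound : count ℕ.≤ j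
          none  : count ≡ 0 → ∀ i → i ℕ.< j → χ (iterate (g ·_) i q) ≡ false
          all   : count ≡ j → ∀ i → i ℕ.< j → χ (iterate (g ·_) i q) ≡ true

      counting : ∀ g χ j q → Count g χ j q
      counting g χ zero    q = record
        { count = 0 ; sum = refl ; bound = z≤n ; none = λ _ _ () ; all = λ _ _ () }
      counting g χ (suc j) q with χ q in eq | counting g χ j (g · q)
      ... | true  | c = record
        { count = suc count
        ; sum   = cong₂ (λ b w → (if b then 1ℤ else 0ℤ) + w) eq sum
        ; bound = s≤s bound
        ; none  = λ ()
        ; all   = λ { _ zero _ → eq ; e (suc i) (s≤s i<j) → all (ℕ.suc-injective e) i i<j } }
        where open Count c
      ... | false | c = record
        { count = count
        ; sum   = trans (cong₂ (λ b w → (if b then 1ℤ else 0ℤ) + w) eq sum) (ℤ.+-identityˡ _)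
        ; bound = ℕ.m≤n⇒m≤1+n bound
        ; none  = λ { _ zero _ → eq ; e (suc i) (s≤s i<j) → none e i i<j }
        ; all   = λ e → ⊥-elim (ℕ.<-irrefl e (s≤s bound)) }
        where open Count c

      norm : Gen → (Q → Bool) → Q → ℤ
      norm g χ = partialNorm points g p (indicator χ)

      -- The comparison is between integers, not residues: 0 and `p` are the counts of a constant
      -- coordinate, and every count strictly between them is invertible modulo `p`.
      constant? : ℤ → Bool
      constant? a = does (a ℤ.≟ 0ℤ) ∨ does (a ℤ.≟ + p)

      -- Divides the first coordinate that is not constant along the orbit by the
      -- number of its values 1, which is invertible modulo p.
      orbitWeight : List (Q → Bool) → Gen → Q → ℤ
      orbitWeight []       g q = 0ℤ
      orbitWeight (χ ∷ χs) g q =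
        if constant? (norm g χ q) then orbitWeight χs g q else indicator χ q * inv (norm g χ q)

      constant⇒fixed : ∀ g χ q → constant? (norm g χ q) ≡ true → χ (g · q) ≡ χ q
      constant⇒fixed g χ q e with norm g χ q ℤ.≟ 0ℤ | norm g χ q ℤ.≟ + p | counting g χ p q
      ... | yes z | _     | c = trans (none c≡0 1 1<p) (sym (none c≡0 0 (ℕ.<-trans (s≤s z≤n) 1<p)))
        where
        open Count c
        c≡0 : count ≡ 0
        c≡0 = ℤ.+-injective (trans (sym sum) z)
      ... | no _ | yes z | c = trans (all c≡p 1 1<p) (sym (all c≡p 0 (ℕ.<-trans (s≤s z≤n) 1<p)))
        where
        open Count c
        c≡p : count ≡ p
        c≡p = ℤ.+-injective (trans (sym sum) z)
      constant⇒fixed g χ q () | no _ | no _ | _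

      nonconstant⇒invertible : ∀ g χ q → constant? (norm g χ q) ≡ false →
        norm g χ q * inv (norm g χ q) ≈ 1ℤ
      nonconstant⇒invertible g χ q e = invertible (norm g χ q) count sum bound e
        where
        open Count (counting g χ p q)
        invertible : ∀ a c → a ≡ + c → c ℕ.≤ p → constant? a ≡ false → a * inv a ≈ 1ℤ
        constant?-p : constant? (+ p) ≡ true
        constant?-p = trans (cong (does (+ p ℤ.≟ 0ℤ) ∨_) (dec-true (+ p ℤ.≟ + p) refl)) (Bool.∨-zeroʳ _)
        invertible _ c refl c≤p e = inv-inverse c (ℕ.n≢0⇒n>0 c≢0) (ℕ.≤∧≢⇒< c≤p c≢p)
          where
          c≢0 : c ≢ 0
          c≢0 refl = case e of λ ()
          c≢p : c ≢ p
          c≢p refl = case trans (sym e) constant?-p of λ ()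

      -- The count is constant along the orbit, so all its points take the same branch of
      -- `orbitWeight` and divide by the same number.
      orbitWeight-norm : ∀ χs g q → ¬ All (λ χ → χ (g · q) ≡ χ q) χs →
        partialNorm points g p (orbitWeight χs g) q ≈ 1ℤ
      orbitWeight-norm []       g q ¬f = ⊥-elim (¬f [])
      orbitWeight-norm (χ ∷ χs) g q ¬f with constant? (norm g χ q) in eq
      ... | true  = ≈-trans (reflexive (skip p q eq))
                      (orbitWeight-norm χs g q (λ f → ¬f (constant⇒fixed g χ q eq ∷ f)))
        where
        skip : ∀ j q → constant? (norm g χ q) ≡ true →
          partialNorm points g j (orbitWeight (χ ∷ χs) g) q ≡ partialNorm points g j (orbitWeight χs g) q
        skip zero    q e = refl
        skip (suc j) q e = cong₂ _+_ (cong (if_then orbitWeight χs g q else indicator χ q * inv (norm g χ q)) e)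
          (skip j (g · q) (trans (cong constant? (norm-invariant g (indicator χ) q)) e))
      ... | false = ≈-trans (reflexive (halt p q eq)) (nonconstant⇒invertible g χ q eq)
        where
        halt : ∀ j q → constant? (norm g χ q) ≡ false →
          partialNorm points g j (orbitWeight (χ ∷ χs) g) q ≡
          partialNorm points g j (indicator χ) q * inv (norm g χ q)
        halt zero    q e = sym (ℤ.*-zeroˡ (inv (norm g χ q)))
        halt (suc j) q e = trans
          (cong₂ _+_ (cong (if_then orbitWeight χs g q else indicator χ q * inv (norm g χ q)) e)
            (trans (halt j (g · q) (trans (cong constant? (norm-invariant g (indicator χ) q)) e))
              (cong (λ w → partialNorm points g j (indicator χ) (g · q) * inv w)
                (norm-invariant g (indicator χ) q))))
          (sym (ℤ.*-distribʳ-+ (inv (norm g χ q)) (indicator χ q) _))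

  -- The translation action on the signs and the nonexistence of labellings

  iterate-snoc : ∀ {A : Set} (f : A → A) j x → iterate f (suc j) x ≡ f (iterate f j x)
  iterate-snoc f zero    x = refl
  iterate-snoc f (suc j) x = iterate-snoc f j (f x)

  module Translations (p′ : ℕ) where
    p = suc p′

    rotate : Fin p → Fin p
    rotate i = fromℕ< (m%n<n (suc (toℕ i)) p)

    toℕ-iterate : ∀ j i → toℕ (iterate rotate j i) ≡ (toℕ i ℕ.+ j) % p
    toℕ-iterate zero    i = sym (trans (cong (_% p) (ℕ.+-identityʳ (toℕ i))) (m<n⇒m%n≡m (Fin.toℕ<n i)))
    toℕ-iterate (suc j) i = begin
      toℕ (iterate rotate j (rotate i))              ≡⟨ toℕ-iterate j (rotate i) ⟩
      (toℕ (rotate i) ℕ.+ j) % p                     ≡⟨ cong (λ w → (w ℕ.+ j) % p) (Fin.toℕ-fromℕ< (m%n<n (suc (toℕ i)) p)) ⟩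
      (suc (toℕ i) % p ℕ.+ j) % p                    ≡⟨ %-distribˡ-+ (suc (toℕ i) % p) j p ⟩
      (suc (toℕ i) % p % p ℕ.+ j % p) % p            ≡⟨ cong (λ w → (w ℕ.+ j % p) % p) (m%n%n≡m%n (suc (toℕ i)) p) ⟩
      (suc (toℕ i) % p ℕ.+ j % p) % p                ≡⟨ %-distribˡ-+ (suc (toℕ i)) j p ⟨
      (suc (toℕ i) ℕ.+ j) % p                        ≡⟨ cong (_% p) (ℕ.+-suc (toℕ i) j) ⟨
      (toℕ i ℕ.+ suc j) % p                          ∎
      where open ≡-Reasoning

    rotate-order : ∀ i → iterate rotate p i ≡ i
    rotate-order i = Fin.toℕ-injective (trans (toℕ-iterate p i)
      (trans ([m+n]%n≡m%n (toℕ i) p) (m<n⇒m%n≡m (Fin.toℕ<n i))))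

    rotate-transitive : ∀ i → iterate rotate (toℕ i) zero ≡ i
    rotate-transitive i = Fin.toℕ-injective (trans (toℕ-iterate (toℕ i) zero) (m<n⇒m%n≡m (Fin.toℕ<n i)))

    pair : ∀ m → Fin p → Fin (p ^ m) → Fin (p ^ suc m)
    pair m = combine {p} {p ^ m}

    unpair : ∀ m → Fin (p ^ suc m) → Fin p × Fin (p ^ m)
    unpair m = remQuot {p} (p ^ m)

    unpair-pair : ∀ m a b → unpair m (pair m a b) ≡ (a , b)
    unpair-pair m = Fin.remQuot-combine {p} {p ^ m}

    pair-elim : ∀ m (C : Fin (p ^ suc m) → Set) → (∀ a b → C (pair m a b)) → ∀ i → C i
    pair-elim m C f i = subst C (Fin.combine-remQuot {p} (p ^ m) i)
      (f (proj₁ (unpair m i)) (proj₂ (unpair m i)))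

    -- An element of `Fin (p ^ m)` is read as `m` digits modulo `p`, and generator `g` adds 1 to
    -- digit `g`.
    translate : ∀ m → Fin m → Fin (p ^ m) → Fin (p ^ m)
    translate (suc m) zero    i = pair m (rotate (proj₁ (unpair m i))) (proj₂ (unpair m i))
    translate (suc m) (suc g) i = pair m (proj₁ (unpair m i)) (translate m g (proj₂ (unpair m i)))

    translate-zero : ∀ m a b → translate (suc m) zero (pair m a b) ≡ pair m (rotate a) b
    translate-zero m a b = cong (λ ab → pair m (rotate (proj₁ ab)) (proj₂ ab)) (unpair-pair m a b)

    translate-suc : ∀ m g a b → translate (suc m) (suc g) (pair m a b) ≡ pair m a (translate m g b)
    translate-suc m g a b = cong (λ ab → pair m (proj₁ ab) (translate m g (proj₂ ab))) (unpair-pair m a b)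

    translate-commute : ∀ m g h i → translate m g (translate m h i) ≡ translate m h (translate m g i)
    translate-commute (suc m) zero zero = λ i → refl
    translate-commute (suc m) zero (suc h) = pair-elim m _ λ a b → trans
      (trans (cong (translate (suc m) zero) (translate-suc m h a b)) (translate-zero m a (translate m h b)))
      (sym (trans (cong (translate (suc m) (suc h)) (translate-zero m a b)) (translate-suc m h (rotate a) b)))
    translate-commute (suc m) (suc g) zero = pair-elim m _ λ a b → trans
      (trans (cong (translate (suc m) (suc g)) (translate-zero m a b)) (translate-suc m g (rotate a) b))
      (sym (trans (cong (translate (suc m) zero) (translate-suc m g a b)) (translate-zero m a (translate m g b))))
    translate-commute (suc m) (suc g) (suc h) = pair-elim m _ λ a b → trans
      (trans (cong (translate (suc m) (suc g)) (translate-suc m h a b)) (translate-suc m g a (translate m h b)))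
      (trans (cong (pair m a) (translate-commute m g h b))
        (sym (trans (cong (translate (suc m) (suc h)) (translate-suc m g a b)) (translate-suc m h a (translate m g b)))))

    iterate-zero : ∀ m j a b → iterate (translate (suc m) zero) j (pair m a b) ≡ pair m (iterate rotate j a) b
    iterate-zero m zero    a b = refl
    iterate-zero m (suc j) a b =
      trans (cong (iterate (translate (suc m) zero) j) (translate-zero m a b)) (iterate-zero m j (rotate a) b)

    iterate-suc : ∀ m g j a b →
      iterate (translate (suc m) (suc g)) j (pair m a b) ≡ pair m a (iterate (translate m g) j b)
    iterate-suc m g zero    a b = refl
    iterate-suc m g (suc j) a b =
      trans (cong (iterate (translate (suc m) (suc g)) j) (translate-suc m g a b)) (iterate-suc m g j a (translate m g b))

    translate-order : ∀ m g i → iterate (translate m g) p i ≡ i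
    translate-order (suc m) zero    = pair-elim m _ λ a b →
      trans (iterate-zero m p a b) (cong (λ a → pair m a b) (rotate-order a))
    translate-order (suc m) (suc g) = pair-elim m _ λ a b →
      trans (iterate-suc m g p a b) (cong (pair m a) (translate-order m g b))

    invariant-iterate : ∀ {A : Set} (f : A → A) (χ : A → Bool) → (∀ x → χ (f x) ≡ χ x) →
      ∀ j x → χ (iterate f j x) ≡ χ x
    invariant-iterate f χ e zero    x = refl
    invariant-iterate f χ e (suc j) x = trans (invariant-iterate f χ e j (f x)) (e x)

    -- Transitivity is expressed through invariant predicates, the form in which it excludes a
    -- proper nonempty set fixed by all generators.
    translate-transitive : ∀ m (χ : Fin (p ^ m) → Bool) → (∀ g i → χ (translate m g i) ≡ χ i) →
      ∀ i j → χ i ≡ χ j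
    translate-transitive zero    χ e zero zero = refl
    translate-transitive (suc m) χ e = pair-elim m _ λ a b → pair-elim m _ λ a′ b′ →
      trans (rotated a b) (trans (translate-transitive m (λ b → χ (pair m zero b))
        (λ g b → trans (sym (cong χ (translate-suc m g zero b))) (e (suc g) (pair m zero b))) b b′)
        (sym (rotated a′ b′)))
      where
      rotated : ∀ a b → χ (pair m a b) ≡ χ (pair m zero b)
      rotated a b = trans (cong (λ a → χ (pair m a b)) (sym (rotate-transitive a)))
        (trans (cong χ (sym (iterate-zero m (toℕ a) zero b)))
          (invariant-iterate (translate (suc m) zero) χ (e zero) (toℕ a) (pair m zero b)))

  -- This is the preimage under `f`; images of sets of signs are therefore written with the inverse
  -- map.
  permute : ∀ {r} → (Fin r → Fin r) → Subset r → Subset r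
  permute f S = tabulate (λ i → lookup S (f i))

  Proper : ∀ {r} → Subset r → Set
  Proper S = (∃ λ i → lookup S i ≡ true) × (∃ λ i → lookup S i ≡ false)

  module NoLabelling {r n : ℕ} (label : SignVector (Fin r) n → ℕ × Subset r)
    (label-permute : ∀ (f f⁻¹ : Fin r → Fin r) → (∀ i → f (f⁻¹ i) ≡ i) → (∀ i → f⁻¹ (f i) ≡ i) →
      ∀ x → label (Vec.map (Maybe.map f) x) ≡ (proj₁ (label x) , permute f⁻¹ (proj₂ (label x))))
    (label-proper : ∀ x → NonZero x → Proper (proj₂ (label x)))
    (rank : ℕ × Subset r → ℕ) (rank-positive : ∀ x → NonZero x → 1 ℕ.≤ rank (label x))
    (rank-bound : ∀ x → NonZero x → rank (label x) ℕ.< n)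
    (monotone : ∀ {z x} → Face z x → NonZero z → label z ≡ label x ⊎ rank (label z) ℕ.< rank (label x))
    (0<n : 0 ℕ.< n) (a₀ : Fin r)
    where

    no-labelling : ∀ p m → Prime p → r ≡ p ^ m → ⊥
    no-labelling 0 m p-prime = ⊥-elim (¬prime[0] p-prime)
    no-labelling 1 m p-prime = ⊥-elim (¬prime[1] p-prime)
    no-labelling (suc (suc p″)) m p-prime refl = impossible (contradiction-mod-p (enough 0<n))
      where
      open Translations (suc p″)
      Q = ℕ × Subset r

      back : Fin m → Fin r → Fin r
      back g = iterate (translate m g) (suc p″)
      translate-back : ∀ g i → translate m g (back g i) ≡ i
      translate-back g i = trans (sym (iterate-snoc (translate m g) (suc p″) i)) (translate-order m g i)
      back-translate : ∀ g i → back g (translate m g i) ≡ i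
      back-translate = translate-order m

      _·_ : Fin m → Q → Q
      g · (ℓ , S) = ℓ , permute (back g) S

      back-commute : ∀ g h i → back g (back h i) ≡ back h (back g i)
      back-commute g h i = begin
        back g (back h i)
          ≡⟨ back-translate h _ ⟨
        back h (translate m h (back g (back h i)))
          ≡⟨ cong (back h) (back-translate g _) ⟨
        back h (back g (translate m g (translate m h (back g (back h i)))))
          ≡⟨ cong (λ w → back h (back g w)) (translate-commute m g h _) ⟩
        back h (back g (translate m h (translate m g (back g (back h i)))))
          ≡⟨ cong (λ w → back h (back g (translate m h w))) (translate-back g _) ⟩
        back h (back g (translate m h (back h i)))
          ≡⟨ cong (λ w → back h (back g w)) (translate-back h _) ⟩
        back h (back g i) ∎
        where open ≡-Reasoning

      permute-permute : ∀ f h (S : Subset r) → permute f (permute h S) ≡ permute (λ i → h (f i)) S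
      permute-permute f h S = Vec.tabulate-cong (λ i → Vec.lookup∘tabulate (λ i → lookup S (h i)) (f i))

      permute-id : ∀ f (S : Subset r) → (∀ i → f i ≡ i) → permute f S ≡ S
      permute-id f S e = trans (Vec.tabulate-cong (λ i → cong (lookup S) (e i))) (Vec.tabulate∘lookup S)

      ·-commute : ∀ g h q → g · (h · q) ≡ h · (g · q)
      ·-commute g h (ℓ , S) = cong (ℓ ,_) (trans (permute-permute (back g) (back h) S)
        (trans (Vec.tabulate-cong (λ i → cong (lookup S) (back-commute h g i)))
          (sym (permute-permute (back h) (back g) S))))

      iterate-· : ∀ g j ℓ S → iterate (g ·_) j (ℓ , S) ≡ (ℓ , permute (iterate (back g) j) S)
      iterate-· g zero    ℓ S = cong (ℓ ,_) (sym (permute-id (λ i → i) S (λ _ → refl)))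
      iterate-· g (suc j) ℓ S = trans (iterate-· g j ℓ (permute (back g) S))
        (cong (ℓ ,_) (trans (permute-permute (iterate (back g) j) (back g) S)
          (Vec.tabulate-cong (λ i → cong (lookup S) (sym (iterate-snoc (back g) j i))))))

      iterate-back : ∀ g j i → iterate (back g) j (iterate (translate m g) j i) ≡ i
      iterate-back g zero    i = refl
      iterate-back g (suc j) i = trans (cong (iterate (back g) (suc j)) (iterate-snoc (translate m g) j i))
        (trans (cong (iterate (back g) j) (back-translate g _)) (iterate-back g j i))

      ·-order : ∀ g q → iterate (g ·_) p q ≡ q
      ·-order g (ℓ , S) = trans (iterate-· g p ℓ S) (cong (ℓ ,_) (permute-id (iterate (back g) p) S λ i →
        trans (cong (iterate (back g) p) (sym (translate-order m g i))) (iterate-back g p i)))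

      ·-injective : ∀ g {q q′} → g · q ≡ g · q′ → q ≡ q′
      ·-injective g {q} {q′} e = trans (sym (undo q)) (trans (cong again e) (undo q′))
        where
        again : Q → Q
        again (ℓ , S) = ℓ , permute (translate m g) S
        undo : ∀ q → again (g · q) ≡ q
        undo (ℓ , S) = cong (ℓ ,_) (trans (permute-permute (translate m g) (back g) S)
          (permute-id (λ i → back g (translate m g i)) S (back-translate g)))

      open Modular p
      open Inverses p p-prime
      open Weights (s≤s (s≤s z≤n)) _·_ ·-commute ·-order ·-injective
      open Cochains p _·_ ·-commute ·-order ·-injective

      coordinates : List (Q → Bool)
      coordinates = List.map (λ i q → lookup (proj₂ q) i) (List.allFin r)

      separates : ∀ g q → All (λ χ → χ (g · q) ≡ χ q) coordinates → g · q ≡ q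
      separates g (ℓ , S) f = cong (ℓ ,_) (trans (Vec.tabulate-cong λ i →
          trans (sym (Vec.lookup∘tabulate _ i)) (All.lookup (All.map⁻ f) (∈-allFin i)))
        (Vec.tabulate∘lookup S))

      decide : (q q′ : Q) → Dec (q ≡ q′)
      decide = ≡-dec ℕ._≟_ (Vec.≡-dec Bool._≟_)

      open Smith decide (orbitWeight coordinates)
        (λ g q ¬f → orbitWeight-norm coordinates g q (λ f → ¬f (separates g q f)))

      P : Q → Set
      P q = Proper (proj₂ q)

      lookup-· : ∀ g (S : Subset r) i → lookup (permute (back g) S) (translate m g i) ≡ lookup S i
      lookup-· g S i = trans (Vec.lookup∘tabulate _ (translate m g i)) (cong (lookup S) (back-translate g i))

      closed : ∀ g {q} → P q → P (g · q)
      closed g {ℓ , S} ((i , e) , (j , e′)) =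
        (translate m g i , trans (lookup-· g S i) e) , (translate m g j , trans (lookup-· g S j) e′)

      free : ∀ {q} → P q → ¬ VecAll.All (λ g → g · q ≡ q) (Vec.allFin m)
      free {ℓ , S} ((i , e) , (j , e′)) f with trans (sym e) (trans (translate-transitive m (lookup S) invariant i j) e′)
        where
        invariant : ∀ g i → lookup S (translate m g i) ≡ lookup S i
        invariant g i = trans (cong (λ S → lookup S (translate m g i)) (sym (cong proj₂ (VecAll.tabulate⁻ f g))))
          (lookup-· g S i)
      ... | ()

      triv : Trivialization (Vec.allFin m) P
      triv = trivialization (Vec.allFin m) P closed free

      open Labelling p (translate m) (translate-commute m) (translate-order m) _·_ ·-commute ·-order ·-injective
      open Subdivision label (λ g x → label-permute (translate m g) (back g) (translate-back g) (back-translate g) x)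
        P label-proper rank rank-positive monotone
      open Padded a₀ (Vec.allFin m) triv rank-bound

      enough : ∀ {n} → 0 ℕ.< n → n ⊒ 1
      enough {suc n} _ = ⊒-one n

      impossible : ¬ (1ℤ ≈ 0ℤ)
      impossible (congruent q e) with ℕ.m*n≡1⇒n≡1 ℤ.∣ q ∣ p
        (trans (sym (ℤ.abs-* q (+ p))) (cong ℤ.∣_∣ (trans (sym (ℤ.+-identityˡ (q * + p))) (sym e))))
      ... | ()

-- Labelling sign vectors by blocks and colours

module BlockLabelling where
  open import Data.Nat as ℕ using (ℕ; zero; suc; s≤s; z≤n; _∸_)
  import Data.Nat.Properties as ℕ
  open import Data.Nat.Primality using (Prime)
  open import Data.Bool using (Bool; true; false; _∨_)
  import Data.Bool.Properties as Bool
  open import Data.Fin as Fin using (Fin; zero; suc)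
  import Data.Fin.Properties as Fin
  open import Data.Fin.Subset using (Subset; ∣_∣)
  open import Data.Fin.Subset.Properties using (anySubset?)
  open import Data.Maybe as Maybe using (Maybe; just; nothing)
  import Data.Maybe.Properties as Maybe
  open import Data.Vec as Vec using (Vec; []; _∷_; lookup; tabulate; _[_]≔_)
  import Data.Vec.Properties as Vec
  open import Data.Product using (∃; _×_; _,_; proj₁; proj₂)
  open import Data.Sum using (_⊎_; inj₁; inj₂)
  open import Data.Empty using (⊥; ⊥-elim)
  open import Function using (case_of_; _∘_)
  open import Function.Bundles using (mk⇔)
  open import Relation.Binary.PropositionalEquality using (_≡_; _≢_; refl; sym; trans; cong; cong₂; subst; subst₂)
  open import Relation.Nullary
  open import Relation.Nullary.Decidable using (dec-true; does-⇔)
  open Obstruction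

  infix 4 _⊑_
  _⊑_ : ∀ {r} → Subset r → Subset r → Set
  S ⊑ T = ∀ i → lookup S i ≡ true → lookup T i ≡ true

  lookup-ext : ∀ {A : Set} {r} (S T : Vec A r) → (∀ i → lookup S i ≡ lookup T i) → S ≡ T
  lookup-ext []      []      e = refl
  lookup-ext (x ∷ S) (y ∷ T) e = cong₂ _∷_ (e zero) (lookup-ext S T (λ i → e (suc i)))

  ⊑-size : ∀ {r} (S T : Subset r) → S ⊑ T → S ≡ T ⊎ ∣ S ∣ ℕ.< ∣ T ∣
  ⊑-size []          []          _ = inj₁ refl
  ⊑-size (b ∷ S)     (c ∷ T)     h with ⊑-size S T (λ i → h (suc i))
  ⊑-size (true ∷ S)  (false ∷ T) h | _          = case h zero refl of λ ()
  ⊑-size (true ∷ S)  (true ∷ T)  h | inj₁ refl  = inj₁ refl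
  ⊑-size (true ∷ S)  (true ∷ T)  h | inj₂ s<t   = inj₂ (s≤s s<t)
  ⊑-size (false ∷ S) (false ∷ T) h | inj₁ refl  = inj₁ refl
  ⊑-size (false ∷ S) (false ∷ T) h | inj₂ s<t   = inj₂ s<t
  ⊑-size (false ∷ S) (true ∷ T)  h | inj₁ refl  = inj₂ ℕ.≤-refl
  ⊑-size (false ∷ S) (true ∷ T)  h | inj₂ s<t   = inj₂ (ℕ.m≤n⇒m≤1+n s<t)

  size-positive : ∀ {r} (S : Subset r) i → lookup S i ≡ true → 1 ℕ.≤ ∣ S ∣
  size-positive (true ∷ S)  _       _ = s≤s z≤n
  size-positive (false ∷ S) (suc i) e = size-positive S i e

  size-full : ∀ {r} (S : Subset r) → (∀ i → lookup S i ≡ true) → ∣ S ∣ ≡ r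
  size-full []          e = refl
  size-full (true ∷ S)  e = cong suc (size-full S (λ i → e (suc i)))
  size-full (false ∷ S) e = case e zero of λ ()

  size-≤ : ∀ {r} (S : Subset r) → ∣ S ∣ ℕ.≤ r
  size-≤ []          = z≤n
  size-≤ (true ∷ S)  = s≤s (size-≤ S)
  size-≤ (false ∷ S) = ℕ.m≤n⇒m≤1+n (size-≤ S)

  size-proper : ∀ {r} (S : Subset r) i → lookup S i ≡ false → ∣ S ∣ ℕ.< r
  size-proper (false ∷ S) zero    e = s≤s (size-≤ S)
  size-proper (true ∷ S)  (suc i) e = s≤s (size-proper S i e)
  size-proper (false ∷ S) (suc i) e = ℕ.m≤n⇒m≤1+n (size-proper S i e)

  insert : ∀ {r} → Fin r → Subset r → Subset r
  insert g S = S [ g ]≔ true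

  insert-self : ∀ {r} (g : Fin r) S → lookup (insert g S) g ≡ true
  insert-self g S = Vec.lookup∘update g S true

  insert-other : ∀ {r} {g i : Fin r} S → i ≢ g → lookup (insert g S) i ≡ lookup S i
  insert-other {g = g} {i} S i≢g = Vec.lookup∘update′ i≢g S true

  insert-⊑ : ∀ {r} (g : Fin r) S → S ⊑ insert g S
  insert-⊑ g S i e with i Fin.≟ g
  ... | yes refl = insert-self g S
  ... | no i≢g   = trans (insert-other S i≢g) e

  insert-mono : ∀ {r} (g : Fin r) S T → S ⊑ T → insert g S ⊑ insert g T
  insert-mono g S T h i e with i Fin.≟ g
  ... | yes refl = insert-self g T
  ... | no i≢g   = trans (insert-other T i≢g) (h i (trans (sym (insert-other S i≢g)) e))

  insert-∈ : ∀ {r} (g : Fin r) S → lookup S g ≡ true → insert g S ≡ S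
  insert-∈ g S e = lookup-ext _ _ λ i → case i Fin.≟ g of λ
    { (yes refl) → trans (insert-self g S) (sym e) ; (no i≢g) → insert-other S i≢g }

  size-insert : ∀ {r} (g : Fin r) S → lookup S g ≡ false → ∣ insert g S ∣ ≡ suc ∣ S ∣
  size-insert zero    (false ∷ S) e = refl
  size-insert (suc g) (true ∷ S)  e = cong suc (size-insert g S e)
  size-insert (suc g) (false ∷ S) e = size-insert g S e

  empty : ∀ {r} → Subset r
  empty = Vec.replicate _ false

  singleton : ∀ {r} → Fin r → Subset r
  singleton g = insert g empty

  singleton-∈ : ∀ {r} {g i : Fin r} → lookup (singleton g) i ≡ true → i ≡ g
  singleton-∈ {g = g} {i} e with i Fin.≟ g
  ... | yes i≡g = i≡g
  ... | no i≢g  = case trans (sym e) (trans (insert-other empty i≢g) (Vec.lookup-replicate i false)) of λ ()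

  size-empty : ∀ r → ∣ empty {r} ∣ ≡ 0
  size-empty zero    = refl
  size-empty (suc r) = size-empty r

  size-singleton : ∀ {r} (g : Fin r) → ∣ singleton g ∣ ≡ 1
  size-singleton {r} g = trans (size-insert g empty (Vec.lookup-replicate g false)) (cong suc (size-empty r))

  Full : ∀ {r} → Subset r → Set
  Full S = ∀ i → lookup S i ≡ true

  Full? : ∀ {r} (S : Subset r) → Dec (Full S)
  Full? S = Fin.all? (λ i → lookup S i Bool.≟ true)

  ¬true⇒false : ∀ {b} → b ≢ true → b ≡ false
  ¬true⇒false {true}  ¬t = ⊥-elim (¬t refl)
  ¬true⇒false {false} ¬t = refl

  not-full : ∀ {r} (S : Subset r) → ¬ Full S → ∃ λ i → lookup S i ≡ false
  not-full {r} S ¬f with Fin.¬∀⟶∃¬ r _ (λ i → lookup S i Bool.≟ true) ¬f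
  ... | i , e = i , ¬true⇒false e

  State : ℕ → Set
  State r = ℕ × Subset r

  -- A sign vector is cut greedily into blocks, each missing at least one sign;
  -- the state is the number of completed blocks and the signs of the current one.
  step : ∀ {r} → State r → Maybe (Fin r) → State r
  step st      nothing  = st
  step (b , S) (just g) with Full? (insert g S)
  ... | yes _ = suc b , singleton g
  ... | no  _ = b , insert g S

  scan : ∀ {r n} → State r → SignVector (Fin r) n → State r
  scan st []      = st
  scan st (m ∷ x) = scan (step st m) x

  infix 4 _≼_
  _≼_ : ∀ {r} → State r → State r → Set
  (b , S) ≼ (c , T) = b ℕ.< c ⊎ (b ≡ c × S ⊑ T)

  ≼-refl : ∀ {r} (st : State r) → st ≼ st
  ≼-refl st = inj₂ (refl , λ _ e → e)

  singleton-⊑ : ∀ {r} (g : Fin r) S → lookup S g ≡ true → singleton g ⊑ S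
  singleton-⊑ g S e i h rewrite singleton-∈ {g = g} {i} h = e

  step-≽ : ∀ {r} (st : State r) m → st ≼ step st m
  step-≽ st      nothing  = ≼-refl st
  step-≽ (b , S) (just g) with Full? (insert g S)
  ... | yes _ = inj₁ ℕ.≤-refl
  ... | no  _ = inj₂ (refl , insert-⊑ g S)

  -- The delicate case is a smaller state that closes its block and thereby catches up in block
  -- number. It then holds only the sign just read, which the other state has also inserted; this is
  -- why a new block starts from a singleton.
  step-mono : ∀ {r} (st st′ : State r) m → st ≼ st′ → step st m ≼ step st′ m
  step-mono st      st′     nothing  h = h
  step-mono (b , S) (c , T) (just g) h with Full? (insert g S) | Full? (insert g T)
  step-mono (b , S) (c , T) (just g) (inj₁ b<c)          | yes _ | yes _ = inj₁ (s≤s b<c)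
  step-mono (b , S) (c , T) (just g) (inj₁ b<c)          | no _  | yes _ = inj₁ (ℕ.m≤n⇒m≤1+n b<c)
  step-mono (b , S) (c , T) (just g) (inj₁ b<c)          | no _  | no _  = inj₁ b<c
  step-mono (b , S) (c , T) (just g) (inj₁ b<c)          | yes _ | no _  with ℕ.m≤n⇒m<n∨m≡n b<c
  ... | inj₁ b<c′ = inj₁ b<c′
  ... | inj₂ eq   = inj₂ (eq , singleton-⊑ g (insert g T) (insert-self g T))
  step-mono (b , S) (c , T) (just g) (inj₂ (refl , S⊑T)) | yes _ | yes _ = inj₂ (refl , λ _ e → e)
  step-mono (b , S) (c , T) (just g) (inj₂ (refl , S⊑T)) | no _  | yes _ = inj₁ ℕ.≤-refl
  step-mono (b , S) (c , T) (just g) (inj₂ (refl , S⊑T)) | no _  | no _  = inj₂ (refl , insert-mono g S T S⊑T)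
  step-mono (b , S) (c , T) (just g) (inj₂ (refl , S⊑T)) | yes f | no ¬f =
    ⊥-elim (¬f λ i → insert-mono g S T S⊑T i (f i))

  scan-mono : ∀ {r n} (st st′ : State r) (x : SignVector (Fin r) n) → st ≼ st′ → scan st x ≼ scan st′ x
  scan-mono st st′ []      h = h
  scan-mono st st′ (m ∷ x) h = scan-mono (step st m) (step st′ m) x (step-mono st st′ m h)

  scan-face : ∀ {r n} (st : State r) {z x : SignVector (Fin r) n} → Face z x → scan st z ≼ scan st x
  scan-face st (here {x = x})      = scan-mono st _ x (step-≽ st _)
  scan-face st (there {m = m} f)   = scan-face (step st m) f

  module Permuted {r} (f f⁻¹ : Fin r → Fin r)
    (f∘f⁻¹ : ∀ i → f (f⁻¹ i) ≡ i) (f⁻¹∘f : ∀ i → f⁻¹ (f i) ≡ i) where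

    move : State r → State r
    move (b , S) = b , permute f⁻¹ S

    permute-empty : permute f⁻¹ empty ≡ empty
    permute-empty = lookup-ext _ _ λ i → trans (Vec.lookup∘tabulate _ i)
      (trans (Vec.lookup-replicate (f⁻¹ i) false) (sym (Vec.lookup-replicate i false)))

    permute-insert : ∀ g S → insert (f g) (permute f⁻¹ S) ≡ permute f⁻¹ (insert g S)
    permute-insert g S = lookup-ext _ _ λ i → trans (at i (i Fin.≟ f g)) (sym (Vec.lookup∘tabulate _ i))
      where
      at : ∀ i → Dec (i ≡ f g) → lookup (insert (f g) (permute f⁻¹ S)) i ≡ lookup (insert g S) (f⁻¹ i)
      at i (yes refl) = trans (insert-self (f g) (permute f⁻¹ S))
        (sym (trans (cong (lookup (insert g S)) (f⁻¹∘f g)) (insert-self g S)))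
      at i (no i≢fg) = trans (insert-other (permute f⁻¹ S) i≢fg) (trans (Vec.lookup∘tabulate _ i)
        (sym (insert-other S λ e → i≢fg (trans (sym (f∘f⁻¹ i)) (cong f e)))))

    permute-full : ∀ S → Full S → Full (permute f⁻¹ S)
    permute-full S h i = trans (Vec.lookup∘tabulate _ i) (h (f⁻¹ i))

    unpermute-full : ∀ S → Full (permute f⁻¹ S) → Full S
    unpermute-full S h i = trans (sym (trans (Vec.lookup∘tabulate _ (f i)) (cong (lookup S) (f⁻¹∘f i)))) (h (f i))

    step-move : ∀ st m → step (move st) (Maybe.map f m) ≡ move (step st m)
    step-move st      nothing  = refl
    step-move (b , S) (just g) with Full? (insert g S) | Full? (insert (f g) (permute f⁻¹ S))
    ... | yes _ | yes _ = cong (suc b ,_) (trans (cong (insert (f g)) (sym permute-empty)) (permute-insert g empty))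
    ... | no _  | no _  = cong (b ,_) (permute-insert g S)
    ... | yes h | no ¬h = ⊥-elim (¬h (subst Full (sym (permute-insert g S)) (permute-full (insert g S) h)))
    ... | no ¬h | yes h = ⊥-elim (¬h (unpermute-full (insert g S) (subst Full (permute-insert g S) h)))

    scan-move : ∀ {n} st (x : SignVector (Fin r) n) → scan (move st) (Vec.map (Maybe.map f) x) ≡ move (scan st x)
    scan-move st []      = refl
    scan-move st (m ∷ x) = trans (cong (λ s → scan s (Vec.map (Maybe.map f) x)) (step-move st m)) (scan-move (step st m) x)

  module _ {r : ℕ} (2≤r : 2 ℕ.≤ r) where

    singleton-not-full : (g : Fin r) → ¬ Full (singleton g)
    singleton-not-full g h = ℕ.<-irrefl refl
      (subst (2 ℕ.≤_) (trans (sym (size-full (singleton g) h)) (size-singleton g)) 2≤r)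

    step-not-full : ∀ (st : State r) m → ¬ Full (proj₂ st) → ¬ Full (proj₂ (step st m))
    step-not-full st      nothing  h = h
    step-not-full (b , S) (just g) h with Full? (insert g S)
    ... | yes _ = singleton-not-full g
    ... | no ¬f = ¬f

    scan-not-full : ∀ {n} (st : State r) (x : SignVector (Fin r) n) → ¬ Full (proj₂ st) → ¬ Full (proj₂ (scan st x))
    scan-not-full st []      h = h
    scan-not-full st (m ∷ x) h = scan-not-full (step st m) x (step-not-full st m h)

  step-just-nonempty : ∀ {r} (st : State r) g → ∃ λ i → lookup (proj₂ (step st (just g))) i ≡ true
  step-just-nonempty (b , S) g with Full? (insert g S)
  ... | yes _ = g , insert-self g empty
  ... | no _  = g , insert-self g S

  scan-stays-nonempty : ∀ {r n} (st : State r) (x : SignVector (Fin r) n) →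
    (∃ λ i → lookup (proj₂ st) i ≡ true) → ∃ λ i → lookup (proj₂ (scan st x)) i ≡ true
  scan-stays-nonempty st []            h = h
  scan-stays-nonempty st (nothing ∷ x) h = scan-stays-nonempty st x h
  scan-stays-nonempty st (just g ∷ x)  h = scan-stays-nonempty (step st (just g)) x (step-just-nonempty st g)

  scan-nonempty : ∀ {r n} (st : State r) (x : SignVector (Fin r) n) → NonZero x →
    ∃ λ i → lookup (proj₂ (scan st x)) i ≡ true
  scan-nonempty st (just g ∷ x)  nz              = scan-stays-nonempty (step st (just g)) x (step-just-nonempty st g)
  scan-nonempty st (nothing ∷ x) (_ , there f)   = scan-nonempty st x (_ , f)

  module Ranked {r : ℕ} where

    -- Proper nonempty sets have between 1 and `r - 1` elements, so successive levels occupy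
    -- successive disjoint intervals of ranks.
    rank : State r → ℕ
    rank (b , S) = b ℕ.* (r ∸ 1) ℕ.+ ∣ S ∣

    size<⇒≤ : ∀ {s} → s ℕ.< r → s ℕ.≤ r ∸ 1
    size<⇒≤ (s≤s h) = h

    rank-level : ∀ {b c} (S : Subset r) → b ℕ.< c → ¬ Full S → rank (b , S) ℕ.≤ c ℕ.* (r ∸ 1)
    rank-level {b} {c} S b<c ¬f = begin
      b ℕ.* (r ∸ 1) ℕ.+ ∣ S ∣      ≤⟨ ℕ.+-monoʳ-≤ (b ℕ.* (r ∸ 1)) (size<⇒≤ (size-proper S (proj₁ i) (proj₂ i))) ⟩
      b ℕ.* (r ∸ 1) ℕ.+ (r ∸ 1)    ≡⟨ ℕ.+-comm (b ℕ.* (r ∸ 1)) (r ∸ 1) ⟩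
      suc b ℕ.* (r ∸ 1)            ≤⟨ ℕ.*-monoˡ-≤ (r ∸ 1) b<c ⟩
      c ℕ.* (r ∸ 1)                ∎
      where
      open ℕ.≤-Reasoning
      i = not-full S ¬f

    rank-mono : ∀ {st st′ : State r} → ¬ Full (proj₂ st) → (∃ λ i → lookup (proj₂ st′) i ≡ true) →
      st ≼ st′ → st ≡ st′ ⊎ rank st ℕ.< rank st′
    rank-mono {b , S} {c , T} ¬f (i , e) (inj₁ b<c) = inj₂ (ℕ.≤-trans (s≤s (rank-level S b<c ¬f))
      (ℕ.≤-trans (ℕ.≤-reflexive (ℕ.+-comm 1 (c ℕ.* (r ∸ 1)))) (ℕ.+-monoʳ-≤ (c ℕ.* (r ∸ 1)) (size-positive T i e))))
    rank-mono {b , S} {_ , T} ¬f (i , e) (inj₂ (refl , S⊑T)) with ⊑-size S T S⊑T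
    ... | inj₁ refl = inj₁ refl
    ... | inj₂ s<t  = inj₂ (ℕ.+-monoʳ-< (b ℕ.* (r ∸ 1)) s<t)

  -- The last member h j ≠ ∅ with j < c (junk if there is none).
  topmost : ∀ {r} → (ℕ → Subset r) → ℕ → State r
  topmost h zero    = 0 , empty
  topmost h (suc c) with Fin.any? (λ i → lookup (h c) i Bool.≟ true)
  ... | yes _ = c , h c
  ... | no  _ = topmost h c

  topmost-spec : ∀ {r} (h : ℕ → Subset r) c j i → j ℕ.< c → lookup (h j) i ≡ true →
    ∃ λ j′ → j ℕ.≤ j′ × j′ ℕ.< c × topmost h c ≡ (j′ , h j′) × ∃ λ i → lookup (h j′) i ≡ true
  topmost-spec h (suc c) j i (s≤s j≤c) e with Fin.any? (λ i → lookup (h c) i Bool.≟ true)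
  ... | yes ne = c , j≤c , ℕ.≤-refl , refl , ne
  ... | no ¬ne with ℕ.m≤n⇒m<n∨m≡n j≤c
  ...   | inj₂ refl = ⊥-elim (¬ne (i , e))
  ...   | inj₁ j<c with topmost-spec h c j i j<c e
  ...     | j′ , j≤j′ , j′<c , eq , ne = j′ , j≤j′ , ℕ.m≤n⇒m≤1+n j′<c , eq , ne

  topmost-cong : ∀ {r} {h h′ : ℕ → Subset r} c → (∀ j → h j ≡ h′ j) → topmost h c ≡ topmost h′ c
  topmost-cong zero    e = refl
  topmost-cong {h = h} {h′} (suc c) e
    with Fin.any? (λ i → lookup (h c) i Bool.≟ true) | Fin.any? (λ i → lookup (h′ c) i Bool.≟ true)
  ... | yes _        | yes _        = cong (c ,_) (e c)
  ... | no _         | no _         = topmost-cong c e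
  ... | yes (i , t)  | no ¬ne       = ⊥-elim (¬ne (i , trans (cong (λ S → lookup S i) (sym (e c))) t))
  ... | no ¬ne       | yes (i , t)  = ⊥-elim (¬ne (i , trans (cong (λ S → lookup S i) (e c)) t))

  module ColouredSubsets {r n : ℕ} (2≤r : 2 ℕ.≤ r) (colour : Subset n → Maybe ℕ) (D c : ℕ) where
    open Ranked {r}

    Within : Subset n → SignVector (Fin r) n → Fin r → Set
    Within σ x i = ∀ p → lookup σ p ≡ true → lookup x p ≡ just i

    Hit : ℕ → SignVector (Fin r) n → Fin r → Subset n → Set
    Hit j x i σ = Within σ x i × colour σ ≡ just j

    Hit? : ∀ j x i → Dec (∃ λ σ → Hit j x i σ)
    Hit? j x i = anySubset? λ σ →
      Fin.all? (λ p → (lookup σ p Bool.≟ true) →-dec (Maybe.≡-dec Fin._≟_ (lookup x p) (just i)))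
        ×-dec Maybe.≡-dec ℕ._≟_ (colour σ) (just j)

    hits : SignVector (Fin r) n → ℕ → Subset r
    hits x j = tabulate (λ i → does (Hit? j x i))

    hits-intro : ∀ {j x i σ} → Hit j x i σ → lookup (hits x j) i ≡ true
    hits-intro {j} {x} {i} h = trans (Vec.lookup∘tabulate _ i) (dec-true (Hit? j x i) (_ , h))

    hits-elim : ∀ {j x i} → lookup (hits x j) i ≡ true → ∃ λ σ → Hit j x i σ
    hits-elim {j} {x} {i} e with Hit? j x i | trans (sym (Vec.lookup∘tabulate (λ i → does (Hit? j x i)) i)) e
    ... | yes h | _ = h

    face-lookup : ∀ {m} {z x : SignVector (Fin r) m} {i} → Face z x → ∀ p → lookup z p ≡ just i → lookup x p ≡ just i
    face-lookup here      (suc p) e = e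
    face-lookup (there f) zero    e = e
    face-lookup (there f) (suc p) e = face-lookup f p e

    hits-face : ∀ {z x} → Face z x → ∀ j → hits z j ⊑ hits x j
    hits-face {z} {x} f j i e with hits-elim {j} {z} {i} e
    ... | σ , w , eq = hits-intro {j} {x} {i} {σ} ((λ p s → face-lookup f p (w p s)) , eq)

    start : State r
    start = 0 , empty

    -- Colour levels begin at `D`, above the block levels below `D`. The decision is an argument so
    -- that the cases for a vector and for its permuted copy can be split independently.
    choose : ∀ x → Dec (proj₁ (scan start x) ℕ.< D) → State r
    choose x (yes _) = scan start x
    choose x (no _)  = D ℕ.+ proj₁ (topmost (hits x) c) , proj₂ (topmost (hits x) c)

    label : SignVector (Fin r) n → State r
    label x = choose x (proj₁ (scan start x) ℕ.<? D)

    module Coloured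
      (no-monochromatic : ∀ j (σ : Fin r → Subset n) → (∀ i → colour (σ i) ≡ just j) →
        ¬ (∀ {i i′} p → lookup (σ i) p ≡ true → lookup (σ i′) p ≡ true → i ≡ i′))
      (found : ∀ x → D ℕ.≤ proj₁ (scan start x) → ∃ λ i → ∃ λ σ → ∃ λ j → j ℕ.< c × Hit j x i σ)
      where

      hits-not-full : ∀ x j → ¬ Full (hits x j)
      hits-not-full x j f = no-monochromatic j (λ i → proj₁ (hit i)) (λ i → proj₂ (proj₂ (hit i)))
        (λ {i} {i′} p e e′ → Maybe.just-injective
          (trans (sym (proj₁ (proj₂ (hit i)) p e)) (proj₁ (proj₂ (hit i′)) p e′)))
        where
        hit : ∀ i → ∃ λ σ → Hit j x i σ
        hit i = hits-elim {j} {x} {i} (f i)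

      data View (x : SignVector (Fin r) n) : Set where
        early : proj₁ (scan start x) ℕ.< D → label x ≡ scan start x → View x
        late  : ∀ j → D ℕ.≤ proj₁ (scan start x) → j ℕ.< c → label x ≡ (D ℕ.+ j , hits x j) →
          (∃ λ i → lookup (hits x j) i ≡ true) →
          (∀ j′ i → j′ ℕ.< c → lookup (hits x j′) i ≡ true → j′ ℕ.≤ j) → View x

      view : ∀ x → View x
      view x = go (proj₁ (scan start x) ℕ.<? D) refl
        where
        go : ∀ d → label x ≡ choose x d → View x
        go (yes b<D) e = early b<D e
        go (no b≮D)  e with found x (ℕ.≮⇒≥ b≮D)
        ... | i , σ , j , j<c , h with topmost-spec (hits x) c j i j<c (hits-intro {j} {x} {i} {σ} h)
        ...   | j′ , _ , j′<c , e′ , ne =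
          late j′ (ℕ.≮⇒≥ b≮D) j′<c (trans e (cong (λ s → D ℕ.+ proj₁ s , proj₂ s) e′)) ne highest
          where
          highest : ∀ j″ i → j″ ℕ.< c → lookup (hits x j″) i ≡ true → j″ ℕ.≤ j′
          highest j″ i j″<c t with topmost-spec (hits x) c j″ i j″<c t
          ... | _ , j″≤ , _ , e″ , _ = subst (j″ ℕ.≤_) (cong proj₁ (trans (sym e″) e′)) j″≤

      scan-start-not-full : ∀ (x : SignVector (Fin r) n) → ¬ Full (proj₂ (scan start x))
      scan-start-not-full x = scan-not-full 2≤r start x λ f →
        case trans (sym (f i₀)) (Vec.lookup-replicate i₀ false) of λ ()
        where
        i₀ : Fin r
        i₀ = Fin.fromℕ< (ℕ.≤-trans (s≤s z≤n) 2≤r)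

      label-not-full : ∀ x → ¬ Full (proj₂ (label x))
      label-not-full x with view x
      ... | early _ e        = subst (λ s → ¬ Full (proj₂ s)) (sym e) (scan-start-not-full x)
      ... | late j _ _ e _ _ = subst (λ s → ¬ Full (proj₂ s)) (sym e) (hits-not-full x j)

      label-nonempty : ∀ x → NonZero x → ∃ λ i → lookup (proj₂ (label x)) i ≡ true
      label-nonempty x nz with view x
      ... | early _ e         = subst (λ s → ∃ λ i → lookup (proj₂ s) i ≡ true) (sym e) (scan-nonempty start x nz)
      ... | late j _ _ e ne _ = subst (λ s → ∃ λ i → lookup (proj₂ s) i ≡ true) (sym e) ne

      label-proper : ∀ x → NonZero x → Proper (proj₂ (label x))
      label-proper x nz = label-nonempty x nz , not-full (proj₂ (label x)) (label-not-full x)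

      -- Faces of an early vector are early since `scan` is monotone. Each set of hits grows with
      -- the vector, so the highest colour that is hit cannot drop, and if it stays the same then
      -- its set of signs grows.
      label-face : ∀ {z x} → Face z x → NonZero z → label z ≼ label x
      label-face {z} {x} f nz with view z | view x | scan-face start f
      ... | early _ e         | early _ e′             | h = subst₂ _≼_ (sym e) (sym e′) h
      ... | early b<D e       | late j _ _ e′ _ _      | _ =
        subst₂ _≼_ (sym e) (sym e′) (inj₁ (ℕ.<-≤-trans b<D (ℕ.m≤m+n D j)))
      ... | late _ D≤ _ _ _ _ | early b<D _            | inj₁ h =
        ⊥-elim (ℕ.<-irrefl refl (ℕ.<-≤-trans (ℕ.<-trans h b<D) D≤))
      ... | late _ D≤ _ _ _ _ | early b<D _            | inj₂ (h , _) =
        ⊥-elim (ℕ.<-irrefl (sym h) (ℕ.<-≤-trans b<D D≤))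
      ... | late j _ j<c e (i , t) _ | late j′ _ _ e′ _ highest | _ with ℕ.m≤n⇒m<n∨m≡n (highest j i j<c (hits-face f j i t))
      ...   | inj₁ j<j′ = subst₂ _≼_ (sym e) (sym e′) (inj₁ (ℕ.+-monoʳ-< D j<j′))
      ...   | inj₂ refl = subst₂ _≼_ (sym e) (sym e′) (inj₂ (refl , hits-face f j))

      label-monotone : ∀ {z x} → Face z x → NonZero z → label z ≡ label x ⊎ rank (label z) ℕ.< rank (label x)
      label-monotone {z} {x} f nz = rank-mono (label-not-full z) (label-nonempty x (z , f)) (label-face f nz)

      rank-positive : ∀ x → NonZero x → 1 ℕ.≤ rank (label x)
      rank-positive x nz = ℕ.≤-trans (size-positive (proj₂ (label x)) (proj₁ ne) (proj₂ ne)) (ℕ.m≤n+m _ _)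
        where ne = label-nonempty x nz

      rank-bound : ∀ x → rank (label x) ℕ.≤ (D ℕ.+ c) ℕ.* (r ∸ 1)
      rank-bound x = rank-level (proj₂ (label x)) level (label-not-full x)
        where
        level : proj₁ (label x) ℕ.< D ℕ.+ c
        level with view x
        ... | early b<D e        = subst (λ s → proj₁ s ℕ.< D ℕ.+ c) (sym e) (ℕ.<-≤-trans b<D (ℕ.m≤m+n D c))
        ... | late j _ j<c e _ _ = subst (λ s → proj₁ s ℕ.< D ℕ.+ c) (sym e) (ℕ.+-monoʳ-< D j<c)

      label-permute : ∀ (f f⁻¹ : Fin r → Fin r) → (∀ i → f (f⁻¹ i) ≡ i) → (∀ i → f⁻¹ (f i) ≡ i) →
        ∀ x → label (Vec.map (Maybe.map f) x) ≡ (proj₁ (label x) , permute f⁻¹ (proj₂ (label x)))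
      label-permute f f⁻¹ f∘f⁻¹ f⁻¹∘f x = go (proj₁ (scan start x′) ℕ.<? D) (proj₁ (scan start x) ℕ.<? D)
        where
        open Permuted f f⁻¹ f∘f⁻¹ f⁻¹∘f
        x′ = Vec.map (Maybe.map f) x
        scan′ : scan start x′ ≡ move (scan start x)
        scan′ = trans (cong (λ s → scan (0 , s) x′) (sym permute-empty)) (scan-move start x)
        hits′ : ∀ j → hits x′ j ≡ permute f⁻¹ (hits x j)
        hits′ j = Vec.tabulate-cong λ i → trans
          (does-⇔ (mk⇔ (λ (σ , w , e) → σ , (λ p s → pull p i (w p s)) , e)
                       (λ (σ , w , e) → σ , (λ p s → push p i (w p s)) , e)) (Hit? j x′ i) (Hit? j x (f⁻¹ i)))
          (sym (Vec.lookup∘tabulate (λ i → does (Hit? j x i)) (f⁻¹ i)))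
          where
          pull : ∀ p i → lookup x′ p ≡ just i → lookup x p ≡ just (f⁻¹ i)
          pull p i e with lookup x p | trans (sym (Vec.lookup-map p (Maybe.map f) x)) e
          ... | just a | refl = cong just (sym (f⁻¹∘f a))
          push : ∀ p i → lookup x p ≡ just (f⁻¹ i) → lookup x′ p ≡ just i
          push p i e = trans (Vec.lookup-map p (Maybe.map f) x) (trans (cong (Maybe.map f) e) (cong just (f∘f⁻¹ i)))
        topmost′ : ∀ c → topmost (hits x′) c ≡ move (topmost (hits x) c)
        topmost′ c = trans (topmost-cong c hits′) (commutes c)
          where
          commutes : ∀ c → topmost (λ j → permute f⁻¹ (hits x j)) c ≡ move (topmost (hits x) c)
          commutes zero    = cong (0 ,_) (sym permute-empty)
          commutes (suc c) with Fin.any? (λ i → lookup (permute f⁻¹ (hits x c)) i Bool.≟ true)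
                              | Fin.any? (λ i → lookup (hits x c) i Bool.≟ true)
          ... | yes _       | yes _       = refl
          ... | no _        | no _        = commutes c
          ... | yes (i , t) | no ¬ne      = ⊥-elim (¬ne (f⁻¹ i , trans (sym (Vec.lookup∘tabulate _ i)) t))
          ... | no ¬ne      | yes (i , t) = ⊥-elim (¬ne (f i , trans (Vec.lookup∘tabulate _ (f i))
                                              (trans (cong (lookup (hits x c)) (f⁻¹∘f i)) t)))
        go : ∀ d′ d → choose x′ d′ ≡ move (choose x d)
        go (yes _) (yes _) = scan′
        go (no _)  (no _)  = cong (λ s → D ℕ.+ proj₁ s , proj₂ s) (topmost′ c)
        go (yes h) (no ¬h) = ⊥-elim (¬h (subst (λ s → proj₁ s ℕ.< D) scan′ h))
        go (no ¬h) (yes h) = ⊥-elim (¬h (subst (λ s → proj₁ s ℕ.< D) (sym scan′) h))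

      impossible : ∀ p m → Prime p → r ≡ p ℕ.^ m → (D ℕ.+ c) ℕ.* (r ∸ 1) ℕ.< n → ⊥
      impossible p m p-prime r≡ bound = NoLabelling.no-labelling label label-permute label-proper
        rank rank-positive (λ x _ → ℕ.≤-<-trans (rank-bound x) bound) label-monotone
        (ℕ.≤-<-trans z≤n bound) (Fin.fromℕ< (ℕ.≤-trans (s≤s z≤n) 2≤r)) p m p-prime r≡

-- Extraction of a stable set from a vector with many blocks

module StableExtraction where
  open import Data.Nat as ℕ using (ℕ; zero; suc; s≤s; z≤n; _∸_; _+_; _*_; _≤_; _<_; _⊔_)
  import Data.Nat.Properties as ℕ
  import Data.Nat.Tactic.RingSolver as ℕSolver
  open import Data.Bool using (true; false)
  open import Data.Fin as Fin using (Fin; zero; suc; toℕ)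
  import Data.Fin.Properties as Fin
  open import Data.Fin.Subset using (Subset; ∣_∣)
  open import Data.List as List using (List; []; _∷_; length)
  open import Data.List.Relation.Unary.All as All using (All; []; _∷_)
  open import Data.Maybe using (just; nothing)
  open import Data.Vec as Vec using (Vec; []; _∷_; lookup; toList)
  import Data.Vec.Properties as Vec
  open import Data.Product using (∃; _×_; _,_; proj₁; proj₂)
  open import Data.Sum using (inj₁; inj₂)
  open import Data.Empty using (⊥-elim)
  open import Function using (case_of_; _∘_)
  open import Relation.Binary.PropositionalEquality using (_≡_; _≢_; refl; sym; trans; cong; cong₂; subst)
  open import Relation.Nullary
  open import Defs
  open import Data.Nat.ListAction using (sum)
  import Data.List.Properties as List
  open import Data.List.Relation.Unary.Any using (here; there)
  open import Data.List.Membership.Propositional using (_∈_)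
  open Obstruction
  open BlockLabelling

  -- Certificate for linear arithmetic: a ≤ b follows from l ≤ r when b + l exceeds a + r by a
  -- given slack.
  certify : ∀ {a b l r} slack → l ≤ r → a + r + slack ≡ b + l → a ≤ b
  certify {a} {b} {l} {r} slack l≤r e = ℕ.+-cancelʳ-≤ r a b
    (ℕ.≤-trans (ℕ.m≤m+n (a + r) slack) (ℕ.≤-trans (ℕ.≤-reflexive e) (ℕ.+-monoʳ-≤ b l≤r)))

  2*-mono : ∀ {a b} → a ≤ b → 2 * a ≤ 2 * b
  2*-mono = ℕ.*-monoʳ-≤ 2

  total : ∀ {r} → (Fin r → ℕ) → ℕ
  total {zero}  f = 0
  total {suc r} f = f zero + total (λ i → f (suc i))

  total-cong : ∀ {r} {f f′ : Fin r → ℕ} → (∀ i → f i ≡ f′ i) → total f ≡ total f′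
  total-cong {zero}  e = refl
  total-cong {suc r} e = cong₂ _+_ (e zero) (total-cong (λ i → e (suc i)))

  total-increment : ∀ {r} (g : Fin r) {f f′ : Fin r → ℕ} → f′ g ≡ suc (f g) → (∀ i → i ≢ g → f′ i ≡ f i) →
    total f′ ≡ suc (total f)
  total-increment zero    {f} e e′ = cong₂ _+_ e (total-cong (λ i → e′ (suc i) λ ()))
  total-increment (suc g) {f} e e′ = trans
    (cong₂ _+_ (e′ zero λ ()) (total-increment g e (λ i i≢g → e′ (suc i) (λ { refl → i≢g refl }))))
    (ℕ.+-suc (f zero) _)

  total-0 : ∀ r → total {r} (λ _ → 0) ≡ 0
  total-0 zero    = refl
  total-0 (suc r) = total-0 r

  total-≤ : ∀ {r} (f : Fin r → ℕ) b → (∀ i → f i ≤ b) → total f ≤ r * b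
  total-≤ {zero}  f b h = z≤n
  total-≤ {suc r} f b h = ℕ.+-mono-≤ (h zero) (total-≤ (λ i → f (suc i)) b (λ i → h (suc i)))

  pigeonhole : ∀ {r} (f : Fin r → ℕ) b → r * b < total f → ∃ λ i → b < f i
  pigeonhole f b h with Fin.any? (λ i → b ℕ.<? f i)
  ... | yes w = w
  ... | no ¬w = ⊥-elim (ℕ.<-irrefl refl (ℕ.<-≤-trans h (total-≤ f b (λ i → ℕ.≮⇒≥ (λ b< → ¬w (i , b<))))))

  -- `rk` is the rank of the scan just before the entry is read. Each counted entry raises the rank
  -- by one, so `rk` is also the number of counted entries before it.
  record Entry : Set where
    constructor entry
    field
      pos rk : ℕ
  open Entry

  data Chain (_~_ : Entry → Entry → Set) : Entry → List Entry → Entry → Set where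
    []  : ∀ {z} → Chain _~_ z [] z
    _∷_ : ∀ {t u l z} → t ~ u → Chain _~_ u l z → Chain _~_ t (u ∷ l) z

  -- r = s + 1 = s₀ + 2 and k = m + 3, in the notation of the theorem.
  module Selection (s₀ m D : ℕ) (enough : suc (suc s₀) * (m + 2) ≤ D * suc s₀) where
    -- `K` is `r (k - 3) + 2 (k - 1)`, twice the length of an arc whose `k - 1` steps enclose gaps
    -- of total size `r (k - 3) / 2`. That total is what stability on average asks of all gaps but a
    -- largest one.
    s K : ℕ
    s = suc s₀
    K = suc s * m + 2 * m + 4

    -- Satisfied by successive counted entries of one sign. The entry that starts the block after
    -- the first of them has another sign and lies strictly between, whence the 2. A sign absent
    -- from a completed block starts the next one, so the second entry comes at most two block
    -- lengths later.
    record Link (t u : Entry) : Set where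
      field
        lower   : 2 + rk t ≤ rk u
        upper   : rk u ≤ rk t + 2 * s
        advance : rk u + pos t ≤ pos u + rk t

    record Before (t u : Entry) : Set where
      field
        rank<   : rk t < rk u
        advance : rk u + pos t ≤ pos u + rk t

    link⇒before : ∀ {t u} → Link t u → Before t u
    link⇒before l = record { rank< = ℕ.<-trans ℕ.≤-refl (Link.lower l) ; advance = Link.advance l }

    before-trans : ∀ {t u v} → Before t u → Before u v → Before t v
    before-trans {t} {u} {v} h h′ = record
      { rank<   = ℕ.<-trans (Before.rank< h) (Before.rank< h′)
      ; advance = certify 0 (ℕ.+-mono-≤ (Before.advance h) (Before.advance h′))
                    (lem (rk t) (rk u) (rk v) (pos t) (pos u) (pos v)) }
      where
      lem : ∀ a b c d e f → c + d + (e + a + (f + b)) + 0 ≡ f + a + (b + d + (c + e))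
      lem = ℕSolver.solve-∀

    -- Ranks are placed on a cycle of length `D s + 1`, the number of counted entries. `small` says
    -- that the arc complementary to the step from `t` to `u` has length at least `K / 2`.
    record Spread (t u : Entry) : Set where
      field
        before : Before t u
        small  : K + 2 * rk u ≤ 2 * (D * s + 1) + 2 * rk t

    Long : Entry → Entry → Set
    Long z t = K + 2 * rk t ≤ 2 * rk z

    link⇒spread : ∀ {t u} → Link t u → Spread t u
    link⇒spread {t} {u} l = record
      { before = link⇒before l
      ; small  = certify (m * s₀ + 2) (ℕ.+-mono-≤ (2*-mono (Link.upper l)) (2*-mono enough))
                   (lem s₀ m (rk t) (rk u) (D * suc s₀)) }
      where
      lem : ∀ s₀ m t u d →
        suc (suc s₀) * m + 2 * m + 4 + 2 * u + (2 * (t + 2 * suc s₀) + 2 * d) + (m * s₀ + 2) ≡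
        2 * (d + 1) + 2 * t + (2 * u + 2 * (suc (suc s₀) * (m + 2)))
      lem = ℕSolver.solve-∀

    chain-length : ∀ {t l z} → Chain Link t l z → 2 * length l + rk t ≤ rk z
    chain-length []                      = ℕ.≤-refl
    chain-length {t} {u ∷ l} {z} (h ∷ c) = certify 0 (ℕ.+-mono-≤ (Link.lower h) (chain-length c))
      (lem (length l) (rk t) (rk u) (rk z))
      where
      lem : ∀ l t u z → 2 * suc l + t + (u + z) + 0 ≡ z + (2 + t + (2 * l + u))
      lem = ℕSolver.solve-∀

    chain-map : ∀ {t l z} → Chain Link t l z → Chain Spread t l z
    chain-map []      = []
    chain-map (h ∷ c) = link⇒spread h ∷ chain-map c

    record Suffix (P : Entry → Set) (t z : Entry) (j : ℕ) : Set where
      field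
        {next}  : Entry
        {rest}  : List Entry
        chain   : Chain Link next rest z
        size    : length rest ≡ j
        before  : Before t next
        within  : All P (next ∷ rest)

    suffix : ∀ {P : Entry → Set} e j {t l z} → length l ≡ e + suc j → Chain Link t l z → All P l → Suffix P t z j
    suffix zero    j eq (h ∷ c) ps       = record
      { chain = c ; size = ℕ.suc-injective eq ; before = link⇒before h ; within = ps }
    suffix (suc e) j eq (h ∷ c) (_ ∷ ps) = record
      { chain = chain ; size = size ; before = before-trans (link⇒before h) before ; within = within }
      where open Suffix (suffix e j (ℕ.suc-injective eq) c ps)

    record Selected (P : Entry → Set) (z : Entry) : Set where
      field
        {first} : Entry
        {rest}  : List Entry
        chain   : Chain Spread first rest z
        size    : length rest ≡ m + 2
        long    : Long z first
        within  : All P (first ∷ rest)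

    -- Discrete intermediate value argument: the chosen entries are some t
    -- followed by the last m + 2 entries. As t moves right, the cyclic gap before
    -- t grows and the gap after t shrinks, and they are never both too large.
    select : ∀ {P : Entry → Set} e {t l z} → length l ≡ e + (m + 2) → Chain Link t l z → Long z t →
      All P (t ∷ l) → Selected P z
    select zero    eq c A ps = record { chain = chain-map c ; size = eq ; long = A ; within = ps }
    select (suc e) {t} {u ∷ l} {z} eq (h ∷ c) A (p ∷ q ∷ ps) with K + 2 * rk u ℕ.≤? 2 * rk z
    ... | yes A′ = select e (ℕ.suc-injective eq) c A′ (q ∷ ps)
    ... | no ¬A′ = record
      { chain  = record { before = before-trans (link⇒before h) before ; small = small } ∷ chain-map chain
      ; size   = trans (cong suc size) (lem₀ m)
      ; long   = A
      ; within = p ∷ within }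
      where
      lem₀ : ∀ m → suc (m + 1) ≡ m + 2
      lem₀ = ℕSolver.solve-∀
      open Suffix (suffix e (m + 1) (trans (ℕ.suc-injective eq) (cong (e +_) (sym (lem₀ m)))) c ps)
      lem : ∀ s₀ m t u w z d → suc (suc s₀) * m + 2 * m + 4 + 2 * w +
          (suc (suc s₀) * m + 2 * m + 4 + 2 * u + (2 * (t + 2 * suc s₀) + (2 * z + 2 * d))) + 3 ≡
        2 * (d + 1) + 2 * t +
          (suc (2 * z) + (2 * u + (2 * (2 * (m + 1) + w) + 2 * (suc (suc s₀) * (m + 2)))))
      lem = ℕSolver.solve-∀
      small : K + 2 * rk next ≤ 2 * (D * s + 1) + 2 * rk t
      -- As `u` is no longer `Long`, `rk z` is below `rk u + K / 2`, hence below
      -- `rk t + 2 s + K / 2`, and the `m + 1` links from `next` to `z` take up at least `2 (m + 1)`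
      -- ranks. The bound follows from `K + 2 s - 2 (m + 1) = r (m + 2)`, which `enough` bounds by
      -- `D s`.
      small = certify 3 (ℕ.+-mono-≤ (ℕ.≰⇒> ¬A′) (ℕ.+-mono-≤ (2*-mono (Link.upper h))
        (ℕ.+-mono-≤ (2*-mono (subst (λ j → 2 * j + rk next ≤ rk z) size (chain-length chain))) (2*-mono enough))))
        (lem s₀ m (rk t) (rk u) (rk next) (rk z) (D * suc s₀))

    r : ℕ
    r = suc s

    open Ranked {r} using (rank; size<⇒≤)

    -- `late` holds because the sign occurs in block `D - 1` or else starts block `D`. `finish`
    -- leaves room behind `z` for the counted entries of ranks `rk z + 1` to `D s`.
    record Final (n : ℕ) (z : Entry) : Set where
      field
        late   : D * s ≤ rk z + s
        finish : pos z + (D * s + 1) ≤ n + rk z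

    add : Fin r → Fin r → Entry → List Entry → List Entry
    add i g e l with i Fin.≟ g
    ... | yes _ = e ∷ l
    ... | no  _ = l

    -- The entries with sign i that enlarge the rank of the state of the scan, up
    -- to the one starting block number D (counted from 0).
    occurrences : Fin r → ∀ {n} → State r → ℕ → SignVector (Fin r) n → List Entry
    occurrences i st      p []            = []
    occurrences i st      p (nothing ∷ x) = occurrences i st (suc p) x
    occurrences i (b , S) p (just g ∷ x) with lookup S g
    ... | true  = occurrences i (b , S) (suc p) x
    ... | false with Full? (insert g S)
    ...   | no _  = add i g (entry p (rank (b , S))) (occurrences i (b , insert g S) (suc p) x)
    ...   | yes _ with suc b ℕ.≟ D
    ...     | yes _ = add i g (entry p (rank (b , S))) []
    ...     | no  _ = add i g (entry p (rank (b , S))) (occurrences i (suc b , singleton g) (suc p) x)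

    fixed-step : ∀ b (S : Subset r) g → ¬ Full S → lookup S g ≡ true → step (b , S) (just g) ≡ (b , S)
    fixed-step b S g ¬f e with Full? (insert g S)
    ... | yes f = ⊥-elim (¬f (subst Full (insert-∈ g S e) f))
    ... | no _  = cong (b ,_) (insert-∈ g S e)

    size-complete : ∀ (S : Subset r) g → lookup S g ≡ false → Full (insert g S) → ∣ S ∣ ≡ s
    size-complete S g e f = ℕ.suc-injective (trans (sym (size-insert g S e)) (size-full (insert g S) f))

    total-add : ∀ g e (l : Fin r → List Entry) →
      total (λ i → length (add i g e (l i))) ≡ suc (total (λ i → length (l i)))
    total-add g e l = total-increment g at-g at-other
      where
      at-g : length (add g g e (l g)) ≡ suc (length (l g))
      at-g with g Fin.≟ g
      ... | yes _ = refl
      ... | no ¬e = ⊥-elim (¬e refl)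
      at-other : ∀ i → i ≢ g → length (add i g e (l i)) ≡ length (l i)
      at-other i i≢g with i Fin.≟ g
      ... | yes i≡g = ⊥-elim (i≢g i≡g)
      ... | no _    = refl

    2≤r : 2 ≤ r
    2≤r = s≤s (s≤s z≤n)

    -- Closing a block raises the rank by one like every other counted entry: from `b s + s` to
    -- `(b + 1) s + 1`. The entry that starts block `D` is read at rank `D s` and counted as well,
    -- which gives the final `suc`.
    total-occurrences : ∀ {n} b (S : Subset r) p (x : SignVector (Fin r) n) → ¬ Full S → b < D →
      D ≤ proj₁ (scan (b , S) x) → total (λ i → length (occurrences i (b , S) p x)) + rank (b , S) ≡ suc (D * s)
    total-occurrences b S p []            ¬f b<D D≤ = ⊥-elim (ℕ.<-irrefl refl (ℕ.<-≤-trans b<D D≤))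
    total-occurrences b S p (nothing ∷ x) ¬f b<D D≤ = total-occurrences b S (suc p) x ¬f b<D D≤
    total-occurrences b S p (just g ∷ x)  ¬f b<D D≤ with lookup S g in eq
    ... | true = total-occurrences b S (suc p) x ¬f b<D
                   (subst (λ st → D ≤ proj₁ (scan st x)) (fixed-step b S g ¬f eq) D≤)
    ... | false with Full? (insert g S)
    ...   | no ¬f′ = trans (cong (_+ rank (b , S)) (total-add g _ (λ i → occurrences i (b , insert g S) (suc p) x)))
            (trans (trans (sym (ℕ.+-suc _ _)) (cong (T +_) (trans (sym (ℕ.+-suc (b * s) ∣ S ∣))
              (cong (b * s +_) (sym (size-insert g S eq))))))
              (total-occurrences b (insert g S) (suc p) x ¬f′ b<D D≤))
      where T = total (λ i → length (occurrences i (b , insert g S) (suc p) x))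
    ...   | yes f with suc b ℕ.≟ D
    ...     | yes refl = trans (cong (_+ rank (b , S)) (trans (total-add g _ (λ _ → [])) (cong suc (total-0 r))))
              (cong suc (trans (cong (b * s +_) (size-complete S g eq f)) (ℕ.+-comm (b * s) s)))
    ...     | no b≢D = trans (cong (_+ rank (b , S)) (total-add g _ (λ i → occurrences i (suc b , singleton g) (suc p) x)))
              (trans (trans (sym (ℕ.+-suc _ _)) (cong (T +_) (trans
                  (cong (λ v → suc (b * s + v)) (size-complete S g eq f))
                  (trans (lem (b * s) s) (cong (suc b * s +_) (sym (size-singleton g)))))))
                (total-occurrences (suc b) (singleton g) (suc p) x (singleton-not-full 2≤r g)
                  (ℕ.≤∧≢⇒< b<D b≢D) D≤))
      where
      T = total (λ i → length (occurrences i (suc b , singleton g) (suc p) x))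
      lem : ∀ a s → suc (a + s) ≡ s + a + 1
      lem = ℕSolver.solve-∀

    SignAt : ∀ {n} → SignVector (Fin r) n → Fin r → ℕ → Entry → Set
    SignAt {n} x i p e = ∃ λ (q : Fin n) → pos e ≡ p + toℕ q × lookup x q ≡ just i

    SignAt-shift : ∀ {n} m′ (x : SignVector (Fin r) n) i p {l} →
      All (SignAt x i (suc p)) l → All (SignAt (m′ ∷ x) i p) l
    SignAt-shift m′ x i p = All.map λ (q , e , e′) → suc q , trans e (sym (ℕ.+-suc p (toℕ q))) , e′

    add-sign : ∀ {n} i g p v (x : SignVector (Fin r) n) l → All (SignAt x i (suc p)) l →
      All (SignAt (just g ∷ x) i p) (add i g (entry p v) l)
    add-sign i g p v x l ps with i Fin.≟ g
    ... | yes refl = (zero , sym (ℕ.+-identityʳ p) , refl) ∷ SignAt-shift (just g) x i p ps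
    ... | no _     = SignAt-shift (just g) x i p ps

    occurrences-sign : ∀ {n} i st p (x : SignVector (Fin r) n) → All (SignAt x i p) (occurrences i st p x)
    occurrences-sign i st      p []            = []
    occurrences-sign i st      p (nothing ∷ x) = SignAt-shift nothing x i p (occurrences-sign i st (suc p) x)
    occurrences-sign i (b , S) p (just g ∷ x) with lookup S g
    ... | true  = SignAt-shift (just g) x i p (occurrences-sign i (b , S) (suc p) x)
    ... | false with Full? (insert g S)
    ...   | no _  = add-sign i g p _ x _ (occurrences-sign i (b , insert g S) (suc p) x)
    ...   | yes _ with suc b ℕ.≟ D
    ...     | yes _ = add-sign i g p _ x [] []
    ...     | no  _ = add-sign i g p _ x _ (occurrences-sign i (suc b , singleton g) (suc p) x)

    module Track (n : ℕ) (i : Fin r) where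

      -- t is the last entry seen; it lies in the current block or, if the current
      -- block does not contain i yet, in the preceding one.
      record Invariant (t : Entry) (b : ℕ) (S : Subset r) (p : ℕ) : Set where
        field
          behind  : rk t < rank (b , S)
          advance : rank (b , S) + pos t ≤ p + rk t
          current : lookup S i ≡ true → b * s ≤ rk t
          recent  : lookup S i ≡ false → b * s ≤ rk t + s × rk t < b * s
          started : 1 ≤ ∣ S ∣
          proper  : ¬ Full S

      record Continuation (t : Entry) (l : List Entry) : Set where
        field
          {last} : Entry
          chain  : Chain Link t l last
          final  : Final n last

      size≤s : ∀ (S : Subset r) → ¬ Full S → ∣ S ∣ ≤ s
      size≤s S ¬f = size<⇒≤ (size-proper S _ (proj₂ (not-full S ¬f)))

      new-link : ∀ {t b S p} → Invariant t b S p → lookup S i ≡ false → Link t (entry p (rank (b , S)))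
      new-link {t} {b} {S} {p} inv e = record
        { lower   = ℕ.+-mono-≤ {1} {∣ S ∣} started (proj₂ (recent e)) ⟨≤⟩ ℕ.≤-reflexive (ℕ.+-comm ∣ S ∣ (b * s))
        ; upper   = certify 0 (ℕ.+-mono-≤ (proj₁ (recent e)) (size≤s S proper)) (lem (b * s) ∣ S ∣ (rk t) s)
        ; advance = advance }
        where
        open Invariant inv
        _⟨≤⟩_ = ℕ.≤-trans
        lem : ∀ b S t s → b + S + (t + s + s) + 0 ≡ t + 2 * s + (b + S)
        lem = ℕSolver.solve-∀

      skip : ∀ {t b S p} → Invariant t b S p → Invariant t b S (suc p)
      skip inv = record { Invariant inv ; advance = ℕ.m≤n⇒m≤1+n (Invariant.advance inv) }

      continue : ∀ {t g e l} → (i ≡ g → Link t e × Continuation e l) → (i ≢ g → Continuation t l) →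
        Continuation t (add i g e l)
      continue {g = g} new old with i Fin.≟ g
      ... | yes i≡g = let open Continuation (proj₂ (new i≡g)) in
        record { chain = proj₁ (new i≡g) ∷ chain ; final = final }
      ... | no i≢g  = old i≢g

      rank-insert : ∀ b S g → lookup S g ≡ false → suc (rank (b , S)) ≡ rank (b , insert g S)
      rank-insert b S g e = trans (sym (ℕ.+-suc (b * s) ∣ S ∣)) (cong (b * s +_) (sym (size-insert g S e)))

      rank-complete : ∀ b S g → lookup S g ≡ false → Full (insert g S) → suc b * s ≡ rank (b , S)
      rank-complete b S g e f = trans (ℕ.+-comm s (b * s)) (cong (b * s +_) (sym (size-complete S g e f)))

      rank-singleton : ∀ b S g → lookup S g ≡ false → Full (insert g S) →
        suc (rank (b , S)) ≡ rank (suc b , singleton g)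
      rank-singleton b S g e f = trans (cong suc (sym (rank-complete b S g e f)))
        (trans (ℕ.+-comm 1 (suc b * s)) (cong (suc b * s +_) (sym (size-singleton g))))

      started-here : ∀ {b S p v} → lookup S i ≡ true → ¬ Full S → b * s ≤ v → suc v ≡ rank (b , S) →
        Invariant (entry p v) b S (suc p)
      started-here {b} {S} {p} {v} e ¬f cur eq = record
        { behind  = ℕ.≤-reflexive eq
        ; advance = ℕ.≤-reflexive (trans (cong (_+ p) (sym eq)) (cong suc (ℕ.+-comm v p)))
        ; current = λ _ → cur
        ; recent  = λ e′ → case trans (sym e) e′ of λ ()
        ; started = size-positive S i e
        ; proper  = ¬f }

      track : ∀ {n′ t b S p} (x : SignVector (Fin r) n′) → p + n′ ≡ n → Invariant t b S p → b < D →
        D ≤ proj₁ (scan (b , S) x) → Continuation t (occurrences i (b , S) p x)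
      track [] eq inv b<D D≤ = ⊥-elim (ℕ.<-irrefl refl (ℕ.<-≤-trans b<D D≤))
      track {suc n′} {p = p} (nothing ∷ x) eq inv b<D D≤ =
        track x (trans (sym (ℕ.+-suc p n′)) eq) (skip inv) b<D D≤
      track {suc n′} {t} {b} {S} {p} (just g ∷ x) eq inv b<D D≤ with lookup S g in eg
      ... | true = track x (trans (sym (ℕ.+-suc p n′)) eq) (skip inv) b<D
                     (subst (λ st → D ≤ proj₁ (scan st x)) (fixed-step b S g (Invariant.proper inv) eg) D≤)
      ... | false with Full? (insert g S)
      ...   | no ¬f = continue
        (λ { refl → new-link inv eg
                  , track x (trans (sym (ℕ.+-suc p n′)) eq)
                      (started-here (insert-self i S) ¬f (ℕ.m≤m+n (b * s) ∣ S ∣) (rank-insert b S g eg)) b<D D≤ })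
        (λ i≢g → track x (trans (sym (ℕ.+-suc p n′)) eq) (record
          { behind  = ℕ.<-trans behind (ℕ.≤-reflexive (rank-insert b S g eg))
          ; advance = ℕ.≤-trans (ℕ.≤-reflexive (cong (_+ pos t) (sym (rank-insert b S g eg)))) (s≤s advance)
          ; current = λ e → current (trans (sym (insert-other S i≢g)) e)
          ; recent  = λ e → recent (trans (sym (insert-other S i≢g)) e)
          ; started = size-positive (insert g S) g (insert-self g S)
          ; proper  = ¬f }) b<D D≤)
        where open Invariant inv
      ...   | yes f with suc b ℕ.≟ D
      ...     | yes refl = continue
        (λ { refl → new-link inv eg , record
          { chain = []
          ; final = record
            { late   = ℕ.≤-trans (ℕ.≤-reflexive rank-eq) (ℕ.m≤m+n _ s)
            ; finish = ℕ.≤-trans (ℕ.≤-reflexive (trans (cong (λ v → p + (v + 1)) rank-eq) (lem p (rank (b , S)))))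
                         (ℕ.+-monoˡ-≤ (rank (b , S)) p<n) } } })
        -- The closing sign `g` is the only one missing from block `D - 1`, so `i` is in that block
        -- and `t` was its last entry.
        (λ i≢g → record
          { chain = []
          ; final = record
            { late   = ℕ.≤-trans (ℕ.≤-reflexive (ℕ.+-comm s (b * s)))
                         (ℕ.+-monoˡ-≤ s (current (trans (sym (insert-other S i≢g)) (f i))))
            ; finish = certify 0 (ℕ.+-mono-≤ advance p<n)
                         (trans (cong (λ v → pos t + (v + 1) + (p + rk t + n) + 0) rank-eq)
                           (lem′ (pos t) (rank (b , S)) p (rk t) n)) } })
        where
        open Invariant inv
        rank-eq = rank-complete b S g eg f
        p<n : suc p ≤ n
        p<n = ℕ.≤-trans (ℕ.m≤m+n (suc p) n′) (ℕ.≤-reflexive (trans (sym (ℕ.+-suc p n′)) eq))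
        lem : ∀ p v → p + (v + 1) ≡ suc p + v
        lem = ℕSolver.solve-∀
        lem′ : ∀ t v p w n → t + (v + 1) + (p + w + n) + 0 ≡ n + w + (v + t + suc p)
        lem′ = ℕSolver.solve-∀
      ...     | no b≢D = continue
        (λ { refl → new-link inv eg
                  , track x (trans (sym (ℕ.+-suc p n′)) eq)
                      (started-here (insert-self i empty) (singleton-not-full 2≤r i)
                        (ℕ.≤-reflexive (rank-complete b S g eg f)) (rank-singleton b S g eg f))
                      (ℕ.≤∧≢⇒< b<D b≢D) D≤ })
        (λ i≢g → track x (trans (sym (ℕ.+-suc p n′)) eq) (record
          { behind  = ℕ.<-trans behind (ℕ.≤-reflexive (rank-singleton b S g eg f))
          ; advance = ℕ.≤-trans (ℕ.≤-reflexive (cong (_+ pos t) (sym (rank-singleton b S g eg f)))) (s≤s advance)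
          ; current = λ e → ⊥-elim (i≢g (singleton-∈ e))
          ; recent  = λ _ →
              ℕ.≤-trans (ℕ.≤-reflexive (ℕ.+-comm s (b * s)))
                (ℕ.+-monoˡ-≤ s (current (trans (sym (insert-other S i≢g)) (f i))))
            , ℕ.<-≤-trans behind (ℕ.≤-reflexive (sym (rank-complete b S g eg f)))
          ; started = ℕ.≤-reflexive (sym (size-singleton g))
          ; proper  = singleton-not-full 2≤r g }) (ℕ.≤∧≢⇒< b<D b≢D) D≤)
        where open Invariant inv

      data Opening : List Entry → Set where
        opening : ∀ {e l} → rk e ≤ s → rk e ≤ pos e → Continuation e l → Opening (e ∷ l)

      open-continue : ∀ {g e l} → (i ≡ g → rk e ≤ s × rk e ≤ pos e × Continuation e l) → (i ≢ g → Opening l) →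
        Opening (add i g e l)
      open-continue {g} new old with i Fin.≟ g
      ... | yes i≡g = let (h , h′ , c) = new i≡g in opening h h′ c
      ... | no i≢g  = old i≢g

      -- If sign `i` is absent from block 0, it is the missing sign that starts block 1; its first
      -- entry therefore has rank at most `s`.
      track-start : ∀ {n′ S p} (x : SignVector (Fin r) n′) → p + n′ ≡ n → lookup S i ≡ false → ¬ Full S →
        ∣ S ∣ ≤ p → 0 < D → D ≤ proj₁ (scan (0 , S) x) → Opening (occurrences i (0 , S) p x)
      track-start [] eq e ¬f S≤p 0<D D≤ = ⊥-elim (ℕ.<-irrefl refl (ℕ.<-≤-trans 0<D D≤))
      track-start {suc n′} {p = p} (nothing ∷ x) eq e ¬f S≤p 0<D D≤ =
        track-start x (trans (sym (ℕ.+-suc p n′)) eq) e ¬f (ℕ.m≤n⇒m≤1+n S≤p) 0<D D≤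
      track-start {suc n′} {S} {p} (just g ∷ x) eq e ¬f S≤p 0<D D≤ with lookup S g in eg
      ... | true = track-start x (trans (sym (ℕ.+-suc p n′)) eq) e ¬f (ℕ.m≤n⇒m≤1+n S≤p) 0<D
                     (subst (λ st → D ≤ proj₁ (scan st x)) (fixed-step 0 S g ¬f eg) D≤)
      ... | false with Full? (insert g S)
      ...   | no ¬f′ = open-continue
        (λ { refl → size≤s S ¬f , S≤p
                  , track x (trans (sym (ℕ.+-suc p n′)) eq)
                      (started-here (insert-self i S) ¬f′ z≤n (rank-insert 0 S g eg)) 0<D D≤ })
        (λ i≢g → track-start x (trans (sym (ℕ.+-suc p n′)) eq) (trans (insert-other S i≢g) e) ¬f′
          (ℕ.≤-trans (ℕ.≤-reflexive (size-insert g S eg)) (s≤s S≤p)) 0<D D≤)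
      ...   | yes f with suc 0 ℕ.≟ D
      ...     | yes refl = open-continue
        (λ { refl → size≤s S ¬f , S≤p , record
          { chain = []
          ; final = record
            { late   = ℕ.≤-trans (ℕ.≤-reflexive (rank-complete 0 S g eg f)) (ℕ.m≤m+n _ s)
            ; finish = ℕ.≤-trans (ℕ.≤-reflexive (trans (cong (λ v → p + (v + 1)) (rank-complete 0 S g eg f))
                         (lem p (rank (0 , S))))) (ℕ.+-monoˡ-≤ (rank (0 , S)) p<n) } } })
        (λ i≢g → case trans (sym e) (trans (sym (insert-other S i≢g)) (f i)) of λ ())
        where
        p<n : suc p ≤ n
        p<n = ℕ.≤-trans (ℕ.m≤m+n (suc p) n′) (ℕ.≤-reflexive (trans (sym (ℕ.+-suc p n′)) eq))
        lem : ∀ p v → p + (v + 1) ≡ suc p + v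
        lem = ℕSolver.solve-∀
      ...     | no 1≢D = open-continue
        (λ { refl → size≤s S ¬f , S≤p
                  , track x (trans (sym (ℕ.+-suc p n′)) eq)
                      (started-here (insert-self i empty) (singleton-not-full 2≤r i)
                        (ℕ.≤-reflexive (rank-complete 0 S g eg f)) (rank-singleton 0 S g eg f))
                      (ℕ.≤∧≢⇒< 0<D 1≢D) D≤ })
        (λ i≢g → case trans (sym e) (trans (sym (insert-other S i≢g)) (f i)) of λ ())

  -- From chosen entries to subsets and their cyclic gaps

  data Ascending (hi : ℕ) : ℕ → List ℕ → Set where
    []  : ∀ {lo} → Ascending hi lo []
    _∷_ : ∀ {lo q l} → lo ≤ q × q < hi → Ascending hi (suc q) l → Ascending hi lo (q ∷ l)

  mark : ∀ n → ℕ → List ℕ → Subset n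
  mark zero    i l       = []
  mark (suc n) i []      = false ∷ mark n (suc i) []
  mark (suc n) i (q ∷ l) with q ℕ.≟ i
  ... | yes _ = true ∷ mark n (suc i) l
  ... | no _  = false ∷ mark n (suc i) (q ∷ l)

  positions-mark : ∀ n i {l hi} → i + n ≡ hi → Ascending hi i l → positionsFrom i (toList (mark n i l)) ≡ l
  positions-mark zero    i eq []                   = refl
  positions-mark zero    i eq ((i≤q , q<hi) ∷ a)   =
    ⊥-elim (ℕ.<-irrefl refl (ℕ.<-≤-trans q<hi (ℕ.≤-trans (ℕ.≤-reflexive (trans (sym eq) (ℕ.+-identityʳ i))) i≤q)))
  positions-mark (suc n) i eq []                   = positions-mark n (suc i) (trans (sym (ℕ.+-suc i n)) eq) []
  positions-mark (suc n) i {q ∷ l} eq ((i≤q , q<hi) ∷ a) with q ℕ.≟ i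
  ... | yes refl = cong (q ∷_) (positions-mark n (suc i) (trans (sym (ℕ.+-suc i n)) eq) a)
  ... | no q≢i   = positions-mark n (suc i) (trans (sym (ℕ.+-suc i n)) eq)
                     ((ℕ.≤∧≢⇒< i≤q (q≢i ∘ sym) , q<hi) ∷ a)

  length-positions : ∀ {n} i (σ : Subset n) → ∣ σ ∣ ≡ length (positionsFrom i (toList σ))
  length-positions i []          = refl
  length-positions i (true ∷ σ)  = cong suc (length-positions (suc i) σ)
  length-positions i (false ∷ σ) = length-positions (suc i) σ

  ∈-positions : ∀ {n} i (σ : Subset n) p → lookup σ p ≡ true → i + toℕ p ∈ positionsFrom i (toList σ)
  ∈-positions i (true ∷ σ)  zero    e = here (ℕ.+-identityʳ i)
  ∈-positions i (true ∷ σ)  (suc p) e =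
    there (subst (_∈ positionsFrom (suc i) (toList σ)) (sym (ℕ.+-suc i (toℕ p))) (∈-positions (suc i) σ p e))
  ∈-positions i (false ∷ σ) (suc p) e =
    subst (_∈ positionsFrom (suc i) (toList σ)) (sym (ℕ.+-suc i (toℕ p))) (∈-positions (suc i) σ p e)

  gaps-positions : ∀ {n} (σ : Subset n) {p ps} → positions σ ≡ p ∷ ps → gaps σ ≡ gapsAux n p p ps
  gaps-positions σ e with positions σ | e
  ... | _ | refl = refl

  sum-gaps : ∀ n f {prev qs} → prev < n → Ascending n (suc prev) qs →
    sum (gapsAux n f prev qs) + (length qs + suc prev) ≡ n + f
  sum-gaps n f {prev} prev<n [] = trans (lem (n ∸ suc prev) f (suc prev)) (cong (_+ f) (ℕ.m∸n+n≡m prev<n))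
    where
    lem : ∀ a f p → a + f + 0 + p ≡ a + p + f
    lem = ℕSolver.solve-∀
  sum-gaps n f {prev} {q ∷ qs} prev<n ((p<q , q<n) ∷ a) = trans
    (lem (q ∸ suc prev) (sum (gapsAux n f q qs)) (length qs) (suc prev))
    (trans (cong (λ v → sum (gapsAux n f q qs) + (length qs + suc v)) (ℕ.m∸n+n≡m p<q)) (sum-gaps n f q<n a))
    where
    lem : ∀ a s l p → a + s + (suc l + p) ≡ s + (l + suc (a + p))
    lem = ℕSolver.solve-∀

  maximum-satisfies : ∀ {P : ℕ → Set} l → P 0 → All P l → P (maximum l)
  maximum-satisfies []      p0 []       = p0
  maximum-satisfies {P} (g ∷ l) p0 (pg ∷ ps) with ℕ.⊔-sel g (maximum l)
  ... | inj₁ e = subst P (sym e) pg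
  ... | inj₂ e = subst P (sym e) (maximum-satisfies l p0 ps)

  module StableSubset (s₀ m D n : ℕ) (enough : suc (suc s₀) * (m + 2) ≤ D * suc s₀) where
    open Selection s₀ m D enough
    open Entry

    -- There are at least as many positions as counted entries before `e`, and likewise from `e` on.
    -- This carries rank distances over to positions also for arcs that wrap around.
    Bounded : Entry → Set
    Bounded e = rk e ≤ pos e × pos e + (D * s + 1) ≤ n + rk e

    bounded : ∀ {t l z} → Chain Link t l z → rk t ≤ pos t → pos z + (D * s + 1) ≤ n + rk z → All Bounded (t ∷ l)
    bounded [] h h′ = (h , h′) ∷ []
    bounded {t} {u ∷ l} (link ∷ c) h h′ with bounded c
        (certify 0 (ℕ.+-mono-≤ (Link.advance link) h) (lem (rk t) (pos t) (rk u) (pos u))) h′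
      where
      lem : ∀ a b c d → c + (d + a + b) + 0 ≡ d + (c + b + a)
      lem = ℕSolver.solve-∀
    ... | (h″ , fin) ∷ ps = (h , certify 0 (ℕ.+-mono-≤ (Link.advance link) fin)
        (lem (rk t) (pos t) (rk u) (pos u) (D * s + 1) n)) ∷ (h″ , fin) ∷ ps
      where
      lem : ∀ a b c d e n → b + e + (d + a + (n + c)) + 0 ≡ n + a + (c + b + (d + e))
      lem = ℕSolver.solve-∀

    -- Next to a gap of size `g` the other gaps have total size `n - k - g`, and the condition asks
    -- for twice this to be at least `r (k - 3)`. For the largest gap it is stability on average.
    Narrow : ℕ → Set
    Narrow g = 2 * (g + (m + 3)) + suc s * m ≤ 2 * n

    chain-advance : ∀ {t l z} → Chain Spread t l z → rk z + pos t ≤ pos z + rk t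
    chain-advance {t} []      = ℕ.≤-reflexive (ℕ.+-comm (rk t) (pos t))
    chain-advance {t} {u ∷ l} {z} (h ∷ c) = certify 0
      (ℕ.+-mono-≤ (Before.advance (Spread.before h)) (chain-advance c))
      (lem (rk t) (pos t) (rk u) (pos u) (rk z) (pos z))
      where
      lem : ∀ a b c d e f → e + b + (d + a + (f + c)) + 0 ≡ f + a + (c + b + (e + d))
      lem = ℕSolver.solve-∀

    pos< : ∀ {t u} → Spread t u → pos t < pos u
    pos< {t} {u} h = certify 0 (ℕ.+-mono-≤ (Before.rank< (Spread.before h)) (Before.advance (Spread.before h)))
      (lem (rk t) (pos t) (rk u) (pos u))
      where
      lem : ∀ a b c d → suc b + (c + (d + a)) + 0 ≡ d + (suc a + (c + b))
      lem = ℕSolver.solve-∀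

    -- The arc from `u` around to `t` has at least as many positions as ranks, by `Bounded` at both
    -- ends, and `Spread` makes it at least `K / 2` ranks long.
    narrow-step : ∀ {t u} → Spread t u → Bounded t → Bounded u → Narrow (pos u ∸ suc (pos t))
    narrow-step {t} {u} h (h₁ , _) (_ , h₂) = certify 0
      (ℕ.+-mono-≤ (Spread.small h) (ℕ.+-mono-≤ (2*-mono h₂) (2*-mono h₁)))
      (trans (lem s₀ m (rk t) (pos t) (rk u) (D * s) n (pos u ∸ suc (pos t)))
        (cong (λ w → 2 * n + (K + 2 * rk u + (2 * (w + (D * s + 1)) + 2 * rk t)))
          (ℕ.m∸n+n≡m (pos< h))))
      where
      lem : ∀ s₀ m a b c d n g →
        2 * (g + (m + 3)) + suc (suc s₀) * m + (2 * (d + 1) + 2 * a + (2 * (n + c) + 2 * b)) + 0 ≡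
        2 * n + (suc (suc s₀) * m + 2 * m + 4 + 2 * c + (2 * (g + suc b + (d + 1)) + 2 * a))
      lem = ℕSolver.solve-∀

    narrow-wrap : ∀ {t l z} → Chain Spread t l z → Long z t → pos z < n → Narrow (n ∸ suc (pos z) + pos t)
    narrow-wrap {t} {z = z} c long z<n = subst (λ w → 2 * (g + pos t + (m + 3)) + suc s * m ≤ 2 * w) (ℕ.m∸n+n≡m z<n)
      (certify 0 (ℕ.+-mono-≤ long (2*-mono (chain-advance c))) (lem s₀ m (rk t) (pos t) (rk z) (pos z) g))
      where
      g = n ∸ suc (pos z)
      lem : ∀ s₀ m a b c d g →
        2 * (g + b + (m + 3)) + suc (suc s₀) * m + (2 * c + 2 * (d + a)) + 0 ≡
        2 * (g + suc d) + (suc (suc s₀) * m + 2 * m + 4 + 2 * a + 2 * (c + b))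
      lem = ℕSolver.solve-∀

    gaps-narrow : ∀ {t l z} f → Chain Spread t l z → All Bounded (t ∷ l) → Narrow (n ∸ suc (pos z) + f) →
      All Narrow (gapsAux n f (pos t) (List.map pos l))
    gaps-narrow f []      _             w = w ∷ []
    gaps-narrow f (h ∷ c) (b ∷ b′ ∷ bs) w = narrow-step h b b′ ∷ gaps-narrow f c (b′ ∷ bs) w

    module _ (x : SignVector (Fin r) n) (D≤ : D ≤ proj₁ (scan (0 , empty) x)) where

      Chosen : Fin r → Entry → Set
      Chosen i e = Bounded e × SignAt x i 0 e

      0<D : 0 < D
      0<D = ℕ.n≢0⇒n>0 λ { refl → case enough of λ { h → contradiction h (ℕ.<⇒≱ (ℕ.≤-trans (s≤s z≤n)
        (ℕ.≤-trans (ℕ.m≤n+m 2 m) (ℕ.m≤m+n (m + 2) _)))) } }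

      empty-proper : ¬ Full {r} empty
      empty-proper f = case f zero of λ ()

      popular : ∃ λ i → m + 2 < length (occurrences i (0 , empty) 0 x)
      popular = pigeonhole _ (m + 2) (ℕ.≤-trans (s≤s enough) (ℕ.≤-reflexive
        (trans (sym (total-occurrences 0 empty 0 x empty-proper 0<D D≤))
          (trans (cong (T +_) (trans (size-empty r) refl)) (ℕ.+-identityʳ T)))))
        where
        T = total (λ i → length (occurrences i (0 , empty) 0 x))

      selected : ∃ λ i → ∃ λ z → Selected (Chosen i) z
      selected with popular
      ... | i , many = i , go (track-start x refl (Vec.lookup-replicate i false) empty-proper
                                (ℕ.≤-reflexive (size-empty r)) 0<D D≤) many (occurrences-sign i (0 , empty) 0 x)
        where
        open Track n i
        go : ∀ {l} → Opening l → m + 2 < length l → All (SignAt x i 0) l → ∃ λ z → Selected (Chosen i) z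
        go (opening {t} {l} t≤s t≤p c) (s≤s many) signs = z , select (length l ∸ (m + 2)) (sym (ℕ.m∸n+n≡m many)) chain
            -- The full chain is `Long`: its ranks run from at most `s` to at least `D s - s`, and
            -- `2 (D s - 2 s)` exceeds `K` by at least `m * s₀`.
            (certify (m * s₀) (ℕ.+-mono-≤ (2*-mono t≤s) (ℕ.+-mono-≤ (2*-mono (Final.late final)) (2*-mono enough)))
              (lem s₀ m (rk t) (rk z) (D * s)))
            (All.zip (bounded chain t≤p (Final.finish final) , signs))
          where
          open Continuation c renaming (last to z)
          lem : ∀ s₀ m t z d → suc (suc s₀) * m + 2 * m + 4 + 2 * t + (2 * suc s₀ + (2 * (z + suc s₀) + 2 * d)) + m * s₀ ≡
            2 * z + (2 * t + (2 * d + 2 * (suc (suc s₀) * (m + 2))))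
          lem = ℕSolver.solve-∀

      ascending : ∀ {i t l z} → Chain Spread t l z → All (Chosen i) (t ∷ l) → ∀ {lo} → lo ≤ pos t →
        Ascending n lo (List.map pos (t ∷ l))
      ascending {t = t} c ((_ , (q , e , _)) ∷ ps) lo≤ = (lo≤ , subst (_< n) (sym e) (Fin.toℕ<n q)) ∷ rest c ps
        where
        rest : ∀ {i t l z} → Chain Spread t l z → All (Chosen i) l → Ascending n (suc (pos t)) (List.map pos l)
        rest []      []       = []
        rest (h ∷ c) (p ∷ ps) = ascending c (p ∷ ps) (pos< h)

      last-pos : ∀ {i t l z} → Chain Spread t l z → All (Chosen i) (t ∷ l) → pos z < n
      last-pos []      ((_ , (q , e , _)) ∷ []) = subst (_< n) (sym e) (Fin.toℕ<n q)
      last-pos (_ ∷ c) (_ ∷ ps)                 = last-pos c ps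

      stable-subset : ∃ λ i → ∃ λ σ → (∀ p → lookup σ p ≡ true → lookup x p ≡ just i) ×
        ∣ σ ∣ ≡ m + 3 × suc s * m ≤ 2 * sumNonMaxGaps σ
      stable-subset with selected
      ... | i , z , sel = i , σ , sign , size-σ , stability
        where
        open Selected sel
        ps = List.map pos rest
        σ = mark n 0 (List.map pos (first ∷ rest))
        asc : Ascending n 0 (List.map pos (first ∷ rest))
        asc = ascending chain within z≤n
        pos-σ : positions σ ≡ pos first ∷ ps
        pos-σ = positions-mark n 0 refl asc
        len : length ps ≡ m + 2
        len = trans (List.length-map pos rest) size
        size-σ : ∣ σ ∣ ≡ m + 3
        size-σ = trans (length-positions 0 σ) (trans (cong length pos-σ) (trans (cong suc len) (lem m)))
          where
          lem : ∀ m → suc (m + 2) ≡ m + 3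
          lem = ℕSolver.solve-∀
        sign : ∀ p → lookup σ p ≡ true → lookup x p ≡ just i
        sign p e = at within (subst (toℕ p ∈_) pos-σ (∈-positions 0 σ p e))
          where
          at : ∀ {l} → All (Chosen i) l → toℕ p ∈ List.map pos l → lookup x p ≡ just i
          at ((_ , (q , e , e′)) ∷ _) (here e″) = trans (cong (lookup x) (Fin.toℕ-injective (trans e″ e))) e′
          at (_ ∷ cs)                 (there m) = at cs m
        wrap : Narrow (n ∸ suc (pos z) + pos first)
        wrap = narrow-wrap chain long (last-pos chain within)
        gs = gapsAux n (pos first) (pos first) ps
        narrow : Narrow (maximum gs)
        narrow = maximum-satisfies gs
          -- The base value 0 of the fold is narrow because the wrapping gap is and a smaller gap
          -- remains narrow.
          (ℕ.≤-trans (ℕ.+-monoˡ-≤ (suc s * m) (2*-mono (ℕ.m≤n+m (m + 3) (n ∸ suc (pos z) + pos first)))) wrap)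
          (gaps-narrow (pos first) chain (All.map proj₁ within) wrap)
        total-gaps : sum gs + (m + 3) ≡ n
        total-gaps = ℕ.+-cancelʳ-≡ (pos first) _ n (trans (lem (sum gs) m (pos first))
            (trans (cong (λ w → sum gs + (w + suc (pos first))) (sym len)) (from-asc asc)))
          where
          lem : ∀ g m f → g + (m + 3) + f ≡ g + (m + 2 + suc f)
          lem = ℕSolver.solve-∀
          from-asc : Ascending n 0 (pos first ∷ ps) → sum gs + (length ps + suc (pos first)) ≡ n + pos first
          from-asc ((_ , f<n) ∷ a) = sum-gaps n (pos first) f<n a
        stability : suc s * m ≤ 2 * sumNonMaxGaps σ
        stability = subst (λ g → suc s * m ≤ 2 * (sum g ∸ maximum g)) (sym (gaps-positions σ pos-σ))
          (ℕ.≤-trans (ℕ.m+n≤o⇒m≤o∸n (suc s * m) (certify 0 narrow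
              (trans (cong (λ w → suc s * m + 2 * maximum gs + 2 * w + 0) (sym total-gaps)) (lem (maximum gs) (suc s * m) (sum gs) m))))
            (ℕ.≤-reflexive (sym (ℕ.*-distribˡ-∸ 2 (sum gs) (maximum gs)))))
          where
          lem : ∀ a c g m → c + 2 * a + 2 * (g + (m + 3)) + 0 ≡ 2 * g + (2 * (a + (m + 3)) + c)
          lem = ℕSolver.solve-∀

-- Rational arithmetic and the stability threshold

module Chromatic where
  open import Defs
  open import Data.Nat as ℕ using (ℕ; zero; suc; s≤s; z≤n; _∸_; _+_; _*_; _≤_; _<_; _⊓_)
  import Data.Nat.Properties as ℕ
  import Data.Nat.DivMod as ℕ
  import Data.Nat.Tactic.RingSolver as ℕSolver
  open import Data.Nat.Divisibility using (_∣_)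
  open import Data.Nat.Primality using (Prime)
  open import Data.Integer as ℤ using (ℤ; +_)
  import Data.Integer.Properties as ℤ
  import Data.Integer.DivMod as ℤ
  open import Data.Integer.Tactic.RingSolver using (solve-∀)
  open import Data.Rational as ℚ using (ℚ; mkℚ; 1ℚ; floor; ceiling; ↥_; ↧_; toℚᵘ)
  import Data.Rational.Properties as ℚ
  import Data.Rational.Unnormalised as ℚᵘ
  import Data.Rational.Unnormalised.Properties as ℚᵘ
  open import Data.Bool using (Bool; true; false)
  open import Data.Fin as Fin using (Fin; zero; suc; toℕ)
  import Data.Fin.Properties as Fin
  open import Data.Fin.Subset using (Subset; ∣_∣)
  open import Data.Fin.Subset.Properties using (x∈p∩q⁺; x∈p∩q⁻)
  open import Data.Maybe as Maybe using (Maybe; just; nothing)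
  import Data.Maybe.Properties as Maybe
  open import Data.Vec as Vec using (Vec; []; _∷_; lookup)
  import Data.Vec.Properties as Vec
  open import Data.Product using (∃; _×_; _,_; proj₁; proj₂)
  open import Data.Sum using (inj₁; inj₂)
  open import Data.Empty using (⊥; ⊥-elim)
  open import Function using (case_of_)
  open import Relation.Binary.PropositionalEquality using (_≡_; _≢_; refl; sym; trans; cong; cong₂; subst; subst₂)
  open import Relation.Nullary
  open Obstruction
  open BlockLabelling
  open StableExtraction

  <suc⇒≤ : ∀ {i j} → i ℤ.< ℤ.suc j → i ℤ.≤ j
  <suc⇒≤ {i} {j} h = subst₂ ℤ._≤_ (ℤ.pred-suc i) (ℤ.pred-suc j) (ℤ.+-monoʳ-≤ ℤ.-1ℤ (ℤ.i<j⇒suc[i]≤j h))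

  floor-unique : ∀ q y → y ℤ.* ↧ q ℤ.≤ ↥ q → ↥ q ℤ.< ℤ.suc y ℤ.* ↧ q → floor q ≡ y
  floor-unique (mkℚ n d-1 _) y lo hi = trans (ℤ.div-pos-is-/ℕ n (suc d-1)) (ℤ.≤-antisym
    (<suc⇒≤ (ℤ.*-cancelʳ-<-nonNeg (+ suc d-1) (ℤ.≤-<-trans (ℤ.[n/ℕd]*d≤n n (suc d-1)) hi)))
    (<suc⇒≤ (ℤ.*-cancelʳ-<-nonNeg (+ suc d-1) (ℤ.≤-<-trans lo (ℤ.n<s[n/ℕd]*d n (suc d-1))))))

  ceiling-unique : ∀ q c → ↥ q ℤ.≤ c ℤ.* ↧ q → c ℤ.* ↧ q ℤ.< ↥ q ℤ.+ ↧ q → ceiling q ≡ c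
  ceiling-unique q@(mkℚ n d-1 _) c lo hi = trans (cong ℤ.-_ (floor-unique (ℚ.- q) (ℤ.- c) lower upper)) (ℤ.neg-involutive c)
    where
    d = + suc d-1
    lower : ℤ.- c ℤ.* ↧ (ℚ.- q) ℤ.≤ ↥ (ℚ.- q)
    lower = subst₂ ℤ._≤_ (trans (ℤ.neg-distribˡ-* c d) (cong (ℤ.- c ℤ.*_) (sym (ℚ.↧-neg q)))) (sym (ℚ.↥-neg q)) (ℤ.neg-mono-≤ lo)
    upper : ↥ (ℚ.- q) ℤ.< ℤ.suc (ℤ.- c) ℤ.* ↧ (ℚ.- q)
    upper = subst₂ ℤ._<_ (trans (lem₁ n d (c ℤ.* d)) (sym (ℚ.↥-neg q))) (trans (lem₂ n d c) (cong (ℤ.suc (ℤ.- c) ℤ.*_) (sym (ℚ.↧-neg q))))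
      (ℤ.+-monoˡ-< (ℤ.- n ℤ.- c ℤ.* d) hi)
      where
      lem₁ : ∀ n d w → w ℤ.+ (ℤ.- n ℤ.- w) ≡ ℤ.- n
      lem₁ = solve-∀
      lem₂ : ∀ n d c → n ℤ.+ d ℤ.+ (ℤ.- n ℤ.- c ℤ.* d) ≡ (+ 1 ℤ.+ ℤ.- c) ℤ.* d
      lem₂ = solve-∀

  -- The quotient is stored in lowest terms, so the bounds pass to its own numerator and denominator
  -- by cross multiplication.
  ceiling-fraction : ∀ z d c → z ℤ.≤ c ℤ.* + suc d → c ℤ.* + suc d ℤ.< z ℤ.+ + suc d → ceiling (z ℚ./ suc d) ≡ c
  ceiling-fraction z d c lo hi = unique (z ℚ./ suc d) (cross (z ℚ./ suc d) (ℚ.toℚᵘ-fromℚᵘ (ℚᵘ.mkℚᵘ z d)))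
    where
    D = + suc d
    cross : ∀ q → toℚᵘ q ℚᵘ.≃ ℚᵘ.mkℚᵘ z d → ↥ q ℤ.* D ≡ z ℤ.* ↧ q
    cross (mkℚ _ _ _) (ℚᵘ.*≡* e) = e
    unique : ∀ q → ↥ q ℤ.* D ≡ z ℤ.* ↧ q → ceiling q ≡ c
    unique q@(mkℚ n e-1 _) eq = ceiling-unique q c
      (ℤ.*-cancelʳ-≤-pos n (c ℤ.* ↧ q) D (subst₂ ℤ._≤_ (sym eq) (swap c D (↧ q)) (ℤ.*-monoʳ-≤-nonNeg (↧ q) lo)))
      (ℤ.*-cancelʳ-<-nonNeg D (subst₂ ℤ._<_ (swap c D (↧ q)) lem (ℤ.*-monoʳ-<-pos (↧ q) hi)))
      where
      swap : ∀ c D e → c ℤ.* D ℤ.* e ≡ c ℤ.* e ℤ.* D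
      swap = solve-∀
      lem′ : ∀ z D e → (z ℤ.+ D) ℤ.* e ≡ z ℤ.* e ℤ.+ e ℤ.* D
      lem′ = solve-∀
      lem : (z ℤ.+ D) ℤ.* ↧ q ≡ (n ℤ.+ ↧ q) ℤ.* D
      lem = trans (lem′ z D (↧ q)) (trans (cong (ℤ._+ (↧ q ℤ.* D)) (sym eq)) (sym (ℤ.*-distribʳ-+ D n (↧ q))))

  fraction-≤ : ∀ a b d e → a * suc e ≤ b * suc d → (+ a ℚ./ suc d) ℚ.≤ (+ b ℚ./ suc e)
  fraction-≤ a b d e h = ℚ.toℚᵘ-cancel-≤ (ℚᵘ.≤-trans (ℚᵘ.≤-reflexive (ℚ.toℚᵘ-fromℚᵘ (ℚᵘ.mkℚᵘ (+ a) d)))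
    (ℚᵘ.≤-trans (ℚᵘ.*≤* (subst₂ ℤ._≤_ (ℤ.pos-* a (suc e)) (ℤ.pos-* b (suc d)) (ℤ.+≤+ h)))
      (ℚᵘ.≤-reflexive (ℚᵘ.≃-sym (ℚ.toℚᵘ-fromℚᵘ (ℚᵘ.mkℚᵘ (+ b) e))))))

  threshold : ℕ → ℕ → ℚ
  threshold r k = frac (+ (r * (k ∸ 3))) (2 * (k ∸ 1)) ℚ.+ 1ℚ

  stable-on-average : ∀ {n} r m (σ : Subset n) → ∣ σ ∣ ≡ 3 + m → r * m ≤ 2 * sumNonMaxGaps σ →
    StableOnAverage (threshold r (3 + m)) σ
  stable-on-average r m σ size h = subst (λ j → threshold r (3 + m) ℚ.≤ frac (+ sumNonMaxGaps σ) (j ∸ 1) ℚ.+ 1ℚ) (sym size)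
    (ℚ.+-monoˡ-≤ 1ℚ (fraction-≤ (r * m) (sumNonMaxGaps σ) _ (suc m)
      (ℕ.≤-trans (ℕ.*-monoˡ-≤ (2 + m) h) (ℕ.≤-reflexive (lem (sumNonMaxGaps σ) m)))))
    where
    lem : ∀ g m → 2 * g * (2 + m) ≡ g * (2 * (2 + m))
    lem = ℕSolver.solve-∀

  -- Lower bound: a colouring yields a labelling

  module LowerBound (s₀ m D n c : ℕ) (enough : suc (suc s₀) * (m + 2) ≤ D * suc s₀)
    (room : (D + c) * suc s₀ < n)
    (t : ℚ)
    (spread⇒stable : ∀ (σ : Subset n) → ∣ σ ∣ ≡ 3 + m → suc (suc s₀) * m ≤ 2 * sumNonMaxGaps σ → StableOnAverage t σ)
    (f : Vertex (3 + m) n t → Fin c) (isColoring : IsColoring (2 + s₀) (3 + m) n t c f) where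

    r : ℕ
    r = 2 + s₀

    stable? : ∀ (σ : Subset n) → Dec (StableOnAverage t σ)
    stable? σ = t ℚ.≤? _

    -- A vertex carries proofs on which `f` may depend. The colour of a set is read off at the
    -- proofs that the decisions return, so each set stands for one vertex.
    colourBy : ∀ σ → Dec (∣ σ ∣ ≡ 3 + m) → Dec (StableOnAverage t σ) → Maybe ℕ
    colourBy σ (yes e) (yes h) = just (toℕ (f (σ , e , h)))
    colourBy σ (yes _) (no _)  = nothing
    colourBy σ (no _)  _       = nothing

    colour : Subset n → Maybe ℕ
    colour σ = colourBy σ (∣ σ ∣ ℕ.≟ 3 + m) (stable? σ)

    colour-vertex : ∀ σ j → colour σ ≡ just j → ∃ λ (v : Vertex (3 + m) n t) → proj₁ v ≡ σ × toℕ (f v) ≡ j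
    colour-vertex σ j = go (∣ σ ∣ ℕ.≟ 3 + m) (stable? σ)
      where
      go : ∀ d d′ → colourBy σ d d′ ≡ just j → ∃ λ (v : Vertex (3 + m) n t) → proj₁ v ≡ σ × toℕ (f v) ≡ j
      go (yes e) (yes h) eq = (σ , e , h) , refl , Maybe.just-injective eq

    colour-stable : ∀ σ → ∣ σ ∣ ≡ 3 + m → StableOnAverage t σ → ∃ λ j → j < c × colour σ ≡ just j
    colour-stable σ e h = go (∣ σ ∣ ℕ.≟ 3 + m) (stable? σ)
      where
      go : ∀ d d′ → ∃ λ j → j < c × colourBy σ d d′ ≡ just j
      go (yes e′) (yes h′) = _ , Fin.toℕ<n (f (σ , e′ , h′)) , refl
      go (yes _)  (no ¬h)  = ⊥-elim (¬h h)
      go (no ¬e)  _        = ⊥-elim (¬e e)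

    no-monochromatic : ∀ j (σ : Fin r → Subset n) → (∀ i → colour (σ i) ≡ just j) →
      ¬ (∀ {i i′} p → lookup (σ i) p ≡ true → lookup (σ i′) p ≡ true → i ≡ i′)
    no-monochromatic j σ col disjoint = isColoring vertex hyperedge λ i i′ → Fin.toℕ-injective
        (trans (proj₂ (proj₂ (spec i))) (sym (proj₂ (proj₂ (spec i′)))))
      where
      spec : ∀ i → ∃ λ (v : Vertex (3 + m) n t) → proj₁ v ≡ σ i × toℕ (f v) ≡ j
      spec i = colour-vertex (σ i) j (col i)
      vertex : Fin r → Vertex (3 + m) n t
      vertex i = proj₁ (spec i)
      hyperedge : IsHyperedge vertex
      hyperedge i i′ i≢i′ (p , p∈) = i≢i′ (disjoint p (at i (proj₁ p∈′)) (at i′ (proj₂ p∈′)))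
        where
        p∈′ = x∈p∩q⁻ (proj₁ (vertex i)) (proj₁ (vertex i′)) p∈
        at : ∀ i → Vec._[_]=_ (proj₁ (vertex i)) p true → lookup (σ i) p ≡ true
        at i h = trans (cong (λ τ → lookup τ p) (sym (proj₁ (proj₂ (spec i))))) (Vec.[]=⇒lookup h)

    open ColouredSubsets {r} {n} (s≤s (s≤s z≤n)) colour D c

    found : ∀ x → D ≤ proj₁ (scan (0 , empty) x) → ∃ λ i → ∃ λ σ → ∃ λ j → j < c × Hit j x i σ
    found x D≤ =
      let (i , σ , within , size , spread) = StableSubset.stable-subset s₀ m D n enough x D≤
          size′ = trans size (ℕ.+-comm m 3)
          (j , j<c , col) = colour-stable σ size′ (spread⇒stable σ size′ spread)
      in i , σ , j , j<c , within , col

    impossible : ∀ p e → Prime p → r ≡ p ℕ.^ e → ⊥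
    impossible p e p-prime r≡ = Coloured.impossible no-monochromatic found p e p-prime r≡ room

  -- Upper bound: colouring by minima

  firstElement : ∀ {n} → Subset n → ℕ
  firstElement []          = 0
  firstElement (true ∷ σ)  = 0
  firstElement (false ∷ σ) = suc (firstElement σ)

  firstElement-∈ : ∀ {n} (σ : Subset n) → 1 ≤ ∣ σ ∣ → ∃ λ p → toℕ p ≡ firstElement σ × lookup σ p ≡ true
  firstElement-∈ (true ∷ σ)  _ = zero , refl , refl
  firstElement-∈ (false ∷ σ) h with firstElement-∈ σ h
  ... | p , e , e′ = suc p , cong suc e , e′

  total-+ : ∀ {r} (f g : Fin r → ℕ) → total (λ i → f i + g i) ≡ total f + total g
  total-+ {zero}  f g = refl
  total-+ {suc r} f g = trans (cong (λ w → f zero + g zero + w) (total-+ (λ i → f (suc i)) (λ i → g (suc i))))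
    (lem (f zero) (g zero) _ _)
    where
    lem : ∀ a b c d → a + b + (c + d) ≡ a + c + (b + d)
    lem = ℕSolver.solve-∀

  total-const : ∀ r k → total {r} (λ _ → k) ≡ r * k
  total-const zero    k = refl
  total-const (suc r) k = cong (λ w → k + w) (total-const r k)

  bit : Bool → ℕ
  bit true  = 1
  bit false = 0

  total-bits : ∀ {r} (b : Fin r → Bool) → (∀ i j → b i ≡ true → b j ≡ true → i ≡ j) → total (λ i → bit (b i)) ≤ 1
  total-bits {zero}  b h = z≤n
  total-bits {suc r} b h with b zero in eq
  ... | false = total-bits (λ i → b (suc i)) (λ i j e e′ → Fin.suc-injective (h (suc i) (suc j) e e′))
  ... | true  = s≤s (ℕ.≤-reflexive (trans (total-cong λ i → cong bit (¬true⇒false {b (suc i)}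
                  λ e → case h zero (suc i) eq e of λ ())) (total-0 r)))

  PairwiseDisjoint : ∀ {r n} → (Fin r → Subset n) → Set
  PairwiseDisjoint σ = ∀ i j p → lookup (σ i) p ≡ true → lookup (σ j) p ≡ true → i ≡ j

  -- Counted position by position: each lies in at most one of the sets, and each of the first `b`
  -- positions in none.
  total-disjoint : ∀ {r} n b (σ : Fin r → Subset n) → PairwiseDisjoint σ → (∀ i → b ≤ firstElement (σ i)) →
    b ≤ n → total (λ i → ∣ σ i ∣) + b ≤ n
  total-disjoint {r} zero zero σ d h b≤n = ℕ.≤-reflexive (trans (ℕ.+-identityʳ _)
    (trans (total-cong (λ i → empty-size (σ i))) (total-0 r)))
    where
    empty-size : (τ : Subset 0) → ∣ τ ∣ ≡ 0
    empty-size [] = refl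
  total-disjoint {r} (suc n) b σ d h b≤n = split b h b≤n
    where
    heads : Fin r → Bool
    heads i = Vec.head (σ i)
    tails : Fin r → Subset n
    tails i = Vec.tail (σ i)
    size : ∀ (τ : Subset (suc n)) → ∣ τ ∣ ≡ bit (Vec.head τ) + ∣ Vec.tail τ ∣
    size (true ∷ τ)  = refl
    size (false ∷ τ) = refl
    lookup-head : ∀ (τ : Subset (suc n)) → lookup τ zero ≡ Vec.head τ
    lookup-head (_ ∷ _) = refl
    lookup-tail : ∀ (τ : Subset (suc n)) p → lookup τ (suc p) ≡ lookup (Vec.tail τ) p
    lookup-tail (_ ∷ _) p = refl
    d′ : PairwiseDisjoint tails
    d′ i j p e e′ = d i j (suc p) (trans (lookup-tail (σ i) p) e) (trans (lookup-tail (σ j) p) e′)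
    sizes : total (λ i → ∣ σ i ∣) ≡ total (λ i → bit (heads i)) + total (λ i → ∣ tails i ∣)
    sizes = trans (total-cong (λ i → size (σ i))) (total-+ (λ i → bit (heads i)) (λ i → ∣ tails i ∣))
    later : ∀ b (τ : Subset (suc n)) → suc b ≤ firstElement τ → Vec.head τ ≡ false × b ≤ firstElement (Vec.tail τ)
    later b (false ∷ τ) (s≤s h) = refl , h
    split : ∀ b → (∀ i → b ≤ firstElement (σ i)) → b ≤ suc n → total (λ i → ∣ σ i ∣) + b ≤ suc n
    split zero h _ = ℕ.≤-trans (ℕ.≤-reflexive (trans (ℕ.+-identityʳ _) sizes))
      (ℕ.+-mono-≤ (total-bits heads (λ i j e e′ → d i j zero (trans (lookup-head (σ i)) e) (trans (lookup-head (σ j)) e′)))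
        (ℕ.≤-trans (ℕ.≤-reflexive (sym (ℕ.+-identityʳ _))) (total-disjoint n 0 tails d′ (λ _ → z≤n) z≤n)))
    split (suc b) h (s≤s b≤n) = ℕ.≤-trans (ℕ.≤-reflexive (trans (cong (_+ suc b) (trans sizes
        (cong (_+ total (λ i → ∣ tails i ∣)) (trans (total-cong (λ i → cong bit (proj₁ (later b (σ i) (h i))))) (total-0 r)))))
        (ℕ.+-suc _ b)))
      (s≤s (total-disjoint n b tails d′ (λ i → proj₂ (later b (σ i) (h i))) b≤n))

  module UpperBound (s₀ k n χ : ℕ) (t : ℚ) (0<k : 0 < k)
    (fits : n < suc (suc s₀) * k + χ * suc s₀) (inside : χ * suc s₀ ≤ n) where

    s r : ℕ
    s = suc s₀
    r = suc s

    colour : Vertex k n t → ℕ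
    colour (σ , _) = (firstElement σ ℕ./ s) ⊓ χ

    coloring : Vertex k n t → Fin (suc χ)
    coloring v = Fin.fromℕ< (s≤s (ℕ.m⊓n≤n (firstElement (proj₁ v) ℕ./ s) χ))

    toℕ-coloring : ∀ v → toℕ (coloring v) ≡ colour v
    toℕ-coloring v = Fin.toℕ-fromℕ< _

    module _ (e : Fin r → Vertex k n t) (hyperedge : IsHyperedge e)
      (monochromatic : ∀ i j → coloring (e i) ≡ coloring (e j)) where

      σ : Fin r → Subset n
      σ i = proj₁ (e i)

      first : Fin r → ℕ
      first i = firstElement (σ i)

      disjoint : PairwiseDisjoint σ
      disjoint i j p h h′ with i Fin.≟ j
      ... | yes i≡j = i≡j
      ... | no i≢j  = ⊥-elim (hyperedge i j i≢j
              (p , x∈p∩q⁺ (Vec.lookup⇒[]= p (σ i) h , Vec.lookup⇒[]= p (σ j) h′)))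

      first-injective : ∀ i j → first i ≡ first j → i ≡ j
      first-injective i j eq with firstElement-∈ (σ i) (nonempty i) | firstElement-∈ (σ j) (nonempty j)
        where
        nonempty : ∀ i → 1 ≤ ∣ σ i ∣
        nonempty i = subst (1 ≤_) (sym (proj₁ (proj₂ (e i)))) 0<k
      ... | p , h , h′ | q , g , g′ = disjoint i j p h′
              (trans (cong (lookup (σ j)) (Fin.toℕ-injective (trans h (trans eq (sym g))))) g′)

      same : ∀ i j → colour (e i) ≡ colour (e j)
      same i j = trans (sym (toℕ-coloring (e i))) (trans (cong toℕ (monochromatic i j)) (toℕ-coloring (e j)))

      absurd : ⊥
      absurd with χ ℕ.≤? first zero ℕ./ s
      -- In the last colour all `r` disjoint sets avoid the first `χ s` positions, which leaves
      -- fewer than the `r k` places that they need.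
      ... | yes last = ℕ.<-irrefl refl (ℕ.<-≤-trans fits (ℕ.≤-trans
              (ℕ.≤-reflexive (cong (_+ χ * s) (sym (trans (total-cong (λ i → proj₁ (proj₂ (e i)))) (total-const r k)))))
              (total-disjoint n (χ * s) σ disjoint late inside)))
        where
        late : ∀ i → χ * s ≤ first i
        late i = ℕ.≤-trans (ℕ.*-monoˡ-≤ s χ≤) (ℕ.m/n*n≤m (first i) s)
          where
          χ≤ : χ ≤ first i ℕ./ s
          χ≤ = ℕ.≤-trans (ℕ.≤-reflexive (trans (sym (ℕ.m≥n⇒m⊓n≡n last)) (same zero i))) (ℕ.m⊓n≤m (first i ℕ./ s) χ)
      -- In any other colour the `r` minima have the same quotient by `s`, and there are only
      -- `s = r - 1` residues, so two minima coincide.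
      ... | no early with Fin.pigeonhole ℕ.≤-refl (λ i → Fin.fromℕ< (ℕ.m%n<n (first i) s))
      ...   | i , j , i<j , eq = ℕ.<-irrefl (cong toℕ (first-injective i j (trans (ℕ.m≡m%n+[m/n]*n (first i) s)
                (trans (cong₂ (λ a b → a + b * s) residues (trans (quotient i) (sym (quotient j))))
                  (sym (ℕ.m≡m%n+[m/n]*n (first j) s)))))) i<j
        where
        residues : first i ℕ.% s ≡ first j ℕ.% s
        residues = trans (sym (Fin.toℕ-fromℕ< (ℕ.m%n<n (first i) s))) (trans (cong toℕ eq) (Fin.toℕ-fromℕ< (ℕ.m%n<n (first j) s)))
        quotient : ∀ i → first i ℕ./ s ≡ first zero ℕ./ s
        quotient i = unmin (first i ℕ./ s) (trans (same i zero) (ℕ.m≤n⇒m⊓n≡m (ℕ.<⇒≤ (ℕ.≰⇒> early))))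
          where
          unmin : ∀ a → a ⊓ χ ≡ first zero ℕ./ s → a ≡ first zero ℕ./ s
          unmin a h with ℕ.⊓-sel a χ
          ... | inj₁ e = trans (sym e) h
          ... | inj₂ e = ⊥-elim (early (ℕ.≤-reflexive (trans (sym e) h)))

    colorable : Colorable r k n t (suc χ)
    colorable = coloring , λ e h mono → absurd e h mono

  -- The value of the chromatic number

  module Solution (s₀ m q : ℕ) (large : suc (suc s₀) * (3 + m) ≤ suc (q * suc s₀)) where
    -- `R` is `r (k - 1)`, and `D` is the ceiling of `R / s`, written as one more than the floor `d`
    -- of `(R - 1) / s`. The chromatic number is `suc χ`, that is `q - d`.
    s r R d D χ n : ℕ
    s = suc s₀
    r = suc s
    R = r * (m + 2)
    d = (R ∸ 1) ℕ./ s
    D = suc d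
    χ = q ∸ D
    n = suc (q * s)

    R-pred : suc (R ∸ 1) ≡ R
    R-pred = ℕ.suc-pred R ⦃ ℕ.>-nonZero 0<R ⦄
      where
      0<R : 0 < R
      0<R = ℕ.≤-trans (s≤s z≤n) (ℕ.≤-trans (ℕ.m≤n+m 2 m) (ℕ.m≤m+n (m + 2) (s * (m + 2))))

    enough : R ≤ D * s
    enough = ℕ.≤-trans (ℕ.≤-reflexive (trans (sym R-pred) (cong suc (ℕ.m≡m%n+[m/n]*n (R ∸ 1) s))))
      (ℕ.+-monoˡ-≤ (d * s) (ℕ.m%n<n (R ∸ 1) s))

    minimal : suc (d * s) ≤ R
    minimal = ℕ.≤-trans (s≤s (ℕ.m/n*n≤m (R ∸ 1) s)) (ℕ.≤-reflexive R-pred)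

    -- The bound `r k ≤ n` enters here; it makes the truncated subtraction in `χ` exact.
    D≤q : D ≤ q
    D≤q = ℕ.*-cancelʳ-< s d q (certify (suc s₀) (ℕ.+-mono-≤ minimal large) (lem s₀ m (d * s) (q * s)))
      where
      lem : ∀ s₀ m a b → suc a + (suc (suc s₀) * (m + 2) + suc b) + suc s₀ ≡ b + (suc a + suc (suc s₀) * (3 + m))
      lem = ℕSolver.solve-∀

    q-split : χ * s + (s + d * s) ≡ q * s
    q-split = trans (sym (ℕ.*-distribʳ-+ s χ D)) (cong (_* s) (ℕ.m∸n+n≡m D≤q))

    chromatic-number : ∀ p e → Prime p → r ≡ p ℕ.^ e → ChromaticNumberIs r (3 + m) n (threshold r (3 + m)) (suc χ)
    chromatic-number p e p-prime r≡ = UpperBound.colorable s₀ (3 + m) n χ (threshold r (3 + m)) (s≤s z≤n) fits inside , minimum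
      where
      fits : n < r * (3 + m) + χ * s
      fits = certify 0 minimal (trans (cong (λ w → suc (suc w) + R + 0) (sym q-split)) (lem s₀ m (χ * s) (d * s)))
        where
        lem : ∀ s₀ m a b → suc (suc (a + (suc s₀ + b))) + suc (suc s₀) * (m + 2) + 0 ≡
          suc (suc s₀) * (3 + m) + a + suc b
        lem = ℕSolver.solve-∀
      inside : χ * s ≤ n
      inside = ℕ.≤-trans (ℕ.m≤m+n (χ * s) _) (ℕ.≤-trans (ℕ.≤-reflexive q-split) (ℕ.n≤1+n (q * s)))
      minimum : ∀ c → Colorable r (3 + m) n (threshold r (3 + m)) c → suc χ ≤ c
      minimum c (f , isColoring) = ℕ.≮⇒≥ λ { (s≤s c≤χ) →
        LowerBound.impossible s₀ m D n c enough
          -- With `c ≤ χ` one has `D + c ≤ q`, and `q s` is exactly `n - 1`, so the ranks stay below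
          -- `n`.
          (s≤s (ℕ.*-monoˡ-≤ s (ℕ.≤-trans (ℕ.+-monoʳ-≤ D c≤χ) (ℕ.≤-reflexive (ℕ.m+[n∸m]≡n D≤q)))))
          (threshold r (3 + m)) (stable-on-average r m) f isColoring p e p-prime r≡ }

    -- Since `n = q s + 1`, the fraction is `q - (R - 1) / s`, whose ceiling is `q` minus the floor
    -- `d`.
    ceiling-value : + suc χ ≡ ceiling (frac (+ n ℤ.- + (r * (2 + m))) s)
    ceiling-value = sym (ceiling-fraction (+ n ℤ.- + R′) s₀ (+ suc χ) lower upper)
      where
      R′ = r * (2 + m)
      R≡ : R ≡ R′
      R≡ = cong (r *_) (ℕ.+-comm m 2)
      n≤ : n ≤ suc χ * s + R′
      n≤ = subst (λ w → n ≤ suc χ * s + w) R≡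
        (certify 0 minimal (trans (cong (λ w → suc w + R + 0) (sym q-split)) (lem s (χ * s) (d * s) R)))
        where
        lem : ∀ s a b R → suc (a + (s + b)) + R + 0 ≡ s + a + R + suc b
        lem = ℕSolver.solve-∀
      <n : suc (suc χ * s + R′) ≤ n + s
      <n = subst (λ w → suc (suc χ * s + w) ≤ n + s) R≡
        (certify 0 enough (trans (lem s (χ * s) (d * s) R) (cong (λ w → suc w + s + R) q-split)))
        where
        lem : ∀ s a b R → suc (s + a + R) + (s + b) + 0 ≡ suc (a + (s + b)) + s + R
        lem = ℕSolver.solve-∀
      cancel : ∀ a b → a ℤ.+ b ℤ.- b ≡ a
      cancel = solve-∀
      swap : ∀ a b c → a ℤ.+ c ℤ.- b ≡ a ℤ.- b ℤ.+ c
      swap = solve-∀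
      product : + (suc χ * s + R′) ≡ + suc χ ℤ.* + s ℤ.+ + R′
      product = trans (ℤ.pos-+ (suc χ * s) R′) (cong (ℤ._+ + R′) (ℤ.pos-* (suc χ) s))
      difference : + (suc χ * s + R′) ℤ.- + R′ ≡ + suc χ ℤ.* + s
      difference = trans (cong (ℤ._- + R′) product) (cancel (+ suc χ ℤ.* + s) (+ R′))
      lower : + n ℤ.- + R′ ℤ.≤ + suc χ ℤ.* + s
      lower = subst (+ n ℤ.- + R′ ℤ.≤_) difference (ℤ.+-monoˡ-≤ (ℤ.- + R′) (ℤ.+≤+ n≤))
      upper : + suc χ ℤ.* + s ℤ.< + n ℤ.- + R′ ℤ.+ + s
      upper = subst₂ ℤ._<_ difference
        (trans (cong (ℤ._- + R′) (ℤ.pos-+ n s)) (swap (+ n) (+ R′) (+ s)))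
        (ℤ.+-monoˡ-< (ℤ.- + R′) (ℤ.+<+ <n))

open import Defs
open import Data.Nat using (ℕ; suc; s≤s; _≤_; _∸_; _*_)
open import Data.Nat.Divisibility using (_∣_; divides)
open import Data.Integer using (+_; _-_)
open import Data.Rational using (ℚ; ceiling; 1ℚ; _+_)
open import Data.Product using (Σ; _×_; _,_)
open import Relation.Binary.PropositionalEquality using (_≡_; refl)
open Chromatic

theorem6p5 : (r n k : ℕ) → IsPrimePower r → 2 ≤ r → 1 ≤ n → (r ∸ 1) ∣ (n ∸ 1) → 4 ≤ k →
    r * k ≤ n →
    Σ ℕ λ χ →
    ChromaticNumberIs r k n (frac (+ (r * (k ∸ 3))) (2 * (k ∸ 1)) + 1ℚ) χ
    × (+ χ ≡ ⌈ frac (+ n - + (r * (k ∸ 1))) (r ∸ 1) ⌉)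
theorem6p5 (suc (suc s₀)) (suc _) (suc (suc (suc m))) (p , e , p-prime , _ , r≡) _ _ (divides q refl) _ large =
  _ , Solution.chromatic-number s₀ m q large p e p-prime r≡ , Solution.ceiling-value s₀ m q large
theorem6p5 1 _ _ _ (s≤s ())
theorem6p5 _ _ 1 _ _ _ _ (s≤s ())
theorem6p5 _ _ 2 _ _ _ _ (s≤s (s≤s ()))
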